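{- There is a parameter-preserving reduction from Bipartite One-sided Vertex Explosion (BOVE) to Co-Path Set (CPS). Additionally, there is a parameter-preserving reduction from restricted BOVE to restricted CPS. In all four problems the parameter is $k$.
   Context: Graphs are finite, undirected and simple. Vertex explosion: exploding a vertex $v$ of a graph removes $v$ and, for each former neighbor $u$ of $v$, adds a new vertex adjacent only to $u$. Exploding every vertex of a set $S$ means exploding the vertices of $S$ one after another (the order does not matter up to isomorphism). A path decomposition of $G$ is a sequence $X_1,\ldots,X_s$ of vertex sets such that every vertex lies in some $X_i$, both endpoints of every edge lie in some common $X_i$, and $X_i\cap X_j\subseteq X_l$ for all $i\le l\le j$; its width is $\max_i|X_i|-1$, and the pathwidth of $G$ is the minimum width of a path decomposition of $G$. A graph is a linear forest if every connected component is a path (a single vertex is a path). BOVE: the input is a bipartite graph $G=(T,B,E)$ (with its bipartition $T,B$) and an integer $k\ge 0$; the question is whether there is $S\subseteq B$ with $|S|\le k$ such that exploding every vertex in $S$ results in a graph with pathwidth at most one. Restricted BOVE: the input additionally contains a set $X\subseteq B$, and $S$ is required to be a subset of $X$. CPS: the input is a graph $G$ and an integer $k\ge 0$; the question is whether there is $S\subseteq E(G)$ with $|S|\le k$ such that deleting the edges in $S$ (keeping all vertices) results in a linear forest. Restricted CPS: the input additionally contains a set $X\subseteq E(G)$, and $S$ is required to be a subset of $X$. A parameter-preserving reduction from a parameterized problem $P$ to a parameterized problem $Q$ is a polynomial-time algorithm that maps each instance $(I,k)$ of $P$ to an instance $(I',k')$ of $Q$ such that $k'\le k$ and $(I,k)$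 is a yes-instance of $P$ if and only if $(I',k')$ is a yes-instance of $Q$. -}

module Defs where

open import Data.Bool using (Bool; true; false; T)
open import Data.Empty using (⊥)
open import Data.Fin using (Fin; zero; suc; toℕ)
import Data.Fin as Fin
open import Data.Fin.Properties using (0≢1+n; suc-injective; _<?_)
open import Data.Fin.Subset using (Subset; _⊆_; ∣_∣)
open import Data.Fin.Subset.Properties using (_∈?_)
open import Data.Irrelevant using ([_])
open import Data.List using (List; []; _∷_; length; lookup; map; foldr; filter; allFin; tabulate; replicate; cartesianProduct)
open import Data.List.Membership.Propositional using (_∈_)
open import Data.List.Membership.Propositional.Properties using (∈-lookup)
import Data.List.Relation.Unary.All as All
open import Data.List.Relation.Unary.All using (All)
open import Data.List.Relation.Unary.AllPairs using (_∷_)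
open import Data.List.Relation.Unary.Any using (Any)
open import Data.List.Relation.Unary.Unique.Propositional using (Unique)
open import Data.List.Relation.Unary.Unique.Propositional.Properties using (allFin⁺; filter⁺)
open import Data.Nat using (ℕ; zero; suc; _+_; _*_; _∸_; _^_; _⊔_; _≤_)
open import Data.Nat.Binary using (ℕᵇ; 2[1+_]; 1+[2_]; fromℕ)
open import Data.Product using (Σ-syntax; ∃-syntax; _×_; _,_; proj₁; proj₂)
open import Data.Refinement using (Refinement-syntax; value; _,_)
open import Data.Sum using (_⊎_; inj₁; inj₂)
open import Data.Sum.Properties using (inj₁-injective; inj₂-injective)
import Data.Vec as Vec
open import Function using (_∘_; _⇔_; _↔_; Inverse; Injective)
open import Relation.Binary.Construct.Closure.ReflexiveTransitive using (Star)
open import Relation.Binary.PropositionalEquality using (_≡_; _≢_; refl; sym; cong)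
open import Relation.Nullary using (¬_; contradiction)
open import Relation.Nullary.Decidable using (T?; _×-dec_)

------------------------------------------------------------------------
-- Graphs

-- Finiteness is not a field: the graphs occurring in instances have
-- vertices Fin n or Fin t ⊎ Fin b, and all others are derived from these.
-- Subtypes of vertices use irrelevant proofs, so that equality of vertices
-- is equality of the underlying values.

record Graph : Set₁ where
  field
    Vertex : Set
    _~_    : Vertex → Vertex → Set
    ~-sym  : ∀ {u v} → u ~ v → v ~ u
    ~-irr  : ∀ {v} → ¬ v ~ v

open Graph using (Vertex)

infix 4 _∋_~_
_∋_~_ : (G : Graph) → Vertex G → Vertex G → Set
G ∋ u ~ v = Graph._~_ G u v

record _≅_ (G H : Graph) : Set where
  field
    vertices : Vertex G ↔ Vertex H
    edges    : ∀ u v → (G ∋ u ~ v) ⇔ (H ∋ Inverse.to vertices u ~ Inverse.to vertices v)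

------------------------------------------------------------------------
-- Linear forests

induced : (G : Graph) → (Vertex G → Set) → Graph
induced G P = record
  { Vertex = [ v ∈ Vertex G ∣ P v ]
  ; _~_    = λ u v → G ∋ value u ~ value v
  ; ~-sym  = Graph.~-sym G
  ; ~-irr  = Graph.~-irr G
  }

component : (G : Graph) → Vertex G → Graph
component G v = induced G (Star (Graph._~_ G) v)

path : ℕ → Graph
path m = record
  { Vertex = Fin m
  ; _~_    = λ i j → toℕ j ≡ suc (toℕ i) ⊎ toℕ i ≡ suc (toℕ j)
  ; ~-sym  = λ { (inj₁ e) → inj₂ e ; (inj₂ e) → inj₁ e }
  ; ~-irr  = λ { (inj₁ e) → n≢1+n e ; (inj₂ e) → n≢1+n e }
  }
  where
  n≢1+n : ∀ {n} → n ≢ suc n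
  n≢1+n ()

LinearForest : Graph → Set
LinearForest G = ∀ v → ∃[ m ] (path (suc m) ≅ component G v)

------------------------------------------------------------------------
-- Pathwidth

record PathDecomposition (G : Graph) : Set where
  field
    bags      : List (List (Vertex G))
    bags-sets : All Unique bags
    vertices  : ∀ v → Any (v ∈_) bags
    edges     : ∀ u v → G ∋ u ~ v → Any (λ X → u ∈ X × v ∈ X) bags
    interval  : ∀ v (i l j : Fin (length bags)) → i Fin.≤ l → l Fin.≤ j →
                v ∈ lookup bags i → v ∈ lookup bags j → v ∈ lookup bags l

  -- Truncated subtraction: 0 instead of -1 when all bags are empty.
  width : ℕ
  width = foldr _⊔_ 0 (map length bags) ∸ 1

-- The minimum width of a path decomposition is at most w.
PathwidthAtMost : ℕ → Graph → Set
PathwidthAtMost w G = Σ[ D ∈ PathDecomposition G ] PathDecomposition.width D ≤ w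

------------------------------------------------------------------------
-- Vertex explosion

-- The new vertices are indexed by the former neighbours of v.
explode : (G : Graph) → Vertex G → Graph
explode G v = record
  { Vertex = [ w ∈ Vertex G ∣ w ≢ v ] ⊎ [ u ∈ Vertex G ∣ G ∋ u ~ v ]
  ; _~_    = adj
  ; ~-sym  = λ {x} {y} → adj-sym x y
  ; ~-irr  = λ {x} → adj-irr x
  }
  where
  V = [ w ∈ Vertex G ∣ w ≢ v ] ⊎ [ u ∈ Vertex G ∣ G ∋ u ~ v ]

  adj : V → V → Set
  adj (inj₁ w) (inj₁ w′) = G ∋ value w ~ value w′
  adj (inj₁ w) (inj₂ u)  = value w ≡ value u
  adj (inj₂ u) (inj₁ w)  = value w ≡ value u
  adj (inj₂ _) (inj₂ _)  = ⊥

  adj-sym : ∀ x y → adj x y → adj y x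
  adj-sym (inj₁ _) (inj₁ _) e = Graph.~-sym G e
  adj-sym (inj₁ _) (inj₂ _) e = e
  adj-sym (inj₂ _) (inj₁ _) e = e

  adj-irr : ∀ x → ¬ adj x x
  adj-irr (inj₁ _) e = Graph.~-irr G e

-- Explodes f 0, f 1, …, f (m - 1) in this order; after each explosion the
-- remaining vertices are viewed as vertices of the new graph.
explodeAll : (G : Graph) {m : ℕ} (f : Fin m → Vertex G) → Injective _≡_ _≡_ f → Graph
explodeAll G {zero}  f inj = G
explodeAll G {suc m} f inj =
  explodeAll (explode G (f zero))
    (λ i → inj₁ (f (suc i) , [ (λ e → 0≢1+n (sym (inj e))) ]))
    (λ e → suc-injective (inj (cong value (inj₁-injective e))))

elements : ∀ {n} → Subset n → List (Fin n)
elements S = filter (_∈? S) (allFin _)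

elements-unique : ∀ {n} (S : Subset n) → Unique (elements S)
elements-unique S = filter⁺ (_∈? S) (allFin⁺ _)

lookup-injective : ∀ {A : Set} {xs : List A} → Unique xs → Injective _≡_ _≡_ (lookup xs)
lookup-injective (x∉ ∷ u) {zero}  {zero}  e = refl
lookup-injective (x∉ ∷ u) {zero}  {suc j} e = contradiction e (All.lookup x∉ (∈-lookup j))
lookup-injective (x∉ ∷ u) {suc i} {zero}  e = contradiction (sym e) (All.lookup x∉ (∈-lookup i))
lookup-injective (x∉ ∷ u) {suc i} {suc j} e = cong suc (lookup-injective u e)

------------------------------------------------------------------------
-- Bipartite graphs with a bipartition (top, bottom)

record BipartiteGraph : Set where
  field
    top bottom : ℕ
    edge       : Fin top → Fin bottom → Bool

toGraph : BipartiteGraph → Graph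
toGraph G = record
  { Vertex = Fin top ⊎ Fin bottom
  ; _~_    = adj
  ; ~-sym  = λ {x} {y} → adj-sym x y
  ; ~-irr  = λ {x} → adj-irr x
  }
  where
  open BipartiteGraph G

  adj : Fin top ⊎ Fin bottom → Fin top ⊎ Fin bottom → Set
  adj (inj₁ t) (inj₂ b) = T (edge t b)
  adj (inj₂ b) (inj₁ t) = T (edge t b)
  adj (inj₁ _) (inj₁ _) = ⊥
  adj (inj₂ _) (inj₂ _) = ⊥

  adj-sym : ∀ x y → adj x y → adj y x
  adj-sym (inj₁ _) (inj₂ _) e = e
  adj-sym (inj₂ _) (inj₁ _) e = e

  adj-irr : ∀ x → ¬ adj x x
  adj-irr (inj₁ _) ()
  adj-irr (inj₂ _) ()

explodeBottom : (G : BipartiteGraph) → Subset (BipartiteGraph.bottom G) → Graph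
explodeBottom G S =
  explodeAll (toGraph G) (inj₂ ∘ lookup (elements S))
    (λ e → lookup-injective (elements-unique S) (inj₂-injective e))

------------------------------------------------------------------------
-- Graphs on Fin n and sets of edges

record FinGraph : Set where
  field
    order   : ℕ
    adj     : Fin order → Fin order → Bool
    adj-sym : ∀ i j → T (adj i j) → T (adj j i)
    adj-irr : ∀ i → ¬ T (adj i i)

open FinGraph using (order; adj)

-- A set of edges is given by its symmetric indicator matrix.
record EdgeSet (G : FinGraph) : Set where
  field
    mem     : Fin (order G) → Fin (order G) → Bool
    mem-sym : ∀ i j → T (mem i j) → T (mem j i)
    mem-adj : ∀ i j → T (mem i j) → T (adj G i j)

open EdgeSet using (mem)

_⊆ᴱ_ : ∀ {G} → EdgeSet G → EdgeSet G → Set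
S ⊆ᴱ X = ∀ i j → T (mem S i j) → T (mem X i j)

-- Each edge is counted once, as a pair i < j.
∣_∣ᴱ : ∀ {G} → EdgeSet G → ℕ
∣_∣ᴱ {G} S =
  length (filter (λ (i , j) → (i <? j) ×-dec T? (mem S i j))
                 (cartesianProduct (allFin (order G)) (allFin (order G))))

deleteEdges : (G : FinGraph) → EdgeSet G → Graph
deleteEdges G S = record
  { Vertex = Fin (order G)
  ; _~_    = λ i j → T (adj G i j) × ¬ T (mem S i j)
  ; ~-sym  = λ {i} {j} (e , ∉S) → FinGraph.adj-sym G i j e , ∉S ∘ EdgeSet.mem-sym S j i
  ; ~-irr  = λ {i} (e , _) → FinGraph.adj-irr G i e
  }

------------------------------------------------------------------------
-- Polynomial-time computability

-- The machine model is a while-language on binary trees, a variable-free form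
-- of Jones' WHILE.  A program acts on a single tree, its store.

data Tree : Set where
  leaf : Tree
  _∙_  : Tree → Tree → Tree

infixr 5 _∙_

size : Tree → ℕ
size leaf    = 1
size (x ∙ y) = suc (size x + size y)

data Prog : Set where
  nop nil hd tl : Prog
  pair          : Prog → Prog → Prog
  _⨾_           : Prog → Prog → Prog
  cond          : Prog → Prog → Prog → Prog
  while         : Prog → Prog → Prog

infixr 4 _⨾_

-- p ⊢ x ⇓ y [ t ]: started on x, p halts with y at cost t.  Executing a
-- construct on x costs size x, plus the cost of the subprograms executed.
-- Charging for sizes matters: at unit cost, repeating pair nop nop would build
-- trees of exponential size in linear time.  Here size y = O(t), and t is
-- polynomially related to the running time of a multitape Turing machine.
data _⊢_⇓_[_] : Prog → Tree → Tree → ℕ → Set where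
  nop      : ∀ {x} → nop ⊢ x ⇓ x [ size x ]
  nil      : ∀ {x} → nil ⊢ x ⇓ leaf [ size x ]
  hd-leaf  : hd ⊢ leaf ⇓ leaf [ size leaf ]
  hd-node  : ∀ {x y} → hd ⊢ x ∙ y ⇓ x [ size (x ∙ y) ]
  tl-leaf  : tl ⊢ leaf ⇓ leaf [ size leaf ]
  tl-node  : ∀ {x y} → tl ⊢ x ∙ y ⇓ y [ size (x ∙ y) ]
  pair     : ∀ {p q x y z s t} → p ⊢ x ⇓ y [ s ] → q ⊢ x ⇓ z [ t ] →
             pair p q ⊢ x ⇓ y ∙ z [ size x + s + t ]
  seq      : ∀ {p q x y z s t} → p ⊢ x ⇓ y [ s ] → q ⊢ y ⇓ z [ t ] →
             (p ⨾ q) ⊢ x ⇓ z [ size x + s + t ]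
  cond-yes : ∀ {b p q x l r y s t} → b ⊢ x ⇓ l ∙ r [ s ] → p ⊢ x ⇓ y [ t ] →
             cond b p q ⊢ x ⇓ y [ size x + s + t ]
  cond-no  : ∀ {b p q x y s t} → b ⊢ x ⇓ leaf [ s ] → q ⊢ x ⇓ y [ t ] →
             cond b p q ⊢ x ⇓ y [ size x + s + t ]
  halt     : ∀ {b p x s} → b ⊢ x ⇓ leaf [ s ] →
             while b p ⊢ x ⇓ x [ size x + s ]
  loop     : ∀ {b p x l r y z s t u} → b ⊢ x ⇓ l ∙ r [ s ] → p ⊢ x ⇓ y [ t ] →
             while b p ⊢ y ⇓ z [ u ] →
             while b p ⊢ x ⇓ z [ size x + s + t + u ]

-- As size x ≥ 1, every polynomial in size x is bounded by some c * size x ^ d.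
PolyTime : {A B : Set} → (A → Tree) → (B → Tree) → (A → B) → Set
PolyTime encA encB f =
  ∃[ p ] ∃[ c ] ∃[ d ] ∀ a → ∃[ t ]
    (p ⊢ encA a ⇓ encB (f a) [ t ] × t ≤ c * size (encA a) ^ d)

------------------------------------------------------------------------
-- Encodings

encBool : Bool → Tree
encBool false = leaf
encBool true  = leaf ∙ leaf

encList : {A : Set} → (A → Tree) → List A → Tree
encList enc []       = leaf
encList enc (x ∷ xs) = enc x ∙ encList enc xs

encUnary : ℕ → Tree
encUnary n = encList encBool (replicate n false)

-- Bijective binary numerals, least significant digit first.
encBinary : ℕ → Tree
encBinary = enc ∘ fromℕ
  where
  enc : ℕᵇ → Tree
  enc ℕᵇ.zero  = leaf
  enc 2[1+ n ] = encBool true ∙ enc n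
  enc 1+[2 n ] = encBool false ∙ enc n

encMatrix : ∀ {m n} → (Fin m → Fin n → Bool) → Tree
encMatrix M = encList (encList encBool) (tabulate (λ i → tabulate (M i)))

encSubset : ∀ {n} → Subset n → Tree
encSubset S = encList encBool (Vec.toList S)

-- The numbers of vertices are written in unary.
encBipartiteGraph : BipartiteGraph → Tree
encBipartiteGraph G = encUnary top ∙ encUnary bottom ∙ encMatrix edge
  where open BipartiteGraph G

encFinGraph : FinGraph → Tree
encFinGraph G = encUnary (order G) ∙ encMatrix (adj G)

encEdgeSet : ∀ {G} → EdgeSet G → Tree
encEdgeSet S = encMatrix (mem S)

------------------------------------------------------------------------
-- Parameterized problems and reductions

record ParameterizedProblem : Set₁ where
  field
    Instance : Set
    encode   : Instance → Tree
    Yes      : Instance → ℕ → Set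

  encodeWithParameter : Instance × ℕ → Tree
  encodeWithParameter (I , k) = encode I ∙ encBinary k

record ParameterPreservingReduction (P Q : ParameterizedProblem) : Set where
  private
    module P = ParameterizedProblem P
    module Q = ParameterizedProblem Q
  field
    reduce    : P.Instance × ℕ → Q.Instance × ℕ
    poly-time : PolyTime P.encodeWithParameter Q.encodeWithParameter reduce
    parameter : ∀ I k → proj₂ (reduce (I , k)) ≤ k
    correct   : ∀ I k → P.Yes I k ⇔ Q.Yes (proj₁ (reduce (I , k))) (proj₂ (reduce (I , k)))

------------------------------------------------------------------------
-- The problems

BOVE : ParameterizedProblem
BOVE = record
  { Instance = BipartiteGraph
  ; encode   = encBipartiteGraph
  ; Yes      = λ G k → ∃[ S ] (∣ S ∣ ≤ k × PathwidthAtMost 1 (explodeBottom G S))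
  }

RestrictedBOVE : ParameterizedProblem
RestrictedBOVE = record
  { Instance = Σ[ G ∈ BipartiteGraph ] Subset (BipartiteGraph.bottom G)
  ; encode   = λ (G , X) → encBipartiteGraph G ∙ encSubset X
  ; Yes      = λ (G , X) k →
      ∃[ S ] (S ⊆ X × ∣ S ∣ ≤ k × PathwidthAtMost 1 (explodeBottom G S))
  }

CPS : ParameterizedProblem
CPS = record
  { Instance = FinGraph
  ; encode   = encFinGraph
  ; Yes      = λ G k → Σ[ S ∈ EdgeSet G ] (∣ S ∣ᴱ ≤ k × LinearForest (deleteEdges G S))
  }

RestrictedCPS : ParameterizedProblem
RestrictedCPS = record
  { Instance = Σ[ G ∈ FinGraph ] EdgeSet G
  ; encode   = λ (G , X) → encFinGraph G ∙ encEdgeSet X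
  ; Yes      = λ (G , X) k →
      Σ[ S ∈ EdgeSet G ] (S ⊆ᴱ X × ∣ S ∣ᴱ ≤ k × LinearForest (deleteEdges G S))
  }

{-# OPTIONS --safe #-}

-- A graph has pathwidth at most one iff deleting its leaves yields a linear
-- forest.  Explosions preserve the degrees of the top vertices, so the core,
-- consisting of the top vertices with at least two neighbours, survives them.
-- A bottom vertex with three core neighbours must be exploded; one with two core
-- neighbours t and t′ acts as an edge t t′, and of several such vertices all but
-- one must be exploded (one outside X is spared, if there is any); one with a
-- single core neighbour and some other neighbour acts as a pendant edge.
-- Exploding amounts to deleting that edge, and a vertex that must be exploded is
-- turned into a triangle, which costs one deletion.  Ordering the vertices by
-- their first bags shows that what remains is a linear forest; conversely the
-- positions of the vertices on the paths of a linear forest determine the bags.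
-- The reduction is computable in polynomial time because the adjacency of its
-- output is first-order definable in its input.

module Submission where

open import Defs
open import Data.Bool using (Bool; true; false; T; not; _∧_; _∨_)
import Data.Bool.Properties as Bool
open import Data.Bool.Properties using (T-≡)
open import Data.Empty using (⊥; ⊥-elim)
import Data.Empty.Irrelevant as Irrelevant
import Data.Fin as Fin
open import Data.Fin using (Fin; zero; suc; toℕ; inject₁; fromℕ; splitAt; _↑ˡ_; _↑ʳ_)
import Data.Fin.Properties as Fin
open import Data.Fin.Properties using (any?; 0≢1+n; toℕ-fromℕ; toℕ-inject₁; toℕ<n; toℕ-injective; splitAt-↑ˡ; splitAt-↑ʳ; splitAt⁻¹-↑ˡ; splitAt⁻¹-↑ʳ)
open import Data.Fin.Relation.Unary.Top using (view; ‵fromℕ; ‵inject₁)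
import Data.Fin.Subset as Subset
open import Data.Fin.Subset using (Subset; ∣_∣)
open import Data.Fin.Subset.Properties using (_∈?_; ∈⊤)
open import Data.Irrelevant using (Irrelevant; [_])
open import Data.List using (List; []; _∷_; _++_; tabulate; replicate; map; lookup; length; foldr; applyUpTo; filter; allFin; cartesianProduct)
open import Data.List.Membership.Propositional using (_∈_)
import Data.List.Membership.Propositional.Properties as List
open import Data.List.Properties using (tabulate-cong; lookup-applyUpTo; length-++)
import Data.List.Relation.Unary.All as All
open import Data.List.Relation.Unary.All using ([]; _∷_)
import Data.List.Relation.Unary.All.Properties as All
open import Data.List.Relation.Unary.AllPairs using ([]; _∷_)
import Data.List.Relation.Unary.Any as Any
open import Data.List.Relation.Unary.Any using (Any; here; there; index)
import Data.List.Relation.Unary.Any.Properties as Any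
open import Data.List.Relation.Unary.Any.Properties using (lookup-index)
open import Data.List.Relation.Unary.Unique.Propositional using (Unique)
import Data.List.Relation.Unary.Unique.Propositional.Properties as Unique
open import Data.Nat using (ℕ; zero; suc; _+_; _*_; _⊔_; _^_; _≤_; _<_; z≤n; s≤s; s≤s⁻¹; _<ᵇ_; _≤?_; _<?_)
open import Data.Nat.DivMod using (_/_; _%_; m≡m%n+[m/n]*n; m%n<n; /-monoˡ-≤)
import Data.Nat.Properties as ℕ
open import Data.Nat.Properties hiding (_≤?_; _<?_; _≟_; 0≢1+n)
open import Data.Nat.Solver using (module +-*-Solver)
open import Data.Product using (Σ; Σ-syntax; ∃-syntax; _×_; _,_; proj₁; proj₂)
open import Data.Refinement using (Refinement; value; proof) renaming (_,_ to _,ᴿ_)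
open import Data.Sum using (_⊎_; inj₁; inj₂; [_,_]′; map₁; swap)
open import Data.Sum.Properties using (inj₁-injective; inj₂-injective)
open import Data.Unit using (⊤; tt)
import Data.Vec as Vec
open import Data.Vec.Properties using ([]=⇒lookup; lookup⇒[]=; lookup∘tabulate)
open import Function using (_∘_; id; _⇔_; mk⇔; Equivalence; Inverse; Injective)
open import Function.Bundles using (mk↔ₛ′)
open import Relation.Binary.Construct.Closure.ReflexiveTransitive using (Star; ε; _◅_; _◅◅_; reverse)
open import Relation.Binary.Definitions using (DecidableEquality; tri<; tri≈; tri>)
open import Relation.Binary.PropositionalEquality
open import Relation.Nullary using (¬_; Dec; yes; no; does; contradiction; recompute)
open import Relation.Nullary.Decidable using (map′; ⌊_⌋; toWitness; fromWitness; _×-dec_; _⊎-dec_; ¬?; T?; decidable-stable)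

-- Polynomial running time

-- The reduction fixes in advance which of several parallel bottom vertices is spared, while a
-- solution may spare any of them. This does no harm for two reasons. When counting, the exploded
-- representative pays for the triangle of the member that is spared instead of it. With respect to
-- `X`, a redundant vertex outside `X` always has a rival outside `X`, and then neither problem has
-- a solution. Every bottom vertex receives its three target vertices whether or not they carry
-- edges: isolated vertices do not disturb a linear forest, so the order of the target is a fixed
-- sum and only adjacency and deletability have to be computed. Both directions replace isomorphisms
-- and decompositions by numbers. A linear forest is recognized by a key under which every vertex
-- has at most one higher and one lower neighbour, and a decomposition is assembled from spans of
-- numbers such that each number meets at most one top vertex and at most one other vertex.

data Poly : Set where
  con     : ℕ → Poly
  var       : Poly
  _⊕_ _⊗_ : Poly → Poly → Poly

infixl 6 _⊕_
infixl 7 _⊗_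

eval : Poly → ℕ → ℕ
eval (con c) n = c
eval var       n = n
eval (P ⊕ Q) n = eval P n + eval Q n
eval (P ⊗ Q) n = eval P n * eval Q n

eval-mono : ∀ P {m n} → m ≤ n → eval P m ≤ eval P n
eval-mono (con c) m≤n = ≤-refl
eval-mono var       m≤n = m≤n
eval-mono (P ⊕ Q) m≤n = +-mono-≤ (eval-mono P m≤n) (eval-mono Q m≤n)
eval-mono (P ⊗ Q) m≤n = *-mono-≤ (eval-mono P m≤n) (eval-mono Q m≤n)

_⟪_⟫ : Poly → Poly → Poly
con c   ⟪ R ⟫ = con c
var       ⟪ R ⟫ = R
(P ⊕ Q) ⟪ R ⟫ = P ⟪ R ⟫ ⊕ Q ⟪ R ⟫
(P ⊗ Q) ⟪ R ⟫ = P ⟪ R ⟫ ⊗ Q ⟪ R ⟫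

eval-subst : ∀ P R n → eval (P ⟪ R ⟫) n ≡ eval P (eval R n)
eval-subst (con c) R n = refl
eval-subst var       R n = refl
eval-subst (P ⊕ Q) R n = cong₂ _+_ (eval-subst P R n) (eval-subst Q R n)
eval-subst (P ⊗ Q) R n = cong₂ _*_ (eval-subst P R n) (eval-subst Q R n)

-- Exponents add for sums as well as for products: since `1 ≤ n`, both terms of a sum may be raised
-- to the exponent `d + d′`. Keeping bounds as syntax allows this induction.
monomial-bound : ∀ P → ∃[ c ] ∃[ d ] ∀ n → 1 ≤ n → eval P n ≤ c * n ^ d
monomial-bound (con c) = c , 0 , λ n _ → ≤-reflexive (sym (*-identityʳ c))
monomial-bound var       = 1 , 1 , λ n _ → ≤-reflexive (sym (trans (*-identityˡ (n * 1)) (*-identityʳ n)))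
monomial-bound (P ⊕ Q) with monomial-bound P | monomial-bound Q
... | c , d , p | c′ , d′ , q = c + c′ , d + d′ , λ n 1≤n → begin
  eval P n + eval Q n                  ≤⟨ +-mono-≤ (p n 1≤n) (q n 1≤n) ⟩
  c * n ^ d + c′ * n ^ d′              ≤⟨ +-mono-≤ (*-monoʳ-≤ c (raise n d (d + d′) 1≤n (m≤m+n d d′)))
                                                   (*-monoʳ-≤ c′ (raise n d′ (d + d′) 1≤n (m≤n+m d′ d))) ⟩
  c * n ^ (d + d′) + c′ * n ^ (d + d′) ≡⟨ *-distribʳ-+ (n ^ (d + d′)) c c′ ⟨
  (c + c′) * n ^ (d + d′)              ∎
  where
  open ≤-Reasoning
  raise : ∀ n i j → 1 ≤ n → i ≤ j → n ^ i ≤ n ^ j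
  raise (suc n) i j _ i≤j = ^-monoʳ-≤ (suc n) i≤j
monomial-bound (P ⊗ Q) with monomial-bound P | monomial-bound Q
... | c , d , p | c′ , d′ , q = c * c′ , d + d′ , λ n 1≤n → begin
  eval P n * eval Q n             ≤⟨ *-mono-≤ (p n 1≤n) (q n 1≤n) ⟩
  c * n ^ d * (c′ * n ^ d′)       ≡⟨ [m*n]*[o*p]≡[m*o]*[n*p] c (n ^ d) c′ (n ^ d′) ⟩
  c * c′ * (n ^ d * n ^ d′)       ≡⟨ cong (c * c′ *_) (^-distribˡ-+-* n d d′) ⟨
  c * c′ * n ^ (d + d′)           ∎
  where open ≤-Reasoning

1≤size : ∀ x → 1 ≤ size x
1≤size leaf    = ≤-refl
1≤size (x ∙ y) = s≤s z≤n

-- Every construct pays for the size of its input, so a result cannot outgrow the time spent. In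
-- `seq-computes` this bounds the input of the second program by the running time of the first.
size-output : ∀ {p x y t} → p ⊢ x ⇓ y [ t ] → size y ≤ t
size-output nop             = ≤-refl
size-output (nil {x})       = 1≤size x
size-output hd-leaf         = ≤-refl
size-output (hd-node {x} {y}) = m≤n⇒m≤1+n (m≤m+n (size x) (size y))
size-output tl-leaf         = ≤-refl
size-output (tl-node {x} {y}) = m≤n⇒m≤1+n (m≤n+m (size y) (size x))
size-output (pair {x = x} p q) =
  ≤-trans (s≤s (+-mono-≤ (size-output p) (size-output q)))
          (≤-trans (+-monoˡ-≤ _ (1≤size x)) (≤-reflexive (sym (+-assoc (size x) _ _))))
size-output (seq p q)       = m≤n⇒m≤o+n _ (size-output q)
size-output (cond-yes b p)  = m≤n⇒m≤o+n _ (size-output p)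
size-output (cond-no b p)   = m≤n⇒m≤o+n _ (size-output p)
size-output (halt b)        = m≤m+n _ _
size-output (loop b p w)    = m≤n⇒m≤o+n _ (size-output w)

-- The program must halt on every tree, also on those that encode nothing, so that composition has
-- no side conditions.
record Computes (p : Prog) (f : Tree → Tree) : Set where
  field
    bound : Poly
    run   : ∀ x → ∃[ t ] (p ⊢ x ⇓ f x [ t ] × t ≤ eval bound (size x))

  size-bound : ∀ x → size (f x) ≤ eval bound (size x)
  size-bound x with run x
  ... | t , d , t≤ = ≤-trans (size-output d) t≤

  run≤ : ∀ x {w} → size x ≤ w → ∃[ t ] (p ⊢ x ⇓ f x [ t ] × t ≤ eval bound w)
  run≤ x x≤w with run x
  ... | t , d , t≤ = t , d , ≤-trans t≤ (eval-mono bound x≤w)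

open Computes

hdᵗ tlᵗ : Tree → Tree
hdᵗ leaf    = leaf
hdᵗ (x ∙ y) = x
tlᵗ leaf    = leaf
tlᵗ (x ∙ y) = y

condᵗ : Tree → Tree → Tree → Tree
condᵗ (_ ∙ _) y z = y
condᵗ leaf    y z = z

nop-computes : Computes nop (λ x → x)
nop-computes = record { bound = var ; run = λ x → _ , nop , ≤-refl }

nil-computes : Computes nil (λ _ → leaf)
nil-computes = record { bound = var ; run = λ x → _ , nil , ≤-refl }

hd-computes : Computes hd hdᵗ
hd-computes = record { bound = var ; run = λ { leaf → _ , hd-leaf , ≤-refl ; (x ∙ y) → _ , hd-node , ≤-refl } }

tl-computes : Computes tl tlᵗ
tl-computes = record { bound = var ; run = λ { leaf → _ , tl-leaf , ≤-refl ; (x ∙ y) → _ , tl-node , ≤-refl } }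

pair-computes : ∀ {p q f g} → Computes p f → Computes q g → Computes (pair p q) (λ x → f x ∙ g x)
pair-computes P Q = record
  { bound = var ⊕ bound P ⊕ bound Q
  ; run   = λ x → let s , p , s≤ = run P x ; t , q , t≤ = run Q x in
                  _ , pair p q , +-mono-≤ (+-monoʳ-≤ (size x) s≤) t≤
  }

seq-computes : ∀ {p q f g} → Computes p f → Computes q g → Computes (p ⨾ q) (λ x → g (f x))
seq-computes {f = f} P Q = record
  { bound = var ⊕ bound P ⊕ bound Q ⟪ bound P ⟫
  ; run   = λ x → let s , p , s≤ = run P x ; t , q , t≤ = run≤ Q (f x) (size-bound P x) in
                  _ , seq p q , +-mono-≤ (+-monoʳ-≤ (size x) s≤)
                                         (≤-trans t≤ (≤-reflexive (sym (eval-subst (bound Q) (bound P) (size x)))))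
  }

cond-computes : ∀ {b p q h f g} → Computes b h → Computes p f → Computes q g →
                Computes (cond b p q) (λ x → condᵗ (h x) (f x) (g x))
cond-computes {b} {p} {q} {h} {f} {g} B P Q = record
  { bound = var ⊕ bound B ⊕ (bound P ⊕ bound Q)
  ; run   = λ x → let r , d , r≤ = run B x in go x (h x) d r≤
  }
  where
  go : ∀ x y {r} → b ⊢ x ⇓ y [ r ] → r ≤ eval (bound B) (size x) →
       ∃[ t ] (cond b p q ⊢ x ⇓ condᵗ y (f x) (g x) [ t ] ×
               t ≤ eval (var ⊕ bound B ⊕ (bound P ⊕ bound Q)) (size x))
  go x (_ ∙ _) d r≤ = let s , e , s≤ = run P x in
    _ , cond-yes d e , +-mono-≤ (+-monoʳ-≤ (size x) r≤) (m≤n⇒m≤n+o _ s≤)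
  go x leaf    d r≤ = let s , e , s≤ = run Q x in
    _ , cond-no d e , +-mono-≤ (+-monoʳ-≤ (size x) r≤) (m≤n⇒m≤o+n _ s≤)

-- The bound `w` holds for all intermediate states at once, so every round has the same cost bound
-- and the total is a product.
data Iterate (h f : Tree → Tree) (w : ℕ) : ℕ → Tree → Tree → Set where
  stop : ∀ {x} → h x ≡ leaf → size x ≤ w → Iterate h f w 0 x x
  step : ∀ {x y l r n} → h x ≡ l ∙ r → size x ≤ w → Iterate h f w n (f x) y → Iterate h f w (suc n) x y

while-run : ∀ {b p h f} (B : Computes b h) (P : Computes p f) {w n x y} → Iterate h f w n x y →
            ∃[ t ] (while b p ⊢ x ⇓ y [ t ] × t ≤ suc n * (w + eval (bound B) w + eval (bound P) w))
while-run {b} B P {w} {x = x} (stop e x≤) with run≤ B x x≤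
... | s , d , s≤ = _ , halt (subst (λ z → b ⊢ x ⇓ z [ s ]) e d) ,
  ≤-trans (+-mono-≤ x≤ s≤) (≤-trans (m≤m+n _ _) (≤-reflexive (sym (*-identityˡ _))))
while-run {b} B P {w} {x = x} (step e x≤ it) with run≤ B x x≤ | run≤ P x x≤ | while-run B P it
... | s , d , s≤ | t , d′ , t≤ | u , d″ , u≤ =
  _ , loop (subst (λ z → b ⊢ x ⇓ z [ s ]) e d) d′ d″ , +-mono-≤ (+-mono-≤ (+-mono-≤ x≤ s≤) t≤) u≤

while-computes : ∀ {b p h f} → Computes b h → Computes p f → (g : Tree → Tree) (N W : Poly) →
                 (∀ x → ∃[ n ] (n ≤ eval N (size x) × Iterate h f (eval W (size x)) n x (g x))) →
                 Computes (while b p) g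
while-computes B P g N W it = record
  { bound = (con 1 ⊕ N) ⊗ (W ⊕ bound B ⟪ W ⟫ ⊕ bound P ⟪ W ⟫)
  ; run   = λ x → let n , n≤ , i = it x ; t , d , t≤ = while-run B P i in
      t , d , ≤-trans t≤ (*-mono-≤ (s≤s n≤) (≤-reflexive (sym
        (cong₂ (λ u v → eval W (size x) + u + v) (eval-subst (bound B) W (size x)) (eval-subst (bound P) W (size x))))))
  }

-- Any tree serves as a numeral: its value is the length of its right spine.

dropᵗ : Tree → Tree → Tree
dropᵗ leaf    y = y
dropᵗ (_ ∙ n) y = dropᵗ n (tlᵗ y)

drop-prog : Prog
drop-prog = while hd (pair (hd ⨾ tl) (tl ⨾ tl)) ⨾ tl

size-tl : ∀ x → size (tlᵗ x) ≤ size x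
size-tl leaf    = ≤-refl
size-tl (x ∙ y) = m≤n⇒m≤1+n (m≤n+m (size y) (size x))

-- Numeral and tree each lose a layer per round and never grow, so the initial size bounds both the
-- number of rounds and the states.
drop-computes : Computes drop-prog (λ x → dropᵗ (hdᵗ x) (tlᵗ x))
drop-computes = record { bound = bound C ; run = λ { leaf → run C leaf ; (n ∙ y) → run C (n ∙ y) } }
  where
  result : Tree → Tree
  result leaf    = leaf
  result (n ∙ y) = leaf ∙ dropᵗ n y
  body : Tree → Tree
  body x = tlᵗ (hdᵗ x) ∙ tlᵗ (tlᵗ x)
  iterates : ∀ n y w → size (n ∙ y) ≤ w → ∃[ i ] (i ≤ size n × Iterate hdᵗ body w i (n ∙ y) (leaf ∙ dropᵗ n y))
  iterates leaf    y w s≤ = 0 , z≤n , stop refl s≤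
  iterates (m ∙ n) y w s≤
    with iterates n (tlᵗ y) w (≤-trans (s≤s (+-mono-≤ (m≤n⇒m≤1+n (m≤n+m (size n) (size m))) (size-tl y))) s≤)
  ... | i , i≤ , it = suc i , s≤s (m≤n⇒m≤o+n (size m) i≤) , step refl s≤ it
  iterate : ∀ x → ∃[ i ] (i ≤ size x × Iterate hdᵗ body (size x) i x (result x))
  iterate leaf    = 0 , z≤n , stop refl ≤-refl
  iterate (n ∙ y) with iterates n y (size (n ∙ y)) ≤-refl
  ... | i , i≤ , it = i , m≤n⇒m≤1+n (m≤n⇒m≤n+o (size y) i≤) , it
  final : ∀ x → tlᵗ (result x) ≡ dropᵗ (hdᵗ x) (tlᵗ x)
  final leaf    = refl
  final (n ∙ y) = refl
  D = seq-computes (while-computes hd-computes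
        (pair-computes (seq-computes hd-computes tl-computes) (seq-computes tl-computes tl-computes))
        result var var iterate) tl-computes
  C : Computes drop-prog (λ x → dropᵗ (hdᵗ x) (tlᵗ x))
  C = record { bound = bound D ; run = λ x → let t , d , t≤ = run D x in
               t , subst (λ z → drop-prog ⊢ x ⇓ z [ t ]) (final x) d , t≤ }

-- The index counts down and hits are prepended, so results come out in increasing order. With a
-- guard that is always true this tabulates `f`; with a trivial `f` it searches for an index
-- satisfying `h`.
collectᵗ : (h f : Tree → Tree) → Tree → Tree → Tree → Tree
collectᵗ h f e leaf    a = a
collectᵗ h f e (_ ∙ n) a = collectᵗ h f e n (condᵗ (h (e ∙ n)) (f (e ∙ n) ∙ a) a)

collect-prog : Prog → Prog → Prog
collect-prog b p =
  -- Rebuilding the input forces the shape `e ∙ n ∙ a`, so the loop never meets a malformed state.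
  pair hd (pair (tl ⨾ hd) (tl ⨾ tl)) ⨾
  while (tl ⨾ hd)
    (pair hd (pair (tl ⨾ hd ⨾ tl)
                   (cond (pair hd (tl ⨾ hd ⨾ tl) ⨾ b) (pair (pair hd (tl ⨾ hd ⨾ tl) ⨾ p) (tl ⨾ tl)) (tl ⨾ tl)))) ⨾
  tl ⨾ tl

collect-computes : ∀ {b p h f} → Computes b h → Computes p f →
  Computes (collect-prog b p) (λ x → collectᵗ h f (hdᵗ x) (hdᵗ (tlᵗ x)) (tlᵗ (tlᵗ x)))
collect-computes {b} {p} {h} {f} B P = record { bound = bound D ; run = λ x → let t , d , t≤ = run D x in
    t , subst (λ z → collect-prog b p ⊢ x ⇓ z [ t ]) (final (hdᵗ x) (hdᵗ (tlᵗ x)) (tlᵗ (tlᵗ x))) d , t≤ }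
  where
  result : Tree → Tree
  result (e ∙ n ∙ a) = e ∙ leaf ∙ collectᵗ h f e n a
  result x           = x
  arg body : Tree → Tree
  arg x  = hdᵗ x ∙ tlᵗ (hdᵗ (tlᵗ x))
  body x = hdᵗ x ∙ tlᵗ (hdᵗ (tlᵗ x)) ∙ condᵗ (h (arg x)) (f (arg x) ∙ tlᵗ (tlᵗ x)) (tlᵗ (tlᵗ x))
  guard : Tree → Tree
  guard x = hdᵗ (tlᵗ x)

  size-cond : ∀ z y a {u} → size y ≤ u → size (condᵗ z (y ∙ a) a) ≤ size a + suc u
  size-cond leaf    y a {u} y≤ = m≤m+n (size a) (suc u)
  size-cond (_ ∙ _) y a {u} y≤ = ≤-trans (s≤s (+-monoˡ-≤ (size a) y≤)) (≤-reflexive (+-comm (suc u) (size a)))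

  -- The numeral shrinks by at least one in each round, which pays for the growth of the accumulator.
  iterates : ∀ e n a u w → (∀ y → size y ≤ size (e ∙ n) → size (f y) ≤ u) →
             size (e ∙ n ∙ a) + size n * suc u ≤ w →
             ∃[ i ] (i ≤ size n × Iterate guard body w i (e ∙ n ∙ a) (e ∙ leaf ∙ collectᵗ h f e n a))
  iterates e leaf    a u w fs s≤ = 0 , z≤n , stop refl (m+n≤o⇒m≤o _ s≤)
  iterates e (m ∙ n) a u w fs s≤ =
    let i , i≤ , it = iterates e n a′ u w (λ y y≤ → fs y (≤-trans y≤ shrink)) (≤-trans bounds s≤)
    in suc i , s≤s (m≤n⇒m≤o+n (size m) i≤) , step refl (m+n≤o⇒m≤o _ s≤) it
    where
    a′ = condᵗ (h (e ∙ n)) (f (e ∙ n) ∙ a) a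
    shrink : size (e ∙ n) ≤ size (e ∙ (m ∙ n))
    shrink = s≤s (+-monoʳ-≤ (size e) (m≤n⇒m≤1+n (m≤n+m (size n) (size m))))
    open ≤-Reasoning
    rearrange : ∀ E N A U M → suc (E + suc (N + (A + suc U))) + N * suc U + M * suc U + M ≡
                              suc (E + suc (M + N + A)) + suc (M + N) * suc U
    rearrange = solve 5 (λ E N A U M →
      con 1 :+ (E :+ (con 1 :+ (N :+ (A :+ (con 1 :+ U))))) :+ N :* (con 1 :+ U) :+ M :* (con 1 :+ U) :+ M :=
      con 1 :+ (E :+ (con 1 :+ (M :+ N :+ A))) :+ (con 1 :+ (M :+ N)) :* (con 1 :+ U)) refl
      where open +-*-Solver
    bounds : size (e ∙ n ∙ a′) + size n * suc u ≤ size (e ∙ (m ∙ n) ∙ a) + size (m ∙ n) * suc u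
    bounds = begin
      suc (size e + suc (size n + size a′)) + size n * suc u
        ≤⟨ +-monoˡ-≤ (size n * suc u) (s≤s (+-monoʳ-≤ (size e) (s≤s (+-monoʳ-≤ (size n)
             (size-cond (h (e ∙ n)) (f (e ∙ n)) a (fs (e ∙ n) shrink)))))) ⟩
      suc (size e + suc (size n + (size a + suc u))) + size n * suc u
        ≤⟨ ≤-trans (m≤m+n _ (size m * suc u)) (m≤m+n _ (size m)) ⟩
      suc (size e + suc (size n + (size a + suc u))) + size n * suc u + size m * suc u + size m
        ≡⟨ rearrange (size e) (size n) (size a) u (size m) ⟩
      suc (size e + suc (size m + size n + size a)) + suc (size m + size n) * suc u
        ≤⟨ +-monoˡ-≤ (suc (size m + size n) * suc u) (s≤s (+-monoʳ-≤ (size e) (s≤s (n≤1+n _)))) ⟩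
      size (e ∙ (m ∙ n) ∙ a) + size (m ∙ n) * suc u ∎

  -- There are at most `size x` rounds, each adding to the accumulator one node and one value of
  -- `f`, whose size is at most `bound P`.
  W : Poly
  W = var ⊕ var ⊗ (con 1 ⊕ bound P)

  iterate : ∀ x → ∃[ i ] (i ≤ size x × Iterate guard body (eval W (size x)) i x (result x))
  iterate leaf        = 0 , z≤n , stop refl (m≤m+n _ _)
  iterate (e ∙ leaf)  = 0 , z≤n , stop refl (m≤m+n _ _)
  iterate (e ∙ n ∙ a) =
    let i , i≤ , it = iterates e n a (eval (bound P) m) (eval W m)
                        (λ y y≤ → ≤-trans (size-bound P y) (eval-mono (bound P) (≤-trans y≤ en≤)))
                        (+-monoʳ-≤ m (*-monoˡ-≤ (suc (eval (bound P) m)) n≤))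
    in i , ≤-trans i≤ n≤ , it
    where
    m = size (e ∙ n ∙ a)
    en≤ : size (e ∙ n) ≤ m
    en≤ = s≤s (+-monoʳ-≤ (size e) (m≤n⇒m≤1+n (m≤m+n (size n) (size a))))
    n≤ : size n ≤ m
    n≤ = ≤-trans (m≤n⇒m≤1+n (m≤n+m (size n) (size e))) en≤

  final : ∀ e n a → tlᵗ (tlᵗ (result (e ∙ n ∙ a))) ≡ collectᵗ h f e n a
  final e n a = refl

  A : Computes (pair hd (tl ⨾ hd ⨾ tl)) arg
  A = pair-computes hd-computes (seq-computes tl-computes (seq-computes hd-computes tl-computes))
  T₂ = seq-computes tl-computes tl-computes
  D = seq-computes (pair-computes hd-computes (pair-computes (seq-computes tl-computes hd-computes) T₂))
        (seq-computes
          (while-computes (seq-computes tl-computes hd-computes)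
            (pair-computes hd-computes (pair-computes (seq-computes tl-computes (seq-computes hd-computes tl-computes))
              (cond-computes (seq-computes A B) (pair-computes (seq-computes A P) T₂) T₂)))
            result var W iterate)
          T₂)

-- Computability relative to encodings

record Computable {A B : Set} (α : A → Tree) (β : B → Tree) (f : A → B) : Set where
  field
    {program}  : Prog
    {function} : Tree → Tree
    computes   : Computes program function
    agrees     : ∀ a → function (α a) ≡ β (f a)

open Computable

poly-time : {A B : Set} {α : A → Tree} {β : B → Tree} {f : A → B} → Computable α β f → PolyTime α β f
poly-time {α = α} C with monomial-bound (bound (computes C))
... | c , d , poly = program C , c , d , λ a → let t , r , t≤ = run (computes C) (α a) in
  t , subst (λ y → program C ⊢ α a ⇓ y [ t ]) (agrees C a) r , ≤-trans t≤ (poly _ (1≤size (α a)))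

module _ {A : Set} {α : A → Tree} where

  constant : {B : Set} {β : B → Tree} (b : B) → Computable α β (λ _ → b)
  constant {β = β} b = record { computes = proj₂ (go (β b)) ; agrees = λ _ → refl }
    where
    go : ∀ y → Σ Prog (λ p → Computes p (λ _ → y))
    go leaf    = _ , nil-computes
    go (y ∙ z) = _ , pair-computes (proj₂ (go y)) (proj₂ (go z))

  _then_ : {B C : Set} {β : B → Tree} {γ : C → Tree} {f : A → B} {g : B → C} →
           Computable α β f → Computable β γ g → Computable α γ (g ∘ f)
  F then G = record
    { computes = seq-computes (computes F) (computes G)
    ; agrees   = λ a → trans (cong (function G) (agrees F a)) (agrees G _)
    }

  fork : {B C : Set} {β : B → Tree} {γ : C → Tree} {f : A → B} {g : A → C} →
         Computable α β f → Computable α γ g → Computable α (λ (b , c) → β b ∙ γ c) (λ a → f a , g a)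
  fork F G = record
    { computes = pair-computes (computes F) (computes G)
    ; agrees   = λ a → cong₂ _∙_ (agrees F a) (agrees G a)
    }

  reencode : {B C : Set} {β : B → Tree} {γ : C → Tree} {f : A → B} {g : A → C} →
             (∀ a → β (f a) ≡ γ (g a)) → Computable α β f → Computable α γ g
  reencode e F = record { computes = computes F ; agrees = λ a → trans (agrees F a) (e a) }

  test : {f : Tree → Tree} {p : Prog} {φ : A → Bool} → Computes p f →
         (∀ a → condᵗ (f (α a)) (encBool true) leaf ≡ encBool (φ a)) → Computable α encBool φ
  test P e = record { computes = cond-computes P (pair-computes nil-computes nil-computes) nil-computes ; agrees = e }

  boolean : (∧∨ : Bool → Bool → Bool) {φ ψ : A → Bool} → Computable α encBool φ → Computable α encBool ψ →
            Computable α encBool (λ a → ∧∨ (φ a) (ψ a))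
  boolean op {φ} {ψ} F G = record
    { computes = cond-computes (computes F)
        (cond-computes (computes G) (answer true true) (answer true false))
        (cond-computes (computes G) (answer false true) (answer false false))
    ; agrees = λ a → lemma (agrees F a) (agrees G a)
    }
    where
    answer : ∀ x y → Computes _ (λ _ → encBool (op x y))
    answer x y = computes (constant {β = encBool} (op x y))
    lemma : ∀ {x y b c} → x ≡ encBool b → y ≡ encBool c →
            condᵗ x (condᵗ y (encBool (op true true)) (encBool (op true false)))
                    (condᵗ y (encBool (op false true)) (encBool (op false false))) ≡ encBool (op b c)
    lemma {b = true}  {true}  refl refl = refl
    lemma {b = true}  {false} refl refl = refl
    lemma {b = false} {true}  refl refl = refl
    lemma {b = false} {false} refl refl = refl

first : {A B : Set} {α : A → Tree} {β : B → Tree} → Computable (λ (p : A × B) → α (proj₁ p) ∙ β (proj₂ p)) α proj₁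
first = record { computes = hd-computes ; agrees = λ _ → refl }

second : {A B : Set} {α : A → Tree} {β : B → Tree} → Computable (λ (p : A × B) → α (proj₁ p) ∙ β (proj₂ p)) β proj₂
second = record { computes = tl-computes ; agrees = λ _ → refl }

-- The last index is examined first, as by collectᵗ.
some : ∀ n → (Fin n → Bool) → Bool
some zero    φ = false
some (suc n) φ = φ (fromℕ n) ∨ some n (φ ∘ inject₁)

encIndex : {A : Set} → (A → Tree) → (n : A → ℕ) → Σ A (Fin ∘ n) → Tree
encIndex α n (a , i) = α a ∙ encUnary (toℕ i)

module _ {A : Set} {α : A → Tree} {n : A → ℕ} (N : Computable α encUnary n) where

  -- The list `g a` is the initial accumulator of the loop, so a block is put in front of later
  -- blocks without a separate program for concatenation.
  tabulated : {B : Set} {β : B → Tree} {f : (a : A) → Fin (n a) → B} {g : A → List B} →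
              Computable (encIndex α n) β (λ (a , i) → f a i) → Computable α (encList β) g →
              Computable α (encList β) (λ a → tabulate (f a) ++ g a)
  tabulated {B} {β} {f} {g} F G = record
    { computes = seq-computes (pair-computes nop-computes (pair-computes (computes N) (computes G)))
                   (collect-computes (pair-computes nil-computes nil-computes) (computes F))
    ; agrees   = λ a → trans (cong₂ (collectᵗ _ _ (α a)) (agrees N a) (agrees G a))
                             (lemma (α a) (n a) (f a) (g a) (λ i → agrees F (a , i)))
    }
    where
    lemma : ∀ e n (f : Fin n → B) (ys : List B) →
            (∀ i → function F (e ∙ encUnary (toℕ i)) ≡ β (f i)) →
            collectᵗ (λ _ → leaf ∙ leaf) (function F) e (encUnary n) (encList β ys) ≡ encList β (tabulate f ++ ys)
    lemma e zero    f ys eq = refl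
    lemma e (suc n) f ys eq
      with function F (e ∙ encUnary n)
         | subst (λ k → function F (e ∙ encUnary k) ≡ β (f (fromℕ n))) (toℕ-fromℕ n) (eq (fromℕ n))
    ... | _ | refl = trans
      (lemma e n (f ∘ inject₁) (f (fromℕ n) ∷ ys)
        (λ i → subst (λ k → function F (e ∙ encUnary k) ≡ β (f (inject₁ i))) (toℕ-inject₁ i) (eq (inject₁ i))))
      (cong (encList β) (snoc n f))
      where
      snoc : ∀ n (f : Fin (suc n) → B) {ys} → tabulate (f ∘ inject₁) ++ f (fromℕ n) ∷ ys ≡ tabulate f ++ ys
      snoc zero    f = refl
      snoc (suc n) f = cong (f zero ∷_) (snoc n (f ∘ suc))

  exists : {φ : (a : A) → Fin (n a) → Bool} → Computable (encIndex α n) encBool (λ (a , i) → φ a i) →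
           Computable α encBool (λ a → some (n a) (φ a))
  exists {φ} F = test
    (seq-computes (pair-computes nop-computes (pair-computes (computes N) nil-computes))
                  (collect-computes (computes F) nil-computes))
    (λ a → trans (cong (λ k → condᵗ (collectᵗ (function F) (λ _ → leaf) (α a) k leaf) (encBool true) leaf) (agrees N a))
                 (lemma (α a) (n a) (φ a) (λ i → agrees F (a , i))))
    where
    nonempty : ∀ e n x y → condᵗ (collectᵗ (function F) (λ _ → leaf) e n (x ∙ y)) (encBool true) leaf ≡ encBool true
    nonempty e leaf    x y = refl
    nonempty e (_ ∙ n) x y with function F (e ∙ n)
    ... | leaf  = nonempty e n x y
    ... | _ ∙ _ = nonempty e n leaf (x ∙ y)
    lemma : ∀ e n (φ : Fin n → Bool) → (∀ i → function F (e ∙ encUnary (toℕ i)) ≡ encBool (φ i)) →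
            condᵗ (collectᵗ (function F) (λ _ → leaf) e (encUnary n) leaf) (encBool true) leaf ≡ encBool (some n φ)
    lemma e zero    φ eq = refl
    lemma e (suc n) φ eq
      with function F (e ∙ encUnary n) | φ (fromℕ n)
         | subst (λ k → function F (e ∙ encUnary k) ≡ encBool (φ (fromℕ n))) (toℕ-fromℕ n) (eq (fromℕ n))
    ... | _ | true  | refl = nonempty e (encUnary n) leaf leaf
    ... | _ | false | refl = lemma e n (φ ∘ inject₁)
      (λ i → subst (λ k → function F (e ∙ encUnary k) ≡ encBool (φ (inject₁ i))) (toℕ-inject₁ i) (eq (inject₁ i)))

  -- A unary numeral is a list of `false`, so addition is concatenation.
  unary-sum : {m : A → ℕ} → Computable α encUnary m → Computable α encUnary (λ a → n a + m a)
  unary-sum M = reencode (λ a → cong (encList encBool) (lemma (n a) _))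
    (tabulated {f = λ _ _ → false} (constant {β = encBool} false) (reencode {β = encUnary} {γ = encList encBool} (λ _ → refl) M))
    where
    lemma : ∀ n m → tabulate {n = n} (λ _ → false) ++ replicate m false ≡ replicate (n + m) false
    lemma zero    m = refl
    lemma (suc n) m = cong (false ∷_) (lemma n m)

-- After dropping `m` entries from a list of `n`, something is left exactly if `m` is smaller.
less : {A : Set} {α : A → Tree} {m n : A → ℕ} → Computable α encUnary m → Computable α encUnary n →
       Computable α encBool (λ a → m a <ᵇ n a)
less {α = α} {m} {n} M N = test (seq-computes (pair-computes (computes M) (computes N)) drop-computes)
  (λ a → trans (cong₂ (λ x y → condᵗ (dropᵗ x y) (encBool true) leaf) (agrees M a) (agrees N a)) (lemma (m a) (n a)))
  where
  lemma : ∀ m n → condᵗ (dropᵗ (encUnary m) (encUnary n)) (encBool true) leaf ≡ encBool (m <ᵇ n)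
  lemma zero    zero    = refl
  lemma zero    (suc n) = refl
  lemma (suc m) zero    = lemma m zero
  lemma (suc m) (suc n) = lemma m n

tabulated-at : {A B : Set} {α : A → Tree} {β : B → Tree} {n : A → ℕ} {f : (a : A) → Fin (n a) → B} {i : (a : A) → Fin (n a)} →
         Computable α encUnary (toℕ ∘ i) → Computable α (encList β) (λ a → tabulate (f a)) →
         Computable α β (λ a → f a (i a))
tabulated-at {B = B} {β = β} {f = f} {i} I L = record
  { computes = seq-computes (seq-computes (pair-computes (computes I) (computes L)) drop-computes) hd-computes
  ; agrees   = λ a → trans (cong₂ (λ x y → hdᵗ (dropᵗ x y)) (agrees I a) (agrees L a)) (lemma (f a) (i a))
  }
  where
  lemma : ∀ {n} (f : Fin n → B) i → hdᵗ (dropᵗ (encUnary (toℕ i)) (encList β (tabulate f))) ≡ β (f i)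
  lemma f zero    = refl
  lemma f (suc i) = lemma (f ∘ suc) i

-- First-order formulas about an instance of restricted BOVE

Instance : Set
Instance = ParameterizedProblem.Instance RestrictedBOVE

data Sort : Set where
  top bottom : Sort

card : Instance → Sort → ℕ
card (G , _) top    = BipartiteGraph.top G
card (G , _) bottom = BipartiteGraph.bottom G

infix 4 _∈ᶜ_
data _∈ᶜ_ (s : Sort) : List Sort → Set where
  here  : ∀ {Γ} → s ∈ᶜ s ∷ Γ
  there : ∀ {r Γ} → s ∈ᶜ Γ → s ∈ᶜ r ∷ Γ

Env : Instance → List Sort → Set
Env I []      = ⊤
Env I (s ∷ Γ) = Env I Γ × Fin (card I s)

look : ∀ {I s Γ} → s ∈ᶜ Γ → Env I Γ → Fin (card I s)
look here      (ρ , i) = i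
look (there x) (ρ , i) = look x ρ

infixr 6 _∧ᶠ_
infixr 5 _∨ᶠ_
-- One syntax with two readings: `holds` is what the program evaluates, `Sat` is what the
-- combinatorial proofs unfold.
data Formula (Γ : List Sort) : Set where
  boolᶠ : Bool → Formula Γ
  edgeᶠ : top ∈ᶜ Γ → bottom ∈ᶜ Γ → Formula Γ
  memᶠ  : bottom ∈ᶜ Γ → Formula Γ
  lessᶠ : ∀ {s} → s ∈ᶜ Γ → s ∈ᶜ Γ → Formula Γ
  _∧ᶠ_ _∨ᶠ_ : Formula Γ → Formula Γ → Formula Γ
  ¬ᶠ_   : Formula Γ → Formula Γ
  ∃ᶠ    : ∀ s → Formula (s ∷ Γ) → Formula Γ

infix 8 ¬ᶠ_

module _ {I : Instance} where
  open BipartiteGraph (proj₁ I) using (edge)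

  holds : ∀ {Γ} → Formula Γ → Env I Γ → Bool
  holds (boolᶠ b)   ρ = b
  holds (edgeᶠ x y) ρ = edge (look x ρ) (look y ρ)
  holds (memᶠ x)    ρ = Vec.lookup (proj₂ I) (look x ρ)
  holds (lessᶠ x y) ρ = toℕ (look x ρ) <ᵇ toℕ (look y ρ)
  holds (φ ∧ᶠ ψ)    ρ = holds φ ρ ∧ holds ψ ρ
  holds (φ ∨ᶠ ψ)    ρ = holds φ ρ ∨ holds ψ ρ
  holds (¬ᶠ φ)      ρ = not (holds φ ρ)
  holds (∃ᶠ s φ)    ρ = some (card I s) (λ i → holds φ (ρ , i))

  Sat : ∀ {Γ} → Formula Γ → Env I Γ → Set
  Sat (boolᶠ b)   ρ = T b
  Sat (edgeᶠ x y) ρ = T (edge (look x ρ) (look y ρ))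
  Sat (memᶠ x)    ρ = T (Vec.lookup (proj₂ I) (look x ρ))
  Sat (lessᶠ x y) ρ = toℕ (look x ρ) < toℕ (look y ρ)
  Sat (φ ∧ᶠ ψ)    ρ = Sat φ ρ × Sat ψ ρ
  Sat (φ ∨ᶠ ψ)    ρ = Sat φ ρ ⊎ Sat ψ ρ
  Sat (¬ᶠ φ)      ρ = ¬ Sat φ ρ
  Sat (∃ᶠ s φ)    ρ = Σ[ i ∈ Fin (card I s) ] Sat φ (ρ , i)

  some-sound : ∀ n {φ} → T (some n φ) → ∃[ i ] T (φ i)
  some-sound (suc n) {φ} h with φ (fromℕ n) in e
  ... | true  = fromℕ n , subst T (sym e) tt
  ... | false = let i , p = some-sound n h in inject₁ i , p

  some-complete : ∀ n {φ} i → T (φ i) → T (some n φ)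
  some-complete (suc n) {φ} i p with view i
  ... | ‵fromℕ with φ (fromℕ n)
  ...   | true = tt
  some-complete (suc n) {φ} i p | ‵inject₁ j with φ (fromℕ n)
  ...   | true  = tt
  ...   | false = some-complete n j p

  -- Negation exchanges the two directions, so they are proved together.
  mutual
    sound : ∀ {Γ} (φ : Formula Γ) ρ → T (holds φ ρ) → Sat φ ρ
    sound (boolᶠ b)   ρ h = h
    sound (edgeᶠ x y) ρ h = h
    sound (memᶠ x)    ρ h = h
    sound (lessᶠ x y) ρ h = <ᵇ⇒< _ _ h
    sound (φ ∧ᶠ ψ)    ρ h with holds φ ρ in e
    ... | true  = sound φ ρ (subst T (sym e) tt) , sound ψ ρ h
    sound (φ ∨ᶠ ψ)    ρ h with holds φ ρ in e
    ... | true  = inj₁ (sound φ ρ (subst T (sym e) tt))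
    ... | false = inj₂ (sound ψ ρ h)
    sound (¬ᶠ φ)      ρ h s with holds φ ρ | complete φ ρ s
    ... | true  | _ = h
    ... | false | p = p
    sound (∃ᶠ s φ)    ρ h = let i , p = some-sound _ h in i , sound φ (ρ , i) p

    complete : ∀ {Γ} (φ : Formula Γ) ρ → Sat φ ρ → T (holds φ ρ)
    complete (boolᶠ b)   ρ h = h
    complete (edgeᶠ x y) ρ h = h
    complete (memᶠ x)    ρ h = h
    complete (lessᶠ x y) ρ h = <⇒<ᵇ h
    complete (φ ∧ᶠ ψ)    ρ (p , q) with holds φ ρ | complete φ ρ p
    ... | true  | _ = complete ψ ρ q
    complete (φ ∨ᶠ ψ)    ρ (inj₁ p) with holds φ ρ | complete φ ρ p
    ... | true  | _ = tt
    complete (φ ∨ᶠ ψ)    ρ (inj₂ q) with holds φ ρ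
    ... | true  = tt
    ... | false = complete ψ ρ q
    complete (¬ᶠ φ)      ρ h with holds φ ρ in e
    ... | true  = h (sound φ ρ (subst T (sym e) tt))
    ... | false = tt
    complete (∃ᶠ s φ)    ρ (i , p) = some-complete _ i (complete φ (ρ , i) p)

  abstract
    sat? : ∀ {Γ} (φ : Formula Γ) ρ → Dec (Sat φ ρ)
    sat? φ ρ = map′ (sound φ ρ) (complete φ ρ) (T? (holds φ ρ))

-- Evaluating formulas in polynomial time

-- Environments nest to the left, so encoding an extended one is literally `encIndex` over the
-- smaller one, and a quantifier passes environment and index on unchanged.
encEnv : ∀ Γ → Σ[ I ∈ Instance ] Env I Γ → Tree
encEnv []      (I , tt)      = ParameterizedProblem.encode RestrictedBOVE I
encEnv (s ∷ Γ) (I , (ρ , i)) = encEnv Γ (I , ρ) ∙ encUnary (toℕ i)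

along : {A A′ B : Set} {α : A → Tree} {α′ : A′ → Tree} {β : B → Tree} {f : A → B} (h : A′ → A) →
        (∀ a → α′ a ≡ α (h a)) → Computable α β f → Computable α′ β (f ∘ h)
along h e F = record { computes = computes F ; agrees = λ a → trans (cong (function F) (e a)) (agrees F (h a)) }

instance-computable : ∀ Γ → Computable (encEnv Γ) (ParameterizedProblem.encode RestrictedBOVE) proj₁
instance-computable []      = record { computes = nop-computes ; agrees = λ _ → refl }
instance-computable (s ∷ Γ) = record
  { computes = seq-computes hd-computes (computes (instance-computable Γ))
  ; agrees   = λ (I , (ρ , i)) → agrees (instance-computable Γ) (I , ρ)
  }

var-computable : ∀ {s Γ} (x : s ∈ᶜ Γ) → Computable (encEnv Γ) encUnary (λ (I , ρ) → toℕ (look {I} x ρ))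
var-computable here      = record { computes = tl-computes ; agrees = λ _ → refl }
var-computable (there x) = record
  { computes = seq-computes hd-computes (computes (var-computable x))
  ; agrees   = λ (I , (ρ , i)) → agrees (var-computable x) (I , ρ)
  }

encode-card : ∀ s → Computable (ParameterizedProblem.encode RestrictedBOVE) encUnary (λ I → card I s)
encode-card top    = record { computes = seq-computes hd-computes hd-computes ; agrees = λ _ → refl }
encode-card bottom = record
  { computes = seq-computes hd-computes (seq-computes tl-computes hd-computes) ; agrees = λ _ → refl }

card-computable : ∀ Γ s → Computable (encEnv Γ) encUnary (λ (I , ρ) → card I s)
card-computable Γ s = instance-computable Γ then encode-card s

subset-computable : ∀ Γ → Computable (encEnv Γ) (encList encBool) (λ ((G , X) , ρ) → tabulate (Vec.lookup X))
subset-computable Γ = reencode {β = encSubset′} {γ = encList encBool} {f = λ ((G , X) , ρ) → _ , X} (λ ((G , X) , ρ) → lemma X)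
  (instance-computable Γ then record { computes = tl-computes ; agrees = λ _ → refl })
  where
  encSubset′ : Σ ℕ Subset → Tree
  encSubset′ (_ , X) = encSubset X
  lemma : ∀ {n} (X : Subset n) → encSubset X ≡ encList encBool (tabulate (Vec.lookup X))
  lemma Vec.[]       = refl
  lemma (b Vec.∷ X) = cong (encBool b ∙_) (lemma X)

matrix-computable : ∀ Γ → Computable (encEnv Γ) (encList (encList encBool))
                    (λ (I , ρ) → tabulate (λ i → tabulate (BipartiteGraph.edge (proj₁ I) i)))
matrix-computable Γ = instance-computable Γ then record
  { computes = seq-computes hd-computes (seq-computes tl-computes tl-computes) ; agrees = λ _ → refl }

-- The formula is fixed while the instance varies, so its quantifiers become a constant number of
-- nested loops over vertices.
formula-computable : ∀ {Γ} (φ : Formula Γ) → Computable (encEnv Γ) encBool (λ (I , ρ) → holds {I} φ ρ)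
formula-computable (boolᶠ b) = constant {β = encBool} b
formula-computable {Γ} (edgeᶠ x y) =
  tabulated-at {f = λ (I , ρ) j → BipartiteGraph.edge (proj₁ I) (look {I} x ρ) j} {i = λ (I , ρ) → look {I} y ρ} (var-computable y)
    (tabulated-at {β = encList encBool} {f = λ (I , ρ) i → tabulate (BipartiteGraph.edge (proj₁ I) i)} {i = λ (I , ρ) → look {I} x ρ}
      (var-computable x) (matrix-computable Γ))
formula-computable {Γ} (memᶠ x) =
  tabulated-at {f = λ (I , ρ) → Vec.lookup (proj₂ I)} {i = λ (I , ρ) → look {I} x ρ} (var-computable x) (subset-computable Γ)
formula-computable (lessᶠ x y) = less (var-computable x) (var-computable y)
formula-computable (φ ∧ᶠ ψ) = boolean _∧_ (formula-computable φ) (formula-computable ψ)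
formula-computable (φ ∨ᶠ ψ) = boolean _∨_ (formula-computable φ) (formula-computable ψ)
formula-computable (¬ᶠ φ) = boolean (λ x _ → not x) (formula-computable φ) (formula-computable φ)
formula-computable {Γ} (∃ᶠ s φ) =
  exists {n = λ (I , ρ) → card I s} (card-computable Γ s) {φ = λ (I , ρ) i → holds {I} φ (ρ , i)}
    (along {α = encEnv (s ∷ Γ)} (λ ((I , ρ) , i) → I , (ρ , i)) (λ _ → refl) (formula-computable φ))

-- The co-path set instance

module _ {Γ : List Sort} where

  apartᶠ : ∀ {s} → s ∈ᶜ Γ → s ∈ᶜ Γ → Formula Γ
  apartᶠ x y = lessᶠ x y ∨ᶠ lessᶠ y x

  sameᶠ : ∀ {s} → s ∈ᶜ Γ → s ∈ᶜ Γ → Formula Γ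
  sameᶠ x y = ¬ᶠ apartᶠ x y

  coreᶠ : top ∈ᶜ Γ → Formula Γ
  coreᶠ t = ∃ᶠ bottom (∃ᶠ bottom
    (lessᶠ (there here) here ∧ᶠ edgeᶠ (there (there t)) (there here) ∧ᶠ edgeᶠ (there (there t)) here))

  core-nbrᶠ : bottom ∈ᶜ Γ → top ∈ᶜ Γ → Formula Γ
  core-nbrᶠ b t = edgeᶠ t b ∧ᶠ coreᶠ t

  -- Lexicographic by membership in `X` and then by index. The order is linear, so exactly one
  -- member of each parallel class has no predecessor in it.
  priorᶠ : bottom ∈ᶜ Γ → bottom ∈ᶜ Γ → Formula Γ
  priorᶠ b′ b = (memᶠ b ∧ᶠ ¬ᶠ memᶠ b′) ∨ᶠ (lessᶠ b′ b ∧ᶠ ¬ᶠ (memᶠ b′ ∧ᶠ ¬ᶠ memᶠ b))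

module _ {Γ : List Sort} where

  heavyᶠ : bottom ∈ᶜ Γ → Formula Γ
  heavyᶠ b = ∃ᶠ top (∃ᶠ top (∃ᶠ top
    (lessᶠ (there (there here)) (there here) ∧ᶠ lessᶠ (there here) here ∧ᶠ
     core-nbrᶠ (there (there (there b))) (there (there here)) ∧ᶠ
     core-nbrᶠ (there (there (there b))) (there here) ∧ᶠ
     core-nbrᶠ (there (there (there b))) here)))

  -- By the last conjunct `b` is no leaf: it carries a noncore neighbour, which is a leaf, and so it
  -- survives the deletion of leaves as the end of an edge from `t`.
  pendantᶠ : bottom ∈ᶜ Γ → top ∈ᶜ Γ → Formula Γ
  pendantᶠ b t = core-nbrᶠ b t ∧ᶠ
    ¬ᶠ ∃ᶠ top (apartᶠ (there t) here ∧ᶠ core-nbrᶠ (there b) here) ∧ᶠ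
    ∃ᶠ top (apartᶠ (there t) here ∧ᶠ edgeᶠ here (there b))

module _ {Γ : List Sort} where

  linkᶠ : bottom ∈ᶜ Γ → top ∈ᶜ Γ → top ∈ᶜ Γ → Formula Γ
  linkᶠ b t t′ = ¬ᶠ heavyᶠ b ∧ᶠ apartᶠ t t′ ∧ᶠ core-nbrᶠ b t ∧ᶠ core-nbrᶠ b t′

module _ {Γ : List Sort} where

  redundantᶠ : bottom ∈ᶜ Γ → Formula Γ
  redundantᶠ b = ∃ᶠ top (∃ᶠ top (linkᶠ (there (there b)) (there here) here ∧ᶠ
    ∃ᶠ bottom (priorᶠ here (there (there (there b))) ∧ᶠ linkᶠ here (there (there here)) (there here))))

  forcedᶠ : bottom ∈ᶜ Γ → Formula Γ
  forcedᶠ b = heavyᶠ b ∨ᶠ redundantᶠ b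

-- Each b is represented by three vertices: a triangle if b must be exploded,
-- and otherwise at most an edge from bot₀ b, if b has a single core neighbour
-- but is not a leaf.  If b has two core neighbours, they are joined directly.
data Kind : Set where
  top bot₀ bot₁ bot₂ : Kind

sort : Kind → Sort
sort top = top
sort _   = bottom

-- Demanding `forcedᶠ` at both ends keeps the formula symmetric without transport along the equality
-- of `b` and `b′`.
triangleᶠ : ∀ {Γ} → bottom ∈ᶜ Γ → bottom ∈ᶜ Γ → Formula Γ
triangleᶠ b b′ = sameᶠ b b′ ∧ᶠ forcedᶠ b ∧ᶠ forcedᶠ b′

adjᶠ : ∀ k l → Formula (sort l ∷ sort k ∷ [])
adjᶠ top  top  = ∃ᶠ bottom (linkᶠ here (there (there here)) (there here))
adjᶠ top  bot₀ = pendantᶠ here (there here)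
adjᶠ bot₀ top  = pendantᶠ (there here) here
adjᶠ bot₀ bot₁ = triangleᶠ (there here) here
adjᶠ bot₀ bot₂ = triangleᶠ (there here) here
adjᶠ bot₁ bot₀ = triangleᶠ (there here) here
adjᶠ bot₁ bot₂ = triangleᶠ (there here) here
adjᶠ bot₂ bot₀ = triangleᶠ (there here) here
adjᶠ bot₂ bot₁ = triangleᶠ (there here) here
adjᶠ _    _    = boolᶠ false

mem-sortᶠ : ∀ {Γ} s → s ∈ᶜ Γ → Formula Γ
mem-sortᶠ top    x = boolᶠ true
mem-sortᶠ bottom x = memᶠ x

-- All but one of the vertices behind a link edge are forced, so deleting this edge amounts to
-- exploding every one of them; hence none may lie outside `X`.
allowedᶠ : ∀ k l → Formula (sort l ∷ sort k ∷ [])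
allowedᶠ top top = ¬ᶠ ∃ᶠ bottom (linkᶠ here (there (there here)) (there here) ∧ᶠ ¬ᶠ memᶠ here)
allowedᶠ k   l   = mem-sortᶠ (sort k) (there here) ∧ᶠ mem-sortᶠ (sort l) here

deletableᶠ : ∀ k l → Formula (sort l ∷ sort k ∷ [])
deletableᶠ k l = adjᶠ k l ∧ᶠ allowedᶠ k l

-- Block matrices

order : Instance → List Kind → ℕ
order I []       = 0
order I (k ∷ ks) = card I (sort k) + order I ks

Labelled : Instance → Set
Labelled I = Σ[ k ∈ Kind ] Fin (card I (sort k))

decode : ∀ I ks → Fin (order I ks) → Labelled I
decode I (k ∷ ks) i = [ k ,_ , decode I ks ]′ (splitAt (card I (sort k)) i)

kinds : List Kind
kinds = top ∷ bot₀ ∷ bot₁ ∷ bot₂ ∷ []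

-- The list of kinds is fixed, so a tabulation over the target vertices splits into finitely many
-- blocks, each with its own program. It is used for the rows and, inside them, for the columns.
rows-computable : {A B : Set} {α : A → Tree} {β : B → Tree} (J : A → Instance) →
                  (∀ s → Computable α encUnary (λ a → card (J a) s)) →
                  (f : (a : A) → Labelled (J a) → B) →
                  (∀ k → Computable (encIndex α (λ a → card (J a) (sort k))) β (λ (a , i) → f a (k , i))) → ∀ ks →
                  Computable α (encList β) (λ a → tabulate (f a ∘ decode (J a) ks))
rows-computable {β = β} J N f F []       = constant {β = encList β} []
rows-computable {B = B} {β = β} J N f F (k ∷ ks) =
  reencode (λ a → cong (encList β) (lemma (card (J a) (sort k)) {g = k ,_} {h = decode (J a) ks} {f = f a}))
    (tabulated (N (sort k)) {f = λ a i → f a (k , i)} (F k) (rows-computable J N f F ks))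
  where
  lemma : ∀ {C : Set} m {n} {g : Fin m → C} {h : Fin n → C} {f : C → B} → tabulate (f ∘ g) ++ tabulate (f ∘ h) ≡
          tabulate (λ i → f ([ g , h ]′ (splitAt m i)))
  lemma zero            = refl
  lemma (suc m) {f = f} = cong (f _ ∷_) (trans (lemma m {f = f}) (tabulate-cong (λ i → cong f (shift (splitAt m i)))))
    where
    shift : ∀ {n} {C : Set} {g : Fin (suc m) → C} {h : Fin n → C} (x : Fin m ⊎ Fin n) →
           [ g ∘ suc , h ]′ x ≡ [ g , h ]′ (map₁ suc x)
    shift (inj₁ _) = refl
    shift (inj₂ _) = refl

order-computable : ∀ ks → Computable (encEnv []) encUnary (λ (I , _) → order I ks)
order-computable []       = constant {β = encUnary} 0
order-computable (k ∷ ks) = unary-sum (card-computable [] (sort k)) (order-computable ks)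

entry : (∀ k l → Formula (sort l ∷ sort k ∷ [])) → (I : Instance) → Labelled I → Labelled I → Bool
entry φ I (k , i) (l , j) = holds {I} (φ k l) ((tt , i) , j)

matrix : (∀ k l → Formula (sort l ∷ sort k ∷ [])) → (I : Instance) → Fin (order I kinds) → Fin (order I kinds) → Bool
matrix φ I i j = entry φ I (decode I kinds i) (decode I kinds j)

entries-computable : ∀ φ → Computable (encEnv []) (encList (encList encBool))
                     (λ (I , _) → tabulate (λ i → tabulate (matrix φ I i)))
entries-computable φ =
  rows-computable proj₁ (card-computable []) (λ (I , _) u → tabulate (entry φ I u ∘ decode I kinds)) (λ k →
    along {α = encEnv (sort k ∷ [])} (λ ((I , ρ) , i) → I , (ρ , i)) (λ _ → refl)
      (rows-computable {α = encEnv (sort k ∷ [])} proj₁ (card-computable (sort k ∷ []))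
        (λ (I , ((_ , i))) v → entry φ I (k , i) v) (λ l →
        along {α = encEnv (sort l ∷ sort k ∷ [])} (λ ((I , (ρ , i)) , j) → I , ((ρ , i) , j)) (λ _ → refl)
          (formula-computable (φ k l)))
        kinds))
    kinds

-- The construction as predicates, and the target graph

module Instances (I : Instance) where

  -- `Sat` computes environments away: a formula yields the same type in whatever context it occurs,
  -- so these predicates also describe its occurrences inside larger formulas.
  Edge : Fin (card I top) → Fin (card I bottom) → Set
  Edge t b = Sat {I} (edgeᶠ (there here) here) ((tt , t) , b)

  In : Fin (card I bottom) → Set
  In b = Sat {I} (memᶠ here) (tt , b)

  Apart : ∀ {s} → Fin (card I s) → Fin (card I s) → Set
  Apart {s} i j = Sat {I} {Γ = s ∷ s ∷ []} (apartᶠ (there here) here) ((tt , i) , j)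

  Core : Fin (card I top) → Set
  Core t = Sat {I} (coreᶠ here) (tt , t)

  CoreNbr : Fin (card I bottom) → Fin (card I top) → Set
  CoreNbr b t = Sat {I} (core-nbrᶠ (there here) here) ((tt , b) , t)

  Heavy : Fin (card I bottom) → Set
  Heavy b = Sat {I} (heavyᶠ here) (tt , b)

  Pendant : Fin (card I bottom) → Fin (card I top) → Set
  Pendant b t = Sat {I} (pendantᶠ (there here) here) ((tt , b) , t)

  Link : Fin (card I bottom) → Fin (card I top) → Fin (card I top) → Set
  Link b t t′ = Sat {I} (linkᶠ (there (there here)) (there here) here) (((tt , b) , t) , t′)

  Prior : Fin (card I bottom) → Fin (card I bottom) → Set
  Prior b′ b = Sat {I} (priorᶠ (there here) here) ((tt , b′) , b)

  Redundant : Fin (card I bottom) → Set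
  Redundant b = Sat {I} (redundantᶠ here) (tt , b)

  Forced : Fin (card I bottom) → Set
  Forced b = Sat {I} (forcedᶠ here) (tt , b)

  Adj : Labelled I → Labelled I → Set
  Adj (k , i) (l , j) = Sat {I} (adjᶠ k l) ((tt , i) , j)

  Allowed : Labelled I → Labelled I → Set
  Allowed (k , i) (l , j) = Sat {I} (allowedᶠ k l) ((tt , i) , j)

  Apart-irrefl : ∀ {s} {i : Fin (card I s)} → ¬ Apart {s} i i
  Apart-irrefl (inj₁ i<i) = <-irrefl refl i<i
  Apart-irrefl (inj₂ i<i) = <-irrefl refl i<i

  Link-sym : ∀ {b t t′} → Link b t t′ → Link b t′ t
  Link-sym (light , apart , n , n′) = light , swap apart , n′ , n

  Adj-sym : ∀ u v → Adj u v → Adj v u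
  Adj-sym (top  , _) (top  , _) (b , l) = b , Link-sym l
  Adj-sym (top  , _) (bot₀ , _) p = p
  Adj-sym (bot₀ , _) (top  , _) p = p
  Adj-sym (bot₀ , _) (bot₁ , _) (s , f , f′) = s ∘ swap , f′ , f
  Adj-sym (bot₀ , _) (bot₂ , _) (s , f , f′) = s ∘ swap , f′ , f
  Adj-sym (bot₁ , _) (bot₀ , _) (s , f , f′) = s ∘ swap , f′ , f
  Adj-sym (bot₁ , _) (bot₂ , _) (s , f , f′) = s ∘ swap , f′ , f
  Adj-sym (bot₂ , _) (bot₀ , _) (s , f , f′) = s ∘ swap , f′ , f
  Adj-sym (bot₂ , _) (bot₁ , _) (s , f , f′) = s ∘ swap , f′ , f

  Adj-irrefl : ∀ u → ¬ Adj u u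
  Adj-irrefl (top , t) (b , _ , apart , _) = Apart-irrefl {top} {t} apart

  Allowed-sym : ∀ u v → Allowed u v → Allowed v u
  Allowed-sym (top  , _) (top  , _) p (b , l , b∉) = p (b , Link-sym l , b∉)
  Allowed-sym (top  , _) (bot₀ , _) (p , q) = q , p
  Allowed-sym (top  , _) (bot₁ , _) (p , q) = q , p
  Allowed-sym (top  , _) (bot₂ , _) (p , q) = q , p
  Allowed-sym (bot₀ , _) (top  , _) (p , q) = q , p
  Allowed-sym (bot₀ , _) (bot₀ , _) (p , q) = q , p
  Allowed-sym (bot₀ , _) (bot₁ , _) (p , q) = q , p
  Allowed-sym (bot₀ , _) (bot₂ , _) (p , q) = q , p
  Allowed-sym (bot₁ , _) (top  , _) (p , q) = q , p
  Allowed-sym (bot₁ , _) (bot₀ , _) (p , q) = q , p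
  Allowed-sym (bot₁ , _) (bot₁ , _) (p , q) = q , p
  Allowed-sym (bot₁ , _) (bot₂ , _) (p , q) = q , p
  Allowed-sym (bot₂ , _) (top  , _) (p , q) = q , p
  Allowed-sym (bot₂ , _) (bot₀ , _) (p , q) = q , p
  Allowed-sym (bot₂ , _) (bot₁ , _) (p , q) = q , p
  Allowed-sym (bot₂ , _) (bot₂ , _) (p , q) = q , p

  V : Fin (order I kinds) → Labelled I
  V = decode I kinds

  module _ (φ : ∀ k l → Formula (sort l ∷ sort k ∷ [])) (i j : Fin (order I kinds)) where

    private
      ψ = φ (proj₁ (V i)) (proj₁ (V j))
      ρ = (tt , proj₂ (V i)) , proj₂ (V j)

    matrix-sound : T (matrix φ I i j) → Sat {I} ψ ρ
    matrix-sound = sound {I} ψ ρ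

    matrix-complete : Sat {I} ψ ρ → T (matrix φ I i j)
    matrix-complete = complete {I} ψ ρ

  target : FinGraph
  target = record
    { order   = order I kinds
    ; adj     = matrix adjᶠ I
    ; adj-sym = λ i j p → matrix-complete adjᶠ j i (Adj-sym (V i) (V j) (matrix-sound adjᶠ i j p))
    ; adj-irr = λ i p → Adj-irrefl (V i) (matrix-sound adjᶠ i i p)
    }

  deletable : EdgeSet target
  deletable = record
    { mem     = matrix deletableᶠ I
    ; mem-sym = λ i j p → let a , c = matrix-sound deletableᶠ i j p in
                  matrix-complete deletableᶠ j i (Adj-sym (V i) (V j) a , Allowed-sym (V i) (V j) c)
    ; mem-adj = λ i j p → matrix-complete adjᶠ i j (proj₁ (matrix-sound deletableᶠ i j p))
    }

target-computable : Computable (encEnv []) (λ (H , X) → encFinGraph H ∙ encEdgeSet {H} X) (λ (I , _) → Instances.target I , Instances.deletable I)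
target-computable = record
  { computes = pair-computes (pair-computes (computes (order-computable kinds)) (computes (entries-computable adjᶠ)))
                             (computes (entries-computable deletableᶠ))
  ; agrees   = λ a → cong₂ _∙_ (cong₂ _∙_ (agrees (order-computable kinds) a) (agrees (entries-computable adjᶠ) a))
                               (agrees (entries-computable deletableᶠ) a)
  }

restricted-poly-time : PolyTime (ParameterizedProblem.encodeWithParameter RestrictedBOVE)
                                (ParameterizedProblem.encodeWithParameter RestrictedCPS)
                                (λ (I , k) → (Instances.target I , Instances.deletable I) , k)
restricted-poly-time = poly-time (fork
  (first {β = encBinary} then along {α = encEnv []} (λ I → I , tt) (λ _ → refl) target-computable)
  (second {α = ParameterizedProblem.encode RestrictedBOVE}))

full : BipartiteGraph → Instance
full G = G , Subset.⊤

full-computable : Computable encBipartiteGraph (ParameterizedProblem.encode RestrictedBOVE) full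
full-computable = record
  { computes = pair-computes nop-computes (computes bits)
  ; agrees   = λ G → cong (encBipartiteGraph G ∙_) (trans (agrees bits G) (lemma (BipartiteGraph.bottom G)))
  }
  where
  bits : Computable encBipartiteGraph (encList encBool) (λ G → tabulate {n = BipartiteGraph.bottom G} (λ _ → true) ++ [])
  bits = tabulated {n = BipartiteGraph.bottom}
    (record { computes = seq-computes tl-computes hd-computes ; agrees = λ _ → refl })
    {f = λ _ _ → true} (constant {β = encBool} true) (constant {β = encList encBool} [])
  lemma : ∀ n → encList encBool (tabulate {n = n} (λ _ → true) ++ []) ≡ encSubset {n} Subset.⊤
  lemma zero    = refl
  lemma (suc n) = cong (encBool true ∙_) (lemma n)

unrestricted-poly-time : PolyTime (ParameterizedProblem.encodeWithParameter BOVE)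
                                  (ParameterizedProblem.encodeWithParameter CPS)
                                  (λ (G , k) → Instances.target (full G) , k)
unrestricted-poly-time = poly-time (fork
  (first {β = encBinary} then (full-computable then
    (along {α = encEnv []} (λ I → I , tt) (λ _ → refl) target-computable then
      forget)))
  (second {α = encBipartiteGraph}))
  where
  forget : Computable (λ (H , X) → encFinGraph H ∙ encEdgeSet {H} X) encFinGraph proj₁
  forget = record { computes = hd-computes ; agrees = λ _ → refl }

-- Linear forests

steps⇒monotone : ∀ {m} (f : Fin (suc m) → ℕ) → (∀ i → f (inject₁ i) < f (suc i)) →
                 ∀ {i j} → toℕ i < toℕ j → f i < f j
steps⇒monotone {suc m} f s {zero}  {suc zero}    i<j = s zero
steps⇒monotone {suc m} f s {zero}  {suc (suc j)} i<j =
  <-trans (s zero) (steps⇒monotone (f ∘ suc) (s ∘ suc) {zero} {suc j} (s≤s z≤n))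
steps⇒monotone {suc m} f s {suc i} {suc j}       i<j = steps⇒monotone (f ∘ suc) (s ∘ suc) (s≤s⁻¹ i<j)

-- Keys need not be injective. It suffices that they differ along edges and that each vertex has at
-- most one neighbour on either side: nothing branches, and on a cycle a vertex of least key would
-- have two higher neighbours.
module KeyedGraph (G : Graph) (_≟_ : DecidableEquality (Graph.Vertex G))
  (key : Graph.Vertex G → ℕ) (bound : ℕ) (key<bound : ∀ v → key v < bound)
  (higher? : ∀ v → Dec (∃[ w ] (G ∋ v ~ w × key v < key w)))
  (lower?  : ∀ v → Dec (∃[ w ] (G ∋ v ~ w × key w < key v)))
  (separates : ∀ {v w} → G ∋ v ~ w → key v ≢ key w)
  (higher-unique : ∀ {v w w′} → G ∋ v ~ w → G ∋ v ~ w′ → key v < key w → key v < key w′ → w ≡ w′)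
  (lower-unique : ∀ {v w w′} → G ∋ v ~ w → G ∋ v ~ w′ → key w < key v → key w′ < key v → w ≡ w′)
  where
  open Graph G

  record Ascent (v : Vertex) : Set where
    field
      height  : ℕ
      at      : Fin (suc height) → Vertex
      start   : at zero ≡ v
      steps   : ∀ i → at (inject₁ i) ~ at (suc i)
      rises   : ∀ i → key (at (inject₁ i)) < key (at (suc i))
      maximal : ¬ (∃[ w ] (at (fromℕ height) ~ w × key (at (fromℕ height)) < key w))

  ascend : ∀ fuel v → bound ≤ fuel + key v → Ascent v
  ascend zero       v b≤ = contradiction (key<bound v) (≤⇒≯ b≤)
  ascend (suc fuel) v b≤ with higher? v
  ... | no none = record
    { height = 0 ; at = λ _ → v ; start = refl ; steps = λ () ; rises = λ () ; maximal = none }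
  ... | yes (w , v~w , v<w) = record
    { height = suc A.height
    ; at = λ { zero → v ; (suc i) → A.at i }
    ; start = refl
    ; steps = λ { zero → subst (v ~_) (sym A.start) v~w ; (suc i) → A.steps i }
    ; rises = λ { zero → subst (λ u → key v < key u) (sym A.start) v<w ; (suc i) → A.rises i }
    ; maximal = A.maximal
    }
    where
    module A = Ascent (ascend fuel w
      (≤-trans b≤ (≤-trans (≤-reflexive (sym (+-suc fuel (key v)))) (+-monoʳ-≤ fuel v<w))))

  descend : ∀ fuel v → key v < fuel → ∃[ u ] (Star _~_ u v × ¬ (∃[ w ] (u ~ w × key w < key u)))
  descend (suc fuel) v v< with lower? v
  ... | no none = v , ε , none
  ... | yes (w , v~w , w<v) =
    let u , u⋆w , least = descend fuel w (<-≤-trans w<v (s≤s⁻¹ v<)) in u , u⋆w ◅◅ ~-sym v~w ◅ ε , least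

  module Component (u : Vertex) (least : ¬ (∃[ w ] (u ~ w × key w < key u))) where

    open Ascent (ascend bound u (m≤m+n bound (key u)))

    increasing : ∀ {i j} → toℕ i < toℕ j → key (at i) < key (at j)
    increasing = steps⇒monotone (key ∘ at) rises

    at-injective : ∀ {i j} → at i ≡ at j → i ≡ j
    at-injective {i} {j} e with <-cmp (toℕ i) (toℕ j)
    ... | tri< i<j _ _ = contradiction (cong key e) (<⇒≢ (increasing i<j))
    ... | tri≈ _ i≡j _ = toℕ-injective i≡j
    ... | tri> _ _ i>j = contradiction (sym (cong key e)) (<⇒≢ (increasing i>j))

    successor : ∀ i {w} → at i ~ w → key (at i) < key w → ∃[ j ] (at j ≡ w × toℕ j ≡ suc (toℕ i))
    successor i a~w a<w with view i
    ... | ‵fromℕ     = contradiction (_ , a~w , a<w) maximal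
    ... | ‵inject₁ j = suc j , higher-unique (steps j) a~w (rises j) a<w , cong suc (sym (toℕ-inject₁ j))

    -- A higher neighbour is the next vertex of the ascent and a lower one the previous, so the
    -- ascent from a locally least vertex exhausts its component.
    closed : ∀ i {w} → at i ~ w → ∃[ j ] at j ≡ w
    closed i {w} a~w with <-cmp (key (at i)) (key w)
    ... | tri< a<w _ _ = let j , e , _ = successor i a~w a<w in j , e
    ... | tri≈ _ a≡w _ = contradiction a≡w (separates a~w)
    closed zero    {w} a~w | tri> _ _ w<a =
      contradiction (w , subst (_~ w) start a~w , subst (λ v → key w < key v) start w<a) least
    closed (suc i) {w} a~w | tri> _ _ w<a = inject₁ i , lower-unique (~-sym (steps i)) a~w (rises i) w<a

    reached : ∀ i {w} → Star _~_ (at i) w → ∃[ j ] at j ≡ w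
    reached i ε           = i , refl
    reached i (a~x ◅ x⋆w) with closed i a~x
    ... | j , refl = reached j x⋆w

    step-adjacent : ∀ {i j} → toℕ j ≡ suc (toℕ i) → at i ~ at j
    step-adjacent {i} {suc j} e =
      subst (λ k → at k ~ at (suc j)) (toℕ-injective (trans (toℕ-inject₁ j) (suc-injective e))) (steps j)

    on-path : ∀ i → Star _~_ u (at i)
    on-path i = subst (λ v → Star _~_ v (at i)) start (go at steps i)
      where
      go : ∀ {m} (f : Fin (suc m) → Vertex) → (∀ i → f (inject₁ i) ~ f (suc i)) → ∀ i → Star _~_ (f zero) (f i)
      go         f s zero    = ε
      go {suc m} f s (suc i) = s zero ◅ go (f ∘ suc) (s ∘ suc) i

    path-like : ∀ v → Star _~_ u v → path (suc height) ≅ component G v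
    path-like v u⋆v = record
      { vertices = mk↔ₛ′ to from to∘from from∘to
      ; edges    = λ i j → mk⇔ (λ { (inj₁ e) → step-adjacent e ; (inj₂ e) → ~-sym (step-adjacent e) })
                               (consecutive i j)
      }
      where
      v⋆u : Star _~_ v u
      v⋆u = reverse ~-sym u⋆v
      to : Fin (suc height) → Graph.Vertex (component G v)
      to i = at i ,ᴿ [ v⋆u ◅◅ on-path i ]
      find : ∀ w → .(Star _~_ v w) → ∃[ j ] at j ≡ w
      -- Membership in the component is irrelevant data; a decidable search recovers the index.
      find w v⋆w = recompute (any? (λ j → at j ≟ w)) (reached zero (subst (λ x → Star _~_ x w) (sym start) (u⋆v ◅◅ v⋆w)))
      from : Graph.Vertex (component G v) → Fin (suc height)
      from (w ,ᴿ [ v⋆w ]) = proj₁ (find w v⋆w)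
      to∘from : ∀ w → to (from w) ≡ w
      to∘from (w ,ᴿ [ v⋆w ]) with find w v⋆w
      ... | j , refl = refl
      from∘to : ∀ i → from (to i) ≡ i
      from∘to i = at-injective (proj₂ (find (at i) (v⋆u ◅◅ on-path i)))
      consecutive : ∀ i j → at i ~ at j → toℕ j ≡ suc (toℕ i) ⊎ toℕ i ≡ suc (toℕ j)
      consecutive i j a~a with <-cmp (key (at i)) (key (at j))
      ... | tri< i<j _ _ = let k , e , eq = successor i a~a i<j in inj₁ (trans (cong toℕ (at-injective (sym e))) eq)
      ... | tri≈ _ i≡j _ = contradiction i≡j (separates a~a)
      ... | tri> _ _ j<i = let k , e , eq = successor j (~-sym a~a) j<i in inj₂ (trans (cong toℕ (at-injective (sym e))) eq)

  keyed⇒linear-forest : LinearForest G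
  keyed⇒linear-forest v =
    let u , u⋆v , least = descend (suc (key v)) v ≤-refl in
    _ , Component.path-like u least v u⋆v

maximum : ∀ {n} (f : Fin n → ℕ) → ∃[ k ] ∀ i → f i ≤ k
maximum {zero}  f = 0 , λ ()
maximum {suc n} f = let k , f≤k = maximum (f ∘ suc) in
  f zero ⊔ k , λ { zero → m≤m⊔n _ _ ; (suc i) → ≤-trans (f≤k i) (m≤n⊔m (f zero) k) }

least : ∀ {n} {P : Fin n → Set} → (∀ i → Dec (P i)) → ∃[ i ] P i →
        ∃[ i ] (P i × ∀ j → P j → toℕ i ≤ toℕ j)
least {suc n} P? (i , p) with P? zero
... | yes p₀ = zero , p₀ , λ _ _ → z≤n
least P? (zero  , p) | no ¬p₀ = contradiction p ¬p₀
least P? (suc i , p) | no ¬p₀ = let j , q , min = least (P? ∘ suc) (i , p) in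
  suc j , q , λ { zero p₀ → contradiction p₀ ¬p₀ ; (suc k) r → s≤s (min k r) }

-- Serves two encodings of pairs as numbers: component and place on its path, and later zone and
-- offset.
quotient-unique : ∀ l q q′ {r r′} → q * l + r ≡ q′ * l + r′ → r < l → r′ < l → q ≡ q′ × r ≡ r′
quotient-unique l q q′ {r} {r′} e r<l r′<l with <-cmp q q′
... | tri≈ _ refl _ = refl , +-cancelˡ-≡ (q * l) r r′ e
... | tri< q<q′ _ _ = contradiction e (<⇒≢ (<-≤-trans (+-monoʳ-< (q * l) r<l)
  (≤-trans (≤-reflexive (+-comm (q * l) l)) (m≤n⇒m≤n+o r′ (*-monoˡ-≤ l q<q′)))))
... | tri> _ _ q′<q = contradiction (sym e) (<⇒≢ (<-≤-trans (+-monoʳ-< (q′ * l) r′<l)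
  (≤-trans (≤-reflexive (+-comm (q′ * l) l)) (m≤n⇒m≤n+o r (*-monoˡ-≤ l q′<q)))))

record Layout (G : Graph) : Set where
  field
    position    : Graph.Vertex G → ℕ
    injective   : ∀ {v w} → position v ≡ position w → v ≡ w
    consecutive : ∀ {v w} → G ∋ v ~ w → position w ≡ suc (position v) ⊎ position v ≡ suc (position w)

module LinearForestLayout {n} (_~_ : Fin n → Fin n → Set) (~-sym : ∀ {u v} → u ~ v → v ~ u) (~-irr : ∀ {v} → ¬ v ~ v) where

  G : Graph
  G = record { Vertex = Fin n ; _~_ = _~_ ; ~-sym = ~-sym ; ~-irr = ~-irr }

  module _ (linear : LinearForest G) where
    open _≅_

    walk : ∀ v → Fin (suc (proj₁ (linear v))) → Fin n
    walk v i = value (Inverse.to (vertices (proj₂ (linear v))) i)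

    Connected : Fin n → Fin n → Set
    Connected u v = ∃[ i ] walk u i ≡ v

    connected? : ∀ u v → Dec (Connected u v)
    connected? u v = any? (λ i → walk u i Fin.≟ v)

    star⇒connected : ∀ {u v} → .(Star _~_ u v) → Connected u v
    star⇒connected {u} {v} u⋆v = from (v ,ᴿ [ u⋆v ]) , cong value (strictlyInverseˡ (v ,ᴿ [ u⋆v ]))
      where open Inverse (vertices (proj₂ (linear u)))

    connected⇒star : ∀ {u v} → Connected u v → Irrelevant (Star _~_ u v)
    connected⇒star {u} (i , refl) = proof (Inverse.to (vertices (proj₂ (linear u))) i)

    extend : ∀ {u v w} → Connected u v → Star _~_ v w → Connected u w
    extend c v⋆w with connected⇒star c
    ... | [ u⋆v ] = star⇒connected (u⋆v ◅◅ v⋆w)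

    -- `linear` gives every vertex its own path through the component, and these paths may run in
    -- opposite directions. The least vertex of the component selects one of them.
    root : ∀ v → ∃[ u ] (Connected u v × ∀ w → Connected w v → toℕ u ≤ toℕ w)
    root v = least (λ u → connected? u v) (v , star⇒connected ε)

    longest : ∃[ l ] ∀ v → proj₁ (linear v) ≤ l
    longest = maximum (proj₁ ∘ linear)

    -- No path has more vertices, so blocks of this width keep the components apart.
    width : ℕ
    width = suc (proj₁ longest)

    layout : Layout G
    layout = record
      { position = pos
      ; injective = λ {v} {w} → inj (proj₁ (proj₂ (root v))) (proj₁ (proj₂ (root w)))
      ; consecutive = λ {v} {w} → cons v w
      }
      where
      at : ∀ u {v} → Connected u v → ℕ
      at u (i , _) = toℕ u * width + toℕ i
      i<width : ∀ {u} (i : Fin (suc (proj₁ (linear u)))) → toℕ i < width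
      i<width {u} i = <-≤-trans (toℕ<n i) (s≤s (proj₂ longest u))
      inj : ∀ {u u′ v w} (c : Connected u v) (c′ : Connected u′ w) → at u c ≡ at u′ c′ → v ≡ w
      inj {u} {u′} (i , p) (j , q) e with quotient-unique width (toℕ u) (toℕ u′) e (i<width {u} i) (i<width {u′} j)
      ... | u≡u′ , i≡j with toℕ-injective u≡u′
      ... | refl with toℕ-injective i≡j
      ... | refl = trans (sym p) q
      adjacent : ∀ {u u′ v w} → u ≡ u′ → (c : Connected u v) (c′ : Connected u′ w) → v ~ w →
                 at u′ c′ ≡ suc (at u c) ⊎ at u c ≡ suc (at u′ c′)
      adjacent {u} refl (i , refl) (j , refl) v~w with Equivalence.from (edges (proj₂ (linear u)) i j) v~w
      ... | inj₁ e = inj₁ (trans (cong (toℕ u * width +_) e) (+-suc _ _))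
      ... | inj₂ e = inj₂ (trans (cong (toℕ u * width +_) e) (+-suc _ _))
      pos : Fin n → ℕ
      pos v = at (proj₁ (root v)) (proj₁ (proj₂ (root v)))
      cons : ∀ v w → v ~ w → pos w ≡ suc (pos v) ⊎ pos v ≡ suc (pos w)
      cons v w v~w with root v | root w
      ... | u , c , min | u′ , c′ , min′ =
        adjacent (toℕ-injective (≤-antisym (min u′ (extend c′ (~-sym v~w ◅ ε))) (min′ u (extend c (v~w ◅ ε))))) c c′ v~w

-- Explosions

module _ (G : Graph) {m : ℕ} (f : Fin m → Graph.Vertex G) where

  -- inj₂ (i , u) labels the new neighbour of u that replaces f i.
  Label : Set
  Label = Graph.Vertex G ⊎ (Fin m × Graph.Vertex G)

  Valid : Label → Set
  Valid (inj₁ v)       = ∀ i → f i ≢ v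
  Valid (inj₂ (i , u)) = G ∋ u ~ f i

  LabelAdj : Label → Label → Set
  LabelAdj (inj₁ v)       (inj₁ w)       = G ∋ v ~ w
  LabelAdj (inj₁ v)       (inj₂ (_ , u)) = v ≡ u
  LabelAdj (inj₂ (_ , u)) (inj₁ v)       = v ≡ u
  LabelAdj (inj₂ _)       (inj₂ _)       = ⊥

  -- Describes the outcome of all explosions at once, in place of the nested vertex types of
  -- `explodeAll`. Validity is irrelevant because membership in those types is.
  record Explosion (K : Graph) : Set where
    field
      label      : Graph.Vertex K → Label
      valid      : ∀ x → Irrelevant (Valid (label x))
      injective  : ∀ {x y} → label x ≡ label y → x ≡ y
      surjective : ∀ l → Valid l → ∃[ x ] label x ≡ l
      adjacent   : ∀ x y → (K ∋ x ~ y) ⇔ LabelAdj (label x) (label y)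

open Explosion

refinement-≡ : {A : Set} {P : A → Set} {x y : Refinement A P} → value x ≡ value y → x ≡ y
refinement-≡ refl = refl

-- As the exploded vertices are pairwise nonadjacent, a vertex exploded later still has exactly its
-- neighbours in `G`, so labels over the once exploded graph translate back to labels over `G`.
explosion : ∀ G {m} (f : Fin m → Graph.Vertex G) (inj : Injective _≡_ _≡_ f) → (∀ i j → ¬ G ∋ f i ~ f j) →
            Explosion G f (explodeAll G f inj)
explosion G {zero}  f inj indep = record
  { label      = inj₁
  ; valid      = λ _ → [ (λ ()) ]
  ; injective  = inj₁-injective
  ; surjective = λ { (inj₁ v) _ → v , refl }
  ; adjacent   = λ _ _ → mk⇔ id id
  }
explosion G {suc m} f inj indep = record
  { label      = relabel ∘ label E
  ; valid      = λ x → relabel-valid (label E x) (valid E x)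
  ; injective  = λ {x} {y} e → injective E (relabel-injective (proper (label E x) (valid E x)) (proper (label E y) (valid E y)) e)
  ; surjective = surj
  ; adjacent   = λ x y → mk⇔
      (λ a → proj₁ (relabel-adj (proper (label E x) (valid E x)) (proper (label E y) (valid E y)))
                   (Equivalence.to (adjacent E x y) a))
      (λ a → Equivalence.from (adjacent E x y)
               (proj₂ (relabel-adj (proper (label E x) (valid E x)) (proper (label E y) (valid E y))) a))
  }
  where
  G₁ : Graph
  G₁ = explode G (f zero)
  f₁ : Fin m → Graph.Vertex G₁
  f₁ i = inj₁ (f (suc i) ,ᴿ [ (λ e → 0≢1+n (sym (inj e))) ])
  E : Explosion G₁ f₁ (explodeAll G f inj)
  E = explosion G₁ f₁ _ (λ i j → indep (suc i) (suc j))

  relabel : Label G₁ f₁ → Label G f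
  relabel (inj₁ (inj₁ w))       = inj₁ (value w)
  relabel (inj₁ (inj₂ u))       = inj₂ (zero , value u)
  relabel (inj₂ (i , inj₁ w))   = inj₂ (suc i , value w)
  relabel (inj₂ (i , inj₂ u))   = inj₂ (suc i , value u)

  data Proper : Label G₁ f₁ → Set where
    old   : ∀ w   → Proper (inj₁ (inj₁ w))
    new   : ∀ u   → Proper (inj₁ (inj₂ u))
    later : ∀ i w → Proper (inj₂ (i , inj₁ w))

  -- As the exploded vertices are independent, no new vertex is adjacent to one of them.
  proper : ∀ l → Irrelevant (Valid G₁ f₁ l) → Proper l
  proper (inj₁ (inj₁ w))     _ = old w
  proper (inj₁ (inj₂ u))     _ = new u
  proper (inj₂ (i , inj₁ w)) _ = later i w
  proper (inj₂ (i , inj₂ (u ,ᴿ [ a ]))) [ e ] = Irrelevant.⊥-elim (indep (suc i) zero (subst (λ w → G ∋ w ~ f zero) (sym e) a))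

  relabel-valid : ∀ l → Irrelevant (Valid G₁ f₁ l) → Irrelevant (Valid G f (relabel l))
  relabel-valid (inj₁ (inj₁ (w ,ᴿ [ w≢ ]))) [ v ] =
    [ (λ { zero e → w≢ (sym e) ; (suc i) e → v i (cong inj₁ (refinement-≡ e)) }) ]
  relabel-valid (inj₁ (inj₂ (u ,ᴿ a)))  _     = a
  relabel-valid (inj₂ (i , inj₁ w))    [ a ] = [ a ]
  relabel-valid (inj₂ (i , inj₂ u))    [ e ] with () ← proper (inj₂ (i , inj₂ u)) [ e ]

  relabel-injective : ∀ {l l′} → Proper l → Proper l′ → relabel l ≡ relabel l′ → l ≡ l′
  relabel-injective (old w)     (old w′)    e    = cong (inj₁ ∘ inj₁) (refinement-≡ (inj₁-injective e))
  relabel-injective (new u)     (new u′)    e    = cong (inj₁ ∘ inj₂) (refinement-≡ (cong proj₂ (inj₂-injective e)))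
  relabel-injective (later i w) (later j w′) e with cong proj₁ (inj₂-injective e)
  ... | refl = cong (λ x → inj₂ (i , inj₁ x)) (refinement-≡ (cong proj₂ (inj₂-injective e)))

  relabel-adj : ∀ {l l′} → Proper l → Proper l′ →
    (LabelAdj G₁ f₁ l l′ → LabelAdj G f (relabel l) (relabel l′)) ×
    (LabelAdj G f (relabel l) (relabel l′) → LabelAdj G₁ f₁ l l′)
  relabel-adj (old w)     (old w′)     = id , id
  relabel-adj (old w)     (new u)      = id , id
  relabel-adj (old w)     (later j w′) = (λ e → cong value (inj₁-injective e)) , λ e → cong inj₁ (refinement-≡ e)
  relabel-adj (new u)     (old w′)     = id , id
  relabel-adj (new u)     (new u′)     = id , id
  relabel-adj (new u)     (later j w′) = (λ ()) , λ ()
  relabel-adj (later i w) (old w′)     = (λ e → cong value (inj₁-injective e)) , λ e → cong inj₁ (refinement-≡ e)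
  relabel-adj (later i w) (new u)      = (λ ()) , λ ()
  relabel-adj (later i w) (later j w′) = (λ ()) , λ ()

  surj : ∀ l → Valid G f l → ∃[ x ] relabel (label E x) ≡ l
  surj (inj₁ v) ok =
    let x , e = surjective E (inj₁ (inj₁ (v ,ᴿ [ (λ e → ok zero (sym e)) ])))
                  (λ i e → ok (suc i) (cong value (inj₁-injective e)))
    in x , cong relabel e
  surj (inj₂ (zero , u)) a =
    let x , e = surjective E (inj₁ (inj₂ (u ,ᴿ [ a ]))) (λ i ()) in x , cong relabel e
  surj (inj₂ (suc i , u)) a =
    let x , e = surjective E (inj₂ (i , inj₁ (u ,ᴿ [ (λ e → indep zero (suc i) (subst (λ w → G ∋ w ~ f (suc i)) e a)) ]))) a
    in x , cong relabel e

module _ (G : BipartiteGraph) (S : Subset (BipartiteGraph.bottom G)) where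
  open BipartiteGraph G using (edge) renaming (top to tops; bottom to bottoms)

  data Role : Set where
    tp : Fin tops → Role
    bt : Fin bottoms → Role
    cp : Fin bottoms → Fin tops → Role

  ValidRole : Role → Set
  ValidRole (tp t)   = ⊤
  ValidRole (bt b)   = b Subset.∉ S
  ValidRole (cp b t) = b Subset.∈ S × T (edge t b)

  RoleAdj : Role → Role → Set
  RoleAdj (tp t)   (bt b)   = T (edge t b)
  RoleAdj (bt b)   (tp t)   = T (edge t b)
  RoleAdj (tp t)   (cp b u) = t ≡ u
  RoleAdj (cp b u) (tp t)   = t ≡ u
  RoleAdj _        _        = ⊥

  record Roles (K : Graph) : Set where
    field
      role            : Graph.Vertex K → Role
      role-valid      : ∀ x → ValidRole (role x)
      role-injective  : ∀ {x y} → role x ≡ role y → x ≡ y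
      role-surjective : ∀ r → ValidRole r → ∃[ x ] role x ≡ r
      role-adjacent   : ∀ x y → (K ∋ x ~ y) ⇔ RoleAdj (role x) (role y)

  element : Fin _ → Fin bottoms
  element = lookup (elements S)

  element∈ : ∀ i → element i Subset.∈ S
  element∈ i = proj₂ (List.∈-filter⁻ (_∈? S) {xs = allFin _} (List.∈-lookup i))

  ∈⇒element : ∀ {b} → b Subset.∈ S → ∃[ i ] element i ≡ b
  ∈⇒element {b} b∈S = let p = List.∈-filter⁺ (_∈? S) (List.∈-allFin b) b∈S in index p , sym (lookup-index p)

  roles-from-labels : Roles (explodeBottom G S)
  roles-from-labels = record
    { role            = λ x → toRole (label E x)
    ; role-valid      = λ x → toRole-valid (proper (label E x) (valid E x)) (valid E x)
    ; role-injective  = λ {x} {y} e → injective E (toRole-injective (proper (label E x) (valid E x)) (proper (label E y) (valid E y)) e)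
    ; role-surjective = surj
    ; role-adjacent   = λ x y → mk⇔
        (λ a → proj₁ (toRole-adj (proper (label E x) (valid E x)) (proper (label E y) (valid E y))) (Equivalence.to (adjacent E x y) a))
        (λ a → Equivalence.from (adjacent E x y) (proj₂ (toRole-adj (proper (label E x) (valid E x)) (proper (label E y) (valid E y))) a))
    }
    where
    f : Fin _ → Graph.Vertex (toGraph G)
    f = inj₂ ∘ element
    E : Explosion (toGraph G) f (explodeBottom G S)
    E = explosion (toGraph G) f _ (λ i j ())

    toRole : Label (toGraph G) f → Role
    toRole (inj₁ (inj₁ t))     = tp t
    toRole (inj₁ (inj₂ b))     = bt b
    toRole (inj₂ (i , inj₁ t)) = cp (element i) t
    -- A default: no bottom vertex is a neighbour of an exploded one, so such a label is never
    -- valid.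
    toRole (inj₂ (i , inj₂ b)) = bt b

    data Proper : Label (toGraph G) f → Set where
      top⁺  : ∀ t   → Proper (inj₁ (inj₁ t))
      bot⁺  : ∀ b   → Proper (inj₁ (inj₂ b))
      copy⁺ : ∀ i t → Proper (inj₂ (i , inj₁ t))

    proper : ∀ l → Irrelevant (Valid (toGraph G) f l) → Proper l
    proper (inj₁ (inj₁ t))     _ = top⁺ t
    proper (inj₁ (inj₂ b))     _ = bot⁺ b
    proper (inj₂ (i , inj₁ t)) _ = copy⁺ i t

    toRole-valid : ∀ {l} → Proper l → Irrelevant (Valid (toGraph G) f l) → ValidRole (toRole l)
    toRole-valid (top⁺ t)    _     = tt
    toRole-valid (bot⁺ b)    [ v ] b∈S = Irrelevant.⊥-elim (v (proj₁ (∈⇒element b∈S)) (cong inj₂ (proj₂ (∈⇒element b∈S))))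
    toRole-valid (copy⁺ i t) [ a ] = element∈ i , recompute (T? _) a

    toRole-injective : ∀ {l l′} → Proper l → Proper l′ → toRole l ≡ toRole l′ → l ≡ l′
    toRole-injective (top⁺ t)    (top⁺ .t) refl = refl
    toRole-injective (bot⁺ b)    (bot⁺ .b) refl = refl
    toRole-injective (copy⁺ i t) (copy⁺ j u) e with lookup-injective (elements-unique S) (cong exploded e) | cong neighbour e
      where
      exploded : Role → Fin bottoms
      exploded (cp b _) = b
      exploded _        = element i
      neighbour : Role → Fin tops
      neighbour (cp _ t) = t
      neighbour _        = t
    ... | refl | refl = refl

    toRole-adj : ∀ {l l′} → Proper l → Proper l′ →
      (LabelAdj (toGraph G) f l l′ → RoleAdj (toRole l) (toRole l′)) ×
      (RoleAdj (toRole l) (toRole l′) → LabelAdj (toGraph G) f l l′)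
    toRole-adj (top⁺ t)    (top⁺ t₁)     = id , id
    toRole-adj (top⁺ t)    (bot⁺ b)      = id , id
    toRole-adj (top⁺ t)    (copy⁺ i t₁)  = inj₁-injective , cong inj₁
    toRole-adj (bot⁺ b)    (top⁺ t)      = id , id
    toRole-adj (bot⁺ b)    (bot⁺ b₁)     = id , id
    toRole-adj (bot⁺ b)    (copy⁺ i t)   = (λ ()) , λ ()
    toRole-adj (copy⁺ i t) (top⁺ t₁)     = inj₁-injective , cong inj₁
    toRole-adj (copy⁺ i t) (bot⁺ b)      = (λ ()) , λ ()
    toRole-adj (copy⁺ i t) (copy⁺ i₁ t₁) = (λ ()) , λ ()

    surj : ∀ r → ValidRole r → ∃[ x ] toRole (label E x) ≡ r
    surj (tp t)   _   = let x , e = surjective E (inj₁ (inj₁ t)) (λ i ()) in x , cong toRole e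
    surj (bt b)   b∉S =
      let x , e = surjective E (inj₁ (inj₂ b)) (λ i e → b∉S (subst (Subset._∈ S) (inj₂-injective e) (element∈ i)))
      in x , cong toRole e
    surj (cp b t) (b∈S , a) with ∈⇒element b∈S
    ... | i , refl = let x , e = surjective E (inj₂ (i , inj₁ t)) a in x , cong toRole e

  abstract
    roles : Roles (explodeBottom G S)
    roles = roles-from-labels

-- Path decompositions of width one

two-distinct : {A : Set} {xs : List A} {u v w : A} → length xs ≤ 2 → u ∈ xs → v ∈ xs → w ∈ xs →
               u ≢ v → u ≢ w → v ≢ w → ⊥
two-distinct {xs = _ ∷ []} _ (here refl) (here refl) _ u≢v _ _ = u≢v refl
two-distinct {xs = _ ∷ _ ∷ []} _ (here refl) (here refl) _ u≢v _ _ = u≢v refl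
two-distinct {xs = _ ∷ _ ∷ []} _ (there (here refl)) (there (here refl)) _ u≢v _ _ = u≢v refl
two-distinct {xs = _ ∷ _ ∷ []} _ (here refl) (there (here refl)) (here refl) _ u≢w _ = u≢w refl
two-distinct {xs = _ ∷ _ ∷ []} _ (here refl) (there (here refl)) (there (here refl)) _ _ v≢w = v≢w refl
two-distinct {xs = _ ∷ _ ∷ []} _ (there (here refl)) (here refl) (here refl) _ _ v≢w = v≢w refl
two-distinct {xs = _ ∷ _ ∷ []} _ (there (here refl)) (here refl) (there (here refl)) _ u≢w _ = u≢w refl
two-distinct {xs = _ ∷ _ ∷ _ ∷ _} (s≤s (s≤s ()))

module FirstBag (K : Graph) (_≟_ : DecidableEquality (Graph.Vertex K))
  (D : PathDecomposition K) (narrow : PathDecomposition.width D ≤ 1) where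
  open Graph K
  open PathDecomposition D

  Within : Fin (length bags) → Vertex → Set
  Within i v = v ∈ lookup bags i

  within? : ∀ i v → Dec (Within i v)
  within? i v = Any.any? (v ≟_) (lookup bags i)

  bag-length : ∀ i → length (lookup bags i) ≤ 2
  bag-length i = ≤-trans (m≤n+m∸n _ 1) (+-monoʳ-≤ 1 (≤-trans (∸-monoˡ-≤ 1 (go bags i)) narrow))
    where
    go : ∀ (Xs : List (List Vertex)) i → length (lookup Xs i) ≤ foldr _⊔_ 0 (map length Xs)
    go (X ∷ Xs) zero    = m≤m⊔n _ _
    go (X ∷ Xs) (suc i) = ≤-trans (go Xs i) (m≤n⊔m (length X) _)

  small : ∀ i {u v w} → Within i u → Within i v → Within i w → u ≢ v → u ≢ w → v ≢ w → ⊥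
  small i = two-distinct (bag-length i)

  common : ∀ {u v} → u ~ v → ∃[ i ] (Within i u × Within i v)
  common u~v = let p = edges _ _ u~v in index p , lookup-index p

  abstract
    first-bag : ∀ v → ∃[ i ] (Within i v × ∀ j → Within j v → toℕ i ≤ toℕ j)
    first-bag v = least (λ i → within? i v) (let p = vertices v in index p , lookup-index p)

  opening : Vertex → Fin (length bags)
  opening v = proj₁ (first-bag v)

  key : Vertex → ℕ
  key v = toℕ (opening v)

  within-first : ∀ v → Within (opening v) v
  within-first v = proj₁ (proj₂ (first-bag v))

  first-least : ∀ {j} v → Within j v → key v ≤ toℕ j
  first-least v = proj₂ (proj₂ (first-bag v)) _

  between : ∀ {v l j} → key v ≤ toℕ l → toℕ l ≤ toℕ j → Within j v → Within l v
  between {v} i≤l l≤j = interval v (opening v) _ _ i≤l l≤j (within-first v)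

  distinct : ∀ {u v} → u ~ v → u ≢ v
  distinct u~u refl = ~-irr u~u

  Spine : Vertex → Set
  Spine v = ∃[ w ] ∃[ w′ ] (v ~ w × v ~ w′ × w ≢ w′)

  other : ∀ {v} → Spine v → ∀ u → ∃[ w ] (v ~ w × w ≢ u)
  other (w , w′ , v~w , v~w′ , w≢w′) u with w ≟ u
  ... | no w≢u   = w , v~w , w≢u
  ... | yes refl = w′ , v~w′ , w≢w′ ∘ sym

  -- When `v` opens, `u` has already opened, and it lasts until a bag shared with `v`, which comes
  -- no earlier.
  meet : ∀ {u v} → u ~ v → key u ≤ key v → Within (opening v) u
  meet u~v u≤v = let j , u∈ , v∈ = common u~v in between u≤v (first-least _ v∈) u∈

  -- Each of the two meets a further neighbour in some bag. If both open together, the earlier of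
  -- these two bags contains `u` and `v` besides that neighbour, since the other one lasts until its
  -- own meeting.
  separates : ∀ {u v} → Spine u → Spine v → u ~ v → key u ≢ key v
  separates {u} {v} su sv u~v e =
    let w , u~w , w≢v = other su v ; z , v~z , z≢u = other sv u
        i , u∈i , w∈i = common u~w ; j , v∈j , z∈j = common v~z
    in case (≤-total (toℕ i) (toℕ j)) u~w w≢v v~z z≢u u∈i w∈i v∈j z∈j
    where
    case : ∀ {w z i j} → toℕ i ≤ toℕ j ⊎ toℕ j ≤ toℕ i → u ~ w → w ≢ v → v ~ z → z ≢ u →
           Within i u → Within i w → Within j v → Within j z → ⊥
    case {i = i} (inj₁ i≤j) u~w w≢v v~z z≢u u∈i w∈i v∈j z∈j =
      small i u∈i w∈i (between (≤-trans (≤-reflexive (sym e)) (first-least u u∈i)) i≤j v∈j) (distinct u~w) (distinct u~v) w≢v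
    case {j = j} (inj₂ j≤i) u~w w≢v v~z z≢u u∈i w∈i v∈j z∈j =
      small j v∈j z∈j (between (≤-trans (≤-reflexive e) (first-least v v∈j)) j≤i u∈i) (distinct v~z) (distinct (~-sym u~v)) z≢u

  -- Both lower neighbours last until the bag that opens `v`, which would then hold three vertices.
  lower-unique : ∀ {v u u′} → v ~ u → v ~ u′ → key u < key v → key u′ < key v → u ≡ u′
  lower-unique {v} {u} {u′} v~u v~u′ u<v u′<v with u ≟ u′
  ... | yes e   = e
  ... | no u≢u′ = contradiction (distinct v~u′) (λ v≢u′ →
    small (opening v) (within-first v) (meet (~-sym v~u) (<⇒≤ u<v)) (meet (~-sym v~u′) (<⇒≤ u′<v)) (distinct v~u) v≢u′ u≢u′)

  -- `v` meets its second neighbour `w` somewhere. If this happens before `v′` opens, then `u`,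
  -- which lasts until `v′` opens, is a third vertex there; otherwise `v` lasts until then and
  -- shares that bag with `u` and `v′`.
  apart : ∀ {u v v′} → Spine v → u ~ v → u ~ v′ → key u < key v → key u < key v′ → v ≢ v′ → key v < key v′ → ⊥
  apart {u} {v} {v′} sv u~v u~v′ u<v u<v′ v≢v′ lt with other sv u
  ... | w , v~w , w≢u with common v~w
  ...   | j , v∈j , w∈j with key v′ ≤? toℕ j
  ...     | yes v′≤j = small (opening v′) (within-first v′) (between (<⇒≤ lt) v′≤j v∈j) (meet u~v′ (<⇒≤ u<v′))
                           (v≢v′ ∘ sym) (distinct (~-sym u~v′)) (distinct (~-sym u~v))
  ...     | no v′≰j  = small j v∈j w∈j
                           (between (≤-trans (<⇒≤ u<v) (first-least v v∈j)) (<⇒≤ (≰⇒> v′≰j)) (meet u~v′ (<⇒≤ u<v′)))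
                           (distinct v~w) (distinct (~-sym u~v)) w≢u

  higher-unique : ∀ {u v v′} → Spine v → Spine v′ → u ~ v → u ~ v′ → key u < key v → key u < key v′ → v ≡ v′
  higher-unique {u} {v} {v′} sv sv′ u~v u~v′ u<v u<v′ with v ≟ v′
  ... | yes e   = e
  ... | no v≢v′ with <-cmp (key v) (key v′)
  ...   | tri< lt _ _ = ⊥-elim (apart sv u~v u~v′ u<v u<v′ v≢v′ lt)
  ...   | tri≈ _ eq _ = ⊥-elim (small (opening v) (within-first v)
    (subst (λ i → Within i v′) (sym (toℕ-injective eq)) (within-first v′)) (meet u~v (<⇒≤ u<v))
    v≢v′ (distinct (~-sym u~v)) (distinct (~-sym u~v′)))
  ...   | tri> _ _ gt = ⊥-elim (apart sv′ u~v′ u~v u<v′ u<v (v≢v′ ∘ sym) gt)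

-- `Covers x v` puts `v` into bag `x`. One vertex per side and bag gives width one; later the sides
-- are the top vertices and all others.
module Covering (K : Graph) (Covers : ℕ → Graph.Vertex K → Set) (side : Graph.Vertex K → Bool) (bound : ℕ)
  (occupied? : ∀ s x → Dec (∃[ v ] (side v ≡ s × Covers x v)))
  (unique    : ∀ {x u v} → side u ≡ side v → Covers x u → Covers x v → u ≡ v)
  (bounded   : ∀ {x v} → Covers x v → x < bound)
  (inhabited : ∀ v → ∃[ x ] Covers x v)
  (meets     : ∀ {u v} → K ∋ u ~ v → ∃[ x ] (Covers x u × Covers x v))
  (convex    : ∀ {x y z v} → x ≤ y → y ≤ z → Covers x v → Covers z v → Covers y v)
  where
  open Graph K

  occupant : Bool → ℕ → List Vertex
  occupant s x with occupied? s x
  ... | yes (v , _) = v ∷ []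
  ... | no _        = []

  bag : ℕ → List Vertex
  bag x = occupant true x ++ occupant false x

  occupant⁻ : ∀ s x {v} → v ∈ occupant s x → side v ≡ s × Covers x v
  occupant⁻ s x v∈ with occupied? s x
  occupant⁻ s x (here refl) | yes (_ , p) = p

  occupant⁺ : ∀ s x {v} → side v ≡ s → Covers x v → v ∈ occupant s x
  occupant⁺ s x {v} e c with occupied? s x
  ... | yes (w , e′ , c′) = here (unique (trans e (sym e′)) c c′)
  ... | no none           = contradiction (v , e , c) none

  bag⁻ : ∀ x {v} → v ∈ bag x → Covers x v
  bag⁻ x v∈ with List.∈-++⁻ (occupant true x) v∈
  ... | inj₁ p = proj₂ (occupant⁻ true x p)
  ... | inj₂ p = proj₂ (occupant⁻ false x p)

  bag⁺ : ∀ x {v} → Covers x v → v ∈ bag x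
  bag⁺ x {v} c with side v in e
  ... | true  = List.∈-++⁺ˡ (occupant⁺ true x e c)
  ... | false = List.∈-++⁺ʳ (occupant true x) (occupant⁺ false x e c)

  bag-unique : ∀ x → Unique (bag x)
  bag-unique x with occupied? true x | occupied? false x
  ... | no _            | no _            = []
  ... | no _            | yes _           = [] ∷ []
  ... | yes _           | no _            = [] ∷ []
  ... | yes (v , p , _) | yes (w , q , _) = ((λ { refl → contradiction (trans (sym p) q) λ () }) ∷ []) ∷ [] ∷ []

  bag-length : ∀ x → length (bag x) ≤ 2
  bag-length x with occupied? true x | occupied? false x
  ... | no _  | no _  = z≤n
  ... | no _  | yes _ = s≤s z≤n
  ... | yes _ | no _  = s≤s z≤n
  ... | yes _ | yes _ = ≤-refl

  covering⇒pathwidth : PathwidthAtMost 1 K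
  covering⇒pathwidth = record
    { bags      = applyUpTo bag bound
    ; bags-sets = All.applyUpTo⁺₂ bag bound bag-unique
    ; vertices  = λ v → let x , c = inhabited v in Any.applyUpTo⁺ bag (bag⁺ x c) (bounded c)
    ; edges     = λ u v u~v → let x , c , d = meets u~v in Any.applyUpTo⁺ bag (bag⁺ x c , bag⁺ x d) (bounded c)
    ; interval  = λ v i l j i≤l l≤j p q → at⁺ l (convex i≤l l≤j (at⁻ i p) (at⁻ j q))
    } , ∸-monoˡ-≤ 1 (widest bag bound bag-length)
    where
    at⁻ : ∀ i {v} → v ∈ lookup (applyUpTo bag bound) i → Covers (toℕ i) v
    at⁻ i {v} p = bag⁻ (toℕ i) (subst (v ∈_) (lookup-applyUpTo bag bound i) p)
    at⁺ : ∀ i {v} → Covers (toℕ i) v → v ∈ lookup (applyUpTo bag bound) i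
    at⁺ i {v} c = subst (v ∈_) (sym (lookup-applyUpTo bag bound i)) (bag⁺ (toℕ i) c)
    widest : ∀ (f : ℕ → List Vertex) n → (∀ x → length (f x) ≤ 2) → foldr _⊔_ 0 (map length (applyUpTo f n)) ≤ 2
    widest f zero    f≤ = z≤n
    widest f (suc n) f≤ = ⊔-lub (f≤ 0) (widest (f ∘ suc) n (f≤ ∘ suc))

-- Counting

pigeonhole : {A B : Set} (R : A → B → Set) {xs : List A} (ys : List B) → Unique xs →
             (∀ {x} → x ∈ xs → ∃[ y ] (y ∈ ys × R x y)) →
             (∀ {x x′ y} → x ∈ xs → x′ ∈ xs → R x y → R x′ y → x ≡ x′) → length xs ≤ length ys
pigeonhole R ys [] total inj = z≤n
pigeonhole R {x ∷ xs} ys (x∉ ∷ u) total inj with total (here refl)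
... | y , y∈ , r with List.∈-∃++ y∈
... | as , bs , refl = ≤-trans
  (s≤s (pigeonhole R (as ++ bs) u total′ (λ p q → inj (there p) (there q))))
  (≤-reflexive (trans (cong suc (length-++ as)) (trans (sym (+-suc (length as) (length bs))) (sym (length-++ as)))))
  where
  total′ : ∀ {z} → z ∈ xs → ∃[ y′ ] (y′ ∈ as ++ bs × R z y′)
  total′ z∈ with total (there z∈)
  ... | y′ , y′∈ , r′ with List.∈-++⁻ as y′∈
  ...   | inj₁ p            = y′ , List.∈-++⁺ˡ p , r′
  ...   | inj₂ (there p)    = y′ , List.∈-++⁺ʳ as p , r′
  ...   | inj₂ (here refl)  = contradiction (inj (here refl) (there z∈) r r′) (All.lookup x∉ z∈)

length-elements : ∀ {n} (S : Subset n) → length (elements S) ≡ ∣ S ∣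
length-elements S = go S (_∈? S) id (does-∈? S)
  where
  does-∈? : ∀ {n} (S : Subset n) i → does (i ∈? S) ≡ Vec.lookup S i
  does-∈? (true  Vec.∷ S) zero    = refl
  does-∈? (false Vec.∷ S) zero    = refl
  does-∈? (_     Vec.∷ S) (suc i) = does-∈? S i
  go : ∀ {n} (S : Subset n) {A : Set} {P : A → Set} (P? : ∀ a → Dec (P a)) (f : Fin n → A) →
       (∀ i → does (P? (f i)) ≡ Vec.lookup S i) → length (filter P? (tabulate f)) ≡ ∣ S ∣
  go Vec.[]           P? f e = refl
  go (true  Vec.∷ S) P? f e with does (P? (f zero)) | e zero
  ... | true | _ = cong suc (go S P? (f ∘ suc) (e ∘ suc))
  go (false Vec.∷ S) P? f e with does (P? (f zero)) | e zero
  ... | false | _ = go S P? (f ∘ suc) (e ∘ suc)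

-- Combinatorics of the instances

module Facts (I : Instance) where
  open Instances I

  Top Bottom : Set
  Top    = Fin (card I top)
  Bottom = Fin (card I bottom)

  code : Labelled I → Fin (order I kinds)
  code (top  , t) = t ↑ˡ order I (bot₀ ∷ bot₁ ∷ bot₂ ∷ [])
  code (bot₀ , b) = card I top ↑ʳ (b ↑ˡ order I (bot₁ ∷ bot₂ ∷ []))
  code (bot₁ , b) = card I top ↑ʳ (card I bottom ↑ʳ (b ↑ˡ order I (bot₂ ∷ [])))
  code (bot₂ , b) = card I top ↑ʳ (card I bottom ↑ʳ (card I bottom ↑ʳ (b ↑ˡ 0)))

  V∘code : ∀ u → V (code u) ≡ u
  V∘code (top  , t) rewrite splitAt-↑ˡ (card I top) t (order I (bot₀ ∷ bot₁ ∷ bot₂ ∷ [])) = refl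
  V∘code (bot₀ , b)
    rewrite splitAt-↑ʳ (card I top) _ (b ↑ˡ order I (bot₁ ∷ bot₂ ∷ []))
          | splitAt-↑ˡ (card I bottom) b (order I (bot₁ ∷ bot₂ ∷ [])) = refl
  V∘code (bot₁ , b)
    rewrite splitAt-↑ʳ (card I top) _ (card I bottom ↑ʳ (b ↑ˡ order I (bot₂ ∷ [])))
          | splitAt-↑ʳ (card I bottom) _ (b ↑ˡ order I (bot₂ ∷ []))
          | splitAt-↑ˡ (card I bottom) b (order I (bot₂ ∷ [])) = refl
  V∘code (bot₂ , b)
    rewrite splitAt-↑ʳ (card I top) _ (card I bottom ↑ʳ (card I bottom ↑ʳ (b ↑ˡ 0)))
          | splitAt-↑ʳ (card I bottom) _ (card I bottom ↑ʳ (b ↑ˡ 0))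
          | splitAt-↑ʳ (card I bottom) _ (b ↑ˡ 0)
          | splitAt-↑ˡ (card I bottom) b 0 = refl

  code∘V : ∀ i → code (V i) ≡ i
  code∘V i with splitAt (card I top) i in e
  ... | inj₁ t = splitAt⁻¹-↑ˡ e
  ... | inj₂ j with splitAt (card I bottom) j in e₀
  ...   | inj₁ b = trans (cong (card I top ↑ʳ_) (splitAt⁻¹-↑ˡ e₀)) (splitAt⁻¹-↑ʳ {m = card I top} e)
  ...   | inj₂ k with splitAt (card I bottom) k in e₁
  ...     | inj₁ b = trans (cong (card I top ↑ʳ_) (trans (cong (card I bottom ↑ʳ_) (splitAt⁻¹-↑ˡ e₁))
                       (splitAt⁻¹-↑ʳ {m = card I bottom} e₀))) (splitAt⁻¹-↑ʳ {m = card I top} e)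
  ...     | inj₂ l with splitAt (card I bottom) l in e₂
  ...       | inj₁ b = trans (cong (card I top ↑ʳ_) (trans (cong (card I bottom ↑ʳ_)
                         (trans (cong (card I bottom ↑ʳ_) (splitAt⁻¹-↑ˡ e₂)) (splitAt⁻¹-↑ʳ {m = card I bottom} e₁)))
                         (splitAt⁻¹-↑ʳ {m = card I bottom} e₀))) (splitAt⁻¹-↑ʳ {m = card I top} e)

  V-injective : ∀ {i j} → V i ≡ V j → i ≡ j
  V-injective {i} {j} e = trans (sym (code∘V i)) (trans (cong code e) (code∘V j))

  apart⇒≢ : ∀ {s} {i j : Fin (card I s)} → Apart {s} i j → i ≢ j
  apart⇒≢ {s} {i} a refl = Apart-irrefl {s} {i} a

  ≢⇒apart : ∀ {s} {i j : Fin (card I s)} → i ≢ j → Apart {s} i j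
  ≢⇒apart {s} {i} {j} i≢j with <-cmp (toℕ i) (toℕ j)
  ... | tri< i<j _ _ = inj₁ i<j
  ... | tri≈ _ i≡j _ = contradiction (toℕ-injective i≡j) i≢j
  ... | tri> _ _ j<i = inj₂ j<i

  same⇒≡ : ∀ {s} {i j : Fin (card I s)} → ¬ Apart {s} i j → i ≡ j
  same⇒≡ {s} {i} {j} same with i Fin.≟ j
  ... | yes e  = e
  ... | no i≢j = contradiction (≢⇒apart {s} i≢j) same

  core? : ∀ t → Dec (Core t)
  core? t = sat? {I} (coreᶠ here) (tt , t)

  coreNbr? : ∀ b t → Dec (CoreNbr b t)
  coreNbr? b t = sat? {I} (core-nbrᶠ (there here) here) ((tt , b) , t)

  edge? : ∀ t b → Dec (Edge t b)
  edge? t b = sat? {I} (edgeᶠ (there here) here) ((tt , t) , b)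

  pendant? : ∀ b t → Dec (Pendant b t)
  pendant? b t = sat? {I} (pendantᶠ (there here) here) ((tt , b) , t)

  link? : ∀ b t t′ → Dec (Link b t t′)
  link? b t t′ = sat? {I} (linkᶠ (there (there here)) (there here) here) (((tt , b) , t) , t′)

  redundant? : ∀ b → Dec (Redundant b)
  redundant? b = sat? {I} (redundantᶠ here) (tt , b)

  forced? : ∀ b → Dec (Forced b)
  forced? b = sat? {I} (forcedᶠ here) (tt , b)

  in? : ∀ b → Dec (In b)
  in? b = sat? {I} (memᶠ here) (tt , b)

  core : ∀ {t b b′} → b ≢ b′ → Edge t b → Edge t b′ → Core t
  core {t} {b} {b′} b≢b′ e e′ with ≢⇒apart {bottom} b≢b′
  ... | inj₁ b<b′ = b , b′ , b<b′ , e , e′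
  ... | inj₂ b′<b = b′ , b , b′<b , e′ , e

  heavy : ∀ {b t u v} → t ≢ u → t ≢ v → u ≢ v → CoreNbr b t → CoreNbr b u → CoreNbr b v → Heavy b
  heavy {b} {t} {u} {v} t≢u t≢v u≢v p q r with ≢⇒apart {top} t≢u | ≢⇒apart {top} t≢v | ≢⇒apart {top} u≢v
  ... | inj₁ t<u | _        | inj₁ u<v = t , u , v , t<u , u<v , p , q , r
  ... | inj₁ t<u | inj₁ t<v | inj₂ v<u = t , v , u , t<v , v<u , p , r , q
  ... | inj₁ t<u | inj₂ v<t | inj₂ v<u = v , t , u , v<t , t<u , r , p , q
  ... | inj₂ u<t | inj₁ t<v | _        = u , t , v , u<t , t<v , q , p , r
  ... | inj₂ u<t | inj₂ v<t | inj₁ u<v = u , v , t , u<v , v<t , q , r , p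
  ... | inj₂ u<t | inj₂ v<t | inj₂ v<u = v , u , t , v<u , u<t , r , q , p

  link-ends : ∀ {b t t′ u} → Link b t t′ → CoreNbr b u → u ≡ t ⊎ u ≡ t′
  link-ends {b} {t} {t′} {u} (light , apart , p , q) r with u Fin.≟ t | u Fin.≟ t′
  ... | yes e  | _      = inj₁ e
  ... | no _   | yes e  = inj₂ e
  ... | no u≢t | no u≢t′ = contradiction (heavy (apart⇒≢ {top} apart) (u≢t ∘ sym) (u≢t′ ∘ sym) p q r) light

  link-other : ∀ {b t t′ t″} → Link b t t′ → Link b t t″ → t′ ≡ t″
  link-other l (_ , apart , _ , q) with link-ends l q
  ... | inj₁ e = contradiction (sym e) (apart⇒≢ {top} apart)
  ... | inj₂ e = sym e

  link-pair : ∀ {b t t′ u u′} → Link b t t′ → Link b u u′ → (u ≡ t × u′ ≡ t′) ⊎ (u ≡ t′ × u′ ≡ t)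
  link-pair l l′@(_ , _ , p , _) with link-ends l p
  ... | inj₁ refl = inj₁ (refl , link-other l′ l)
  ... | inj₂ refl = inj₂ (refl , link-other l′ (Link-sym l))

  pendant-nbr : ∀ {b t u} → Pendant b t → CoreNbr b u → t ≡ u
  pendant-nbr {b} {t} {u} (_ , none , _) q with t Fin.≟ u
  ... | yes e  = e
  ... | no t≢u = contradiction (u , ≢⇒apart {top} t≢u , q) none

  pendant-not-link : ∀ {b t u u′} → Pendant b t → ¬ Link b u u′
  pendant-not-link p (_ , apart , q , r) =
    apart⇒≢ {top} apart (trans (sym (pendant-nbr p q)) (pendant-nbr p r))

  pendant-light : ∀ {b t} → Pendant b t → ¬ Heavy b
  pendant-light p (t , u , _ , t<u , _ , q , r , _) =
    apart⇒≢ {top} (inj₁ t<u) (trans (sym (pendant-nbr p q)) (pendant-nbr p r))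

  pendant-not-forced : ∀ {b t} → Pendant b t → ¬ Forced b
  pendant-not-forced p (inj₁ h)               = pendant-light p h
  pendant-not-forced p (inj₂ (_ , _ , l , _)) = pendant-not-link p l

  rival : ∀ {b t t′} → Redundant b → Link b t t′ → ∃[ b′ ] (Prior b′ b × Link b′ t t′)
  rival (u , u′ , l , b′ , prior , l′) l₀ with link-pair l l₀
  ... | inj₁ (refl , refl) = b′ , prior , l′
  ... | inj₂ (refl , refl) = b′ , prior , Link-sym l′

  prior-total : ∀ {b b′} → b ≢ b′ → Prior b b′ ⊎ Prior b′ b
  prior-total {b} {b′} b≢b′ with in? b | in? b′
  ... | yes p | no q  = inj₂ (inj₁ (p , q))
  ... | no p  | yes q = inj₁ (inj₁ (q , p))
  ... | yes p | yes q with ≢⇒apart {bottom} b≢b′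
  ...   | inj₁ lt = inj₁ (inj₂ (lt , λ (_ , r) → r q))
  ...   | inj₂ gt = inj₂ (inj₂ (gt , λ (_ , r) → r p))
  prior-total {b} {b′} b≢b′ | no p | no q with ≢⇒apart {bottom} b≢b′
  ...   | inj₁ lt = inj₁ (inj₂ (lt , λ (r , _) → p r))
  ...   | inj₂ gt = inj₂ (inj₂ (gt , λ (r , _) → q r))

  -- Contrapositively, every predecessor of a vertex outside `X` is outside `X`.
  prior-in : ∀ {b b′} → Prior b′ b → In b′ → In b
  prior-in (inj₁ (p , _)) _ = p
  prior-in {b} (inj₂ (_ , q)) p with in? b
  ... | yes r = r
  ... | no r  = contradiction (p , r) q

  parallel : ∀ {b b′ t t′} → b ≢ b′ → Link b t t′ → Link b′ t t′ → Redundant b ⊎ Redundant b′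
  parallel {b} {b′} {t} {t′} b≢b′ l l′ with prior-total b≢b′
  ... | inj₁ p = inj₂ (t , t′ , l′ , b , p , l)
  ... | inj₂ p = inj₁ (t , t′ , l , b′ , p , l′)

  -- Prior compares ranks: the vertices outside X come first.
  rank : Bottom → ℕ
  rank b with in? b
  ... | yes _ = card I bottom + toℕ b
  ... | no _  = toℕ b

  prior-rank : ∀ {b′ b} → Prior b′ b → rank b′ < rank b
  prior-rank {b′} {b} p with in? b′ | in? b
  prior-rank (inj₁ (p , q))       | yes r | _     = contradiction r q
  prior-rank (inj₂ (lt , _))      | yes r | yes s = +-monoʳ-< (card I bottom) lt
  prior-rank (inj₂ (_ , q))       | yes r | no s  = contradiction (r , s) q
  prior-rank {b′} p               | no r  | yes s = <-≤-trans (toℕ<n b′) (m≤m+n _ _)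
  prior-rank (inj₁ (p , _))       | no r  | no s  = contradiction p s
  prior-rank (inj₂ (lt , _))      | no r  | no s  = lt

  -- Passing from a redundant vertex to its rival lowers the rank, so the search ends.
  representative : ∀ {b t t′} → Link b t t′ → ∃[ b′ ] (Link b′ t t′ × ¬ Redundant b′)
  representative {b} l = go (suc (rank b)) l ≤-refl
    where
    go : ∀ fuel {b t t′} → Link b t t′ → rank b < fuel → ∃[ b′ ] (Link b′ t t′ × ¬ Redundant b′)
    go (suc fuel) {b} l b< with redundant? b
    ... | no r  = b , l , r
    ... | yes r = let b′ , p , l′ = rival r l in go fuel l′ (<-≤-trans (prior-rank p) (s≤s⁻¹ b<))

∈⇒In : (I : Instance) → ∀ {b} → b Subset.∈ proj₂ I → Instances.In I b
∈⇒In I b∈X = Equivalence.from T-≡ ([]=⇒lookup b∈X)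

In⇒∈ : (I : Instance) → ∀ {b} → Instances.In I b → b Subset.∈ proj₂ I
In⇒∈ I {b} p = lookup⇒[]= b (proj₂ I) (Equivalence.to T-≡ p)

-- From explosions to deletions

module Forward (I : Instance) (S : Subset (card I bottom)) (S⊆X : S Subset.⊆ proj₂ I)
  (decomposition : PathwidthAtMost 1 (explodeBottom (proj₁ I) S)) where
  open Instances I
  open Facts I

  K : Graph
  K = explodeBottom (proj₁ I) S

  open Graph K using (_~_; ~-sym)
  open Roles (roles (proj₁ I) S)

  role≟ : DecidableEquality (Role (proj₁ I) S)
  role≟ (tp t)   (tp u)   = map′ (cong tp) (λ { refl → refl }) (t Fin.≟ u)
  role≟ (bt b)   (bt c)   = map′ (cong bt) (λ { refl → refl }) (b Fin.≟ c)
  role≟ (cp b t) (cp c u) = map′ (λ (p , q) → cong₂ cp p q) (λ { refl → refl , refl }) (b Fin.≟ c ×-dec t Fin.≟ u)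
  role≟ (tp _)   (bt _)   = no λ ()
  role≟ (tp _)   (cp _ _) = no λ ()
  role≟ (bt _)   (tp _)   = no λ ()
  role≟ (bt _)   (cp _ _) = no λ ()
  role≟ (cp _ _) (tp _)   = no λ ()
  role≟ (cp _ _) (bt _)   = no λ ()

  vertex≟ : DecidableEquality (Graph.Vertex K)
  vertex≟ x y = map′ role-injective (cong role) (role≟ (role x) (role y))

  open FirstBag K vertex≟ (proj₁ decomposition) (proj₂ decomposition)

  topᵛ : Top → Graph.Vertex K
  topᵛ t = proj₁ (role-surjective (tp t) tt)

  topᵛ-role : ∀ t → role (topᵛ t) ≡ tp t
  topᵛ-role t = proj₂ (role-surjective (tp t) tt)

  botᵛ : ∀ b → b Subset.∉ S → Graph.Vertex K
  botᵛ b b∉S = proj₁ (role-surjective (bt b) b∉S)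

  botᵛ-role : ∀ b b∉S → role (botᵛ b b∉S) ≡ bt b
  botᵛ-role b b∉S = proj₂ (role-surjective (bt b) b∉S)

  topᵛ-injective : ∀ {t u} → topᵛ t ≡ topᵛ u → t ≡ u
  topᵛ-injective {t} {u} e with trans (sym (topᵛ-role t)) (trans (cong role e) (topᵛ-role u))
  ... | refl = refl

  botᵛ-injective : ∀ {b c} b∉S c∉S → botᵛ b b∉S ≡ botᵛ c c∉S → b ≡ c
  botᵛ-injective {b} {c} p q e with trans (sym (botᵛ-role b p)) (trans (cong role e) (botᵛ-role c q))
  ... | refl = refl

  botᵛ-irrelevant : ∀ {b} p q → botᵛ b p ≡ botᵛ b q
  botᵛ-irrelevant {b} p q = role-injective (trans (botᵛ-role b p) (sym (botᵛ-role b q)))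

  edgeᵛ : ∀ {b t} (b∉S : b Subset.∉ S) → Edge t b → topᵛ t ~ botᵛ b b∉S
  edgeᵛ {b} {t} b∉S e = Equivalence.from (role-adjacent _ _)
    (subst₂ (RoleAdj (proj₁ I) S) (sym (topᵛ-role t)) (sym (botᵛ-role b b∉S)) e)

  -- Exploding a vertex preserves the degrees of its neighbours.
  nbr : ∀ {b t} → Edge t b → ∃[ x ] (topᵛ t ~ x × (role x ≡ bt b ⊎ role x ≡ cp b t))
  nbr {b} {t} e with b ∈? S
  ... | no b∉S  = botᵛ b b∉S , edgeᵛ b∉S e , inj₁ (botᵛ-role b b∉S)
  ... | yes b∈S with role-surjective (cp b t) (b∈S , e)
  ...   | x , r = x , Equivalence.from (role-adjacent _ _)
    (subst₂ (RoleAdj (proj₁ I) S) (sym (topᵛ-role t)) (sym r) refl) , inj₂ r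

  spine-top : ∀ {t} → Core t → Spine (topᵛ t)
  spine-top (b , b′ , b<b′ , e , e′) with nbr e | nbr e′
  ... | x , a , r | y , a′ , r′ = x , y , a , a′ , λ { refl → differ r r′ }
    where
    differ : ∀ {r t} → r ≡ bt b ⊎ r ≡ cp b t → r ≡ bt b′ ⊎ r ≡ cp b′ t → ⊥
    differ (inj₁ refl) (inj₁ refl) = <-irrefl refl b<b′
    differ (inj₂ refl) (inj₂ refl) = <-irrefl refl b<b′

  spine-bot : ∀ {b t t′} (b∉S : b Subset.∉ S) → t ≢ t′ → Edge t b → Edge t′ b → Spine (botᵛ b b∉S)
  spine-bot b∉S t≢t′ e e′ =
    _ , _ , ~-sym (edgeᵛ b∉S e) , ~-sym (edgeᵛ b∉S e′) , t≢t′ ∘ topᵛ-injective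

  -- The order of first bags may traverse a path of the target either way; with the direction as an
  -- argument, one proof covers both readings.
  data Direction : Set where
    up down : Direction

  _<[_]_ : ℕ → Direction → ℕ → Set
  m <[ up ]   n = m < n
  m <[ down ] n = n < m

  compare : ∀ {m n} → m ≢ n → ∃[ d ] m <[ d ] n
  compare {m} {n} m≢n with <-cmp m n
  ... | tri< lt _ _ = up , lt
  ... | tri≈ _ eq _ = contradiction eq m≢n
  ... | tri> _ _ gt = down , gt

  directed-unique : ∀ d {u v v′} → Spine v → Spine v′ → u ~ v → u ~ v′ →
                    key u <[ d ] key v → key u <[ d ] key v′ → v ≡ v′
  directed-unique up   sv sv′ = higher-unique sv sv′
  directed-unique down _  _   = lower-unique

  side-unique : ∀ d {b t t′} (b∉S : b Subset.∉ S) → CoreNbr b t → CoreNbr b t′ →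
                key (botᵛ b b∉S) <[ d ] key (topᵛ t) → key (botᵛ b b∉S) <[ d ] key (topᵛ t′) → t ≡ t′
  side-unique d b∉S (e , c) (e′ , c′) p q = topᵛ-injective
    (directed-unique d (spine-top c) (spine-top c′) (~-sym (edgeᵛ b∉S e)) (~-sym (edgeᵛ b∉S e′)) p q)

  side : ∀ {b t t′} (b∉S : b Subset.∉ S) → t ≢ t′ → CoreNbr b t → Edge t′ b →
         ∃[ d ] key (botᵛ b b∉S) <[ d ] key (topᵛ t)
  side b∉S t≢t′ (e , c) e′ = compare (separates (spine-bot b∉S t≢t′ e e′) (spine-top c) (~-sym (edgeᵛ b∉S e)))

  -- An unexploded `b` has at most one core neighbour that opens later and one that opens earlier,
  -- so three do not fit.
  heavy⇒exploded : ∀ {b} → Heavy b → b Subset.∈ S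
  heavy⇒exploded {b} (t , u , v , t<u , u<v , p , q , r) with b ∈? S
  ... | yes b∈S = b∈S
  ... | no b∉S = ⊥-elim (clash (side b∉S t≢u p (proj₁ q)) (side b∉S (t≢u ∘ sym) q (proj₁ p)) (side b∉S (u≢v ∘ sym) r (proj₁ q)))
    where
    t≢u = apart⇒≢ {top} (inj₁ t<u)
    u≢v = apart⇒≢ {top} (inj₁ u<v)
    t≢v = apart⇒≢ {top} (inj₁ (<-trans t<u u<v))
    clash : ∃[ d ] key (botᵛ b b∉S) <[ d ] key (topᵛ t) → ∃[ d ] key (botᵛ b b∉S) <[ d ] key (topᵛ u) →
            ∃[ d ] key (botᵛ b b∉S) <[ d ] key (topᵛ v) → ⊥
    clash (up   , x) (up   , y) _          = t≢u (side-unique up b∉S p q x y)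
    clash (down , x) (down , y) _          = t≢u (side-unique down b∉S p q x y)
    clash (up   , x) (down , y) (up   , z) = t≢v (side-unique up b∉S p r x z)
    clash (up   , x) (down , y) (down , z) = u≢v (side-unique down b∉S q r y z)
    clash (down , x) (up   , y) (up   , z) = u≢v (side-unique up b∉S q r y z)
    clash (down , x) (up   , y) (down , z) = t≢v (side-unique down b∉S p r x z)

  -- For the same reason the two core neighbours lie on opposite sides of `b`, which gives the edge
  -- replacing `b` a direction.
  link-between : ∀ {b t t′} (b∉S : b Subset.∉ S) → Link b t t′ →
    ∃[ d ] (key (topᵛ t) <[ d ] key (botᵛ b b∉S) × key (botᵛ b b∉S) <[ d ] key (topᵛ t′))
  link-between {b} {t} {t′} b∉S (_ , apart , p , q) =
    go (side b∉S t≢t′ p (proj₁ q)) (side b∉S (t≢t′ ∘ sym) q (proj₁ p))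
    where
    t≢t′ = apart⇒≢ {top} apart
    go : ∃[ d ] key (botᵛ b b∉S) <[ d ] key (topᵛ t) → ∃[ d ] key (botᵛ b b∉S) <[ d ] key (topᵛ t′) → _
    go (up   , x) (up   , y) = contradiction (side-unique up b∉S p q x y) t≢t′
    go (down , x) (down , y) = contradiction (side-unique down b∉S p q x y) t≢t′
    go (up   , x) (down , y) = down , x , y
    go (down , x) (up   , y) = up , x , y

  toward : ∀ d {x y z} → ∃[ e ] (x <[ e ] y × y <[ e ] z) → x <[ d ] z → x <[ d ] y
  toward up   (up   , p , q) r = p
  toward down (down , p , q) r = p
  toward up   (down , p , q) r = contradiction r (<-asym (<-trans q p))
  toward down (up   , p , q) r = contradiction r (<-asym (<-trans p q))

  through : ∀ d {x y z} → x <[ d ] y → y <[ d ] z → x <[ d ] z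
  through up   p q = <-trans p q
  through down p q = <-trans q p

  link-direction : ∀ d {b t t′} (b∉S : b Subset.∉ S) → Link b t t′ → key (topᵛ t) <[ d ] key (topᵛ t′) →
                   key (topᵛ t) <[ d ] key (botᵛ b b∉S)
  link-direction d b∉S l = toward d (link-between b∉S l)

  link-spine : ∀ {b t t′} (b∉S : b Subset.∉ S) → Link b t t′ → Spine (botᵛ b b∉S)
  link-spine b∉S (_ , apart , (e , _) , (e′ , _)) = spine-bot b∉S (apart⇒≢ {top} apart) e e′

  pendant-spine : ∀ {b t} (b∉S : b Subset.∉ S) → Pendant b t → Spine (botᵛ b b∉S)
  pendant-spine b∉S ((e , _) , _ , u , apart , e′) = spine-bot b∉S (apart⇒≢ {top} apart) e e′

  -- Both lie between `t` and `t′`, hence on the same side of `t`, where there is room for only one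
  -- spine neighbour.
  unexploded-unique : ∀ {b b′ t t′} → b Subset.∉ S → b′ Subset.∉ S → Link b t t′ → Link b′ t t′ → b ≡ b′
  unexploded-unique b∉S b′∉S l@(_ , _ , (e , _) , _) l′@(_ , _ , (e′ , _) , _) =
    let d , x , y = link-between b∉S l in
    botᵛ-injective b∉S b′∉S
      (directed-unique d (link-spine b∉S l) (link-spine b′∉S l′) (edgeᵛ b∉S e) (edgeᵛ b′∉S e′) x
        (link-direction d b′∉S l′ (through d x y)))

  -- A redundant vertex outside `X` would have a prior parallel vertex outside `X`; neither could be
  -- exploded, which `unexploded-unique` excludes.
  forced-in : ∀ {b} → Forced b → In b
  forced-in (inj₁ h) = ∈⇒In I (S⊆X (heavy⇒exploded h))
  forced-in {b} (inj₂ (t , t′ , l , b′ , prior , l′)) = decidable-stable (in? b) λ b∉X →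
    <-irrefl (cong rank (unexploded-unique (b∉X ∘ prior-in prior ∘ ∈⇒In I ∘ S⊆X) (b∉X ∘ ∈⇒In I ∘ S⊆X) l′ l))
             (prior-rank prior)

  -- A link edge stays as long as one vertex behind it is unexploded, redundant or not; a triangle
  -- always loses the edge of `bot₀` and `bot₁`. Nonadjacent pairs are filtered out by `deletion?`.
  Deleted : Labelled I → Labelled I → Set
  Deleted (top  , t) (top  , t′) = ¬ (∃[ b ] (Link b t t′ × b Subset.∉ S))
  Deleted (top  , t) (bot₀ , b)  = b Subset.∈ S
  Deleted (bot₀ , b) (top  , t)  = b Subset.∈ S
  Deleted (bot₀ , _) (bot₁ , _)  = ⊤
  Deleted (bot₁ , _) (bot₀ , _)  = ⊤
  Deleted _          _           = ⊥

  open-link? : ∀ t t′ → Dec (∃[ b ] (Link b t t′ × b Subset.∉ S))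
  open-link? t t′ = any? (λ b → link? b t t′ ×-dec ¬? (b ∈? S))

  deleted? : ∀ u v → Dec (Deleted u v)
  deleted? (top  , t) (top  , t′) = ¬? (open-link? t t′)
  deleted? (top  , t) (bot₀ , b)  = b ∈? S
  deleted? (bot₀ , b) (top  , t)  = b ∈? S
  deleted? (bot₀ , _) (bot₁ , _)  = yes tt
  deleted? (bot₁ , _) (bot₀ , _)  = yes tt
  deleted? (top  , _) (bot₁ , _)  = no λ ()
  deleted? (top  , _) (bot₂ , _)  = no λ ()
  deleted? (bot₀ , _) (bot₀ , _)  = no λ ()
  deleted? (bot₀ , _) (bot₂ , _)  = no λ ()
  deleted? (bot₁ , _) (top  , _)  = no λ ()
  deleted? (bot₁ , _) (bot₁ , _)  = no λ ()
  deleted? (bot₁ , _) (bot₂ , _)  = no λ ()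
  deleted? (bot₂ , _) _           = no λ ()

  Deleted-sym : ∀ u v → Deleted u v → Deleted v u
  Deleted-sym (top  , t) (top  , t′) d (b , l , b∉S) = d (b , Link-sym l , b∉S)
  Deleted-sym (top  , t) (bot₀ , b)  d = d
  Deleted-sym (bot₀ , b) (top  , t)  d = d
  Deleted-sym (bot₀ , _) (bot₁ , _)  d = tt
  Deleted-sym (bot₁ , _) (bot₀ , _)  d = tt

  deletion? : ∀ i j → Dec (Adj (V i) (V j) × Deleted (V i) (V j))
  deletion? i j = map′ (matrix-sound adjᶠ i j) (matrix-complete adjᶠ i j) (T? _) ×-dec deleted? (V i) (V j)

  deletions : EdgeSet target
  deletions = record
    { mem     = λ i j → ⌊ deletion? i j ⌋
    ; mem-sym = λ i j p → let a , d = toWitness p in fromWitness (Adj-sym (V i) (V j) a , Deleted-sym (V i) (V j) d)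
    ; mem-adj = λ i j p → matrix-complete adjᶠ i j (proj₁ (toWitness p))
    }

  deleted-allowed : ∀ u v → Adj u v → Deleted u v → Allowed u v
  deleted-allowed (top  , t) (top  , t′) a d (b , l , b∉X) = d (b , l , b∉X ∘ ∈⇒In I ∘ S⊆X)
  deleted-allowed (top  , t) (bot₀ , b)  a d = tt , ∈⇒In I (S⊆X d)
  deleted-allowed (bot₀ , b) (top  , t)  a d = ∈⇒In I (S⊆X d) , tt
  deleted-allowed (bot₀ , _) (bot₁ , _)  (_ , f , f′) d = forced-in f , forced-in f′
  deleted-allowed (bot₁ , _) (bot₀ , _)  (_ , f , f′) d = forced-in f , forced-in f′

  deletions⊆deletable : deletions ⊆ᴱ deletable
  deletions⊆deletable i j p = let a , d = toWitness p in
    matrix-complete deletableᶠ i j (a , deleted-allowed (V i) (V j) a d)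

  data Kept : Labelled I → Labelled I → Set where
    link   : ∀ {b t t′} → b Subset.∉ S → Link b t t′ → Kept (top , t) (top , t′)
    top-0  : ∀ {b t} → b Subset.∉ S → Pendant b t → Kept (top , t) (bot₀ , b)
    0-top  : ∀ {b t} → b Subset.∉ S → Pendant b t → Kept (bot₀ , b) (top , t)
    0-2    : ∀ {b} → Forced b → Kept (bot₀ , b) (bot₂ , b)
    2-0    : ∀ {b} → Forced b → Kept (bot₂ , b) (bot₀ , b)
    1-2    : ∀ {b} → Forced b → Kept (bot₁ , b) (bot₂ , b)
    2-1    : ∀ {b} → Forced b → Kept (bot₂ , b) (bot₁ , b)

  kept : ∀ u v → Adj u v → ¬ Deleted u v → Kept u v
  kept (top  , t) (top  , t′) a d = let b , l , b∉S = decidable-stable (open-link? t t′) d in link b∉S l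
  kept (top  , t) (bot₀ , b)  a d = top-0 d a
  kept (bot₀ , b) (top  , t)  a d = 0-top d a
  kept (bot₀ , b) (bot₁ , b′) a d = contradiction tt d
  kept (bot₁ , b) (bot₀ , b′) a d = contradiction tt d
  kept (bot₀ , b) (bot₂ , b′) (s , f , _) d = subst (λ c → Kept (bot₀ , b) (bot₂ , c)) (same⇒≡ {bottom} s) (0-2 f)
  kept (bot₂ , b) (bot₀ , b′) (s , f , _) d = subst (λ c → Kept (bot₂ , b) (bot₀ , c)) (same⇒≡ {bottom} s) (2-0 f)
  kept (bot₁ , b) (bot₂ , b′) (s , f , _) d = subst (λ c → Kept (bot₁ , b) (bot₂ , c)) (same⇒≡ {bottom} s) (1-2 f)
  kept (bot₂ , b) (bot₁ , b′) (s , f , _) d = subst (λ c → Kept (bot₂ , b) (bot₁ , c)) (same⇒≡ {bottom} s) (2-1 f)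

  -- A forced vertex starts its triangle at 0. For an exploded vertex that is not forced the value
  -- is arbitrary, as no edge is kept at its `bot₀`. The decisions are arguments so that proofs can
  -- split on them.
  key₀-by : ∀ b → Dec (Forced b) → Dec (b Subset.∈ S) → ℕ
  key₀-by b (no _) (no b∉S) = key (botᵛ b b∉S)
  key₀-by b _      _        = 0

  key₀ : Bottom → ℕ
  key₀ b = key₀-by b (forced? b) (b ∈? S)

  key₀-forced : ∀ {b} → Forced b → key₀ b ≡ 0
  key₀-forced {b} f = go (forced? b) (b ∈? S)
    where
    go : ∀ d e → key₀-by b d e ≡ 0
    go (yes _) _ = refl
    go (no ¬f) _ = contradiction f ¬f

  key₀-pendant : ∀ {b t} (b∉S : b Subset.∉ S) → Pendant b t → key₀ b ≡ key (botᵛ b b∉S)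
  key₀-pendant {b} b∉S p = go (forced? b) (b ∈? S)
    where
    go : ∀ d e → key₀-by b d e ≡ key (botᵛ b b∉S)
    go (yes f) _         = contradiction f (pendant-not-forced p)
    go (no _)  (yes b∈S) = contradiction b∈S b∉S
    go (no _)  (no q)    = cong key (botᵛ-irrelevant q b∉S)

  keyᴴ : Labelled I → ℕ
  keyᴴ (top  , t) = key (topᵛ t)
  keyᴴ (bot₀ , b) = key₀ b
  -- What remains of a triangle is the path `bot₀`, `bot₂`, `bot₁`, with keys 0, 1, 2.
  keyᴴ (bot₁ , b) = 2
  keyᴴ (bot₂ , b) = 1

  kept-separates : ∀ {u v} → Kept u v → keyᴴ u ≢ keyᴴ v
  kept-separates (link b∉S l) e = let d , x , y = link-between b∉S l in irreflexive d (through d x y) e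
    where
    irreflexive : ∀ d {m n} → m <[ d ] n → m ≢ n
    irreflexive up   = <⇒≢
    irreflexive down = >⇒≢
  kept-separates (top-0 b∉S p@((ed , c) , _)) e =
    separates (spine-top c) (pendant-spine b∉S p) (edgeᵛ b∉S ed) (trans e (key₀-pendant b∉S p))
  kept-separates (0-top b∉S p@((ed , c) , _)) e =
    separates (spine-top c) (pendant-spine b∉S p) (edgeᵛ b∉S ed) (trans (sym e) (key₀-pendant b∉S p))
  kept-separates (0-2 f) e = contradiction (trans (sym (key₀-forced f)) e) λ ()
  kept-separates (2-0 f) e = contradiction (trans e (key₀-forced f)) λ ()

  -- In one direction from `t` there is only one spine neighbour, so `b` and `c` would coincide, but
  -- no vertex is both linked and pendant.
  link-vs-pendant : ∀ d {b c t t′} (b∉S : b Subset.∉ S) (c∉S : c Subset.∉ S) → Link b t t′ → Pendant c t →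
                    key (topᵛ t) <[ d ] key (topᵛ t′) → key (topᵛ t) <[ d ] key₀ c → ¬ Link b t t′
  link-vs-pendant d {t = t} b∉S c∉S l@(_ , _ , (e , _) , _) r@((e′ , _) , _) p q =
    pendant-not-link (subst (λ b → Pendant b t) (sym (botᵛ-injective b∉S c∉S
      (directed-unique d (link-spine b∉S l) (pendant-spine c∉S r) (edgeᵛ b∉S e) (edgeᵛ c∉S e′)
        (link-direction d b∉S l p) (subst (key (topᵛ t) <[ d ]_) (key₀-pendant c∉S r) q)))) r)

  -- A kept edge at a core vertex t leads through an unexploded neighbour of t.
  kept-unique : ∀ d {u v w} → Kept u v → Kept u w → keyᴴ u <[ d ] keyᴴ v → keyᴴ u <[ d ] keyᴴ w → v ≡ w
  kept-unique d (link b∉S l@(_ , _ , (e , _) , _)) (link c∉S l′@(_ , _ , (e′ , _) , _)) p q =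
    cong (top ,_) (link-other l (subst (λ b → Link b _ _) (sym (botᵛ-injective b∉S c∉S
      (directed-unique d (link-spine b∉S l) (link-spine c∉S l′) (edgeᵛ b∉S e) (edgeᵛ c∉S e′)
        (link-direction d b∉S l p) (link-direction d c∉S l′ q)))) l′))
  kept-unique d (link b∉S l) (top-0 c∉S r) p q = contradiction l (link-vs-pendant d b∉S c∉S l r p q)
  kept-unique d (top-0 c∉S r) (link b∉S l) q p = contradiction l (link-vs-pendant d b∉S c∉S l r p q)
  kept-unique d {top , t} (top-0 b∉S r@((e , _) , _)) (top-0 c∉S r′@((e′ , _) , _)) p q =
    cong (bot₀ ,_) (botᵛ-injective b∉S c∉S
      (directed-unique d (pendant-spine b∉S r) (pendant-spine c∉S r′) (edgeᵛ b∉S e) (edgeᵛ c∉S e′)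
        (subst (key (topᵛ t) <[ d ]_) (key₀-pendant b∉S r) p) (subst (key (topᵛ t) <[ d ]_) (key₀-pendant c∉S r′) q)))
  kept-unique d (0-top _ r) (0-top _ (n , _)) p q = cong (top ,_) (pendant-nbr r n)
  kept-unique d (0-top _ r) (0-2 f)     p q = contradiction f (pendant-not-forced r)
  kept-unique d (0-2 f)     (0-top _ r) p q = contradiction f (pendant-not-forced r)
  kept-unique d (0-2 _)     (0-2 _)     p q = refl
  kept-unique d (1-2 _)     (1-2 _)     p q = refl
  kept-unique d (2-0 _)     (2-0 _)     p q = refl
  kept-unique d (2-1 _)     (2-1 _)     p q = refl
  kept-unique up   (2-0 f) (2-1 _) p q = contradiction (subst (1 <_) (key₀-forced f) p) λ ()
  kept-unique up   (2-1 f) (2-0 _) p q = contradiction (subst (1 <_) (key₀-forced f) q) λ ()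
  kept-unique down (2-0 f) (2-1 _) p q = contradiction q (<-asym ≤-refl)
  kept-unique down (2-1 f) (2-0 _) p q = contradiction p (<-asym ≤-refl)

  H′ : Graph
  H′ = deleteEdges target deletions

  keptᵛ : ∀ {i j} → H′ ∋ i ~ j → Kept (V i) (V j)
  keptᵛ {i} {j} (a , ¬d) = let p = matrix-sound adjᶠ i j a in
    kept (V i) (V j) p (λ d → ¬d (fromWitness (p , d)))

  linear : LinearForest H′
  linear = KeyedGraph.keyed⇒linear-forest H′ Fin._≟_ (keyᴴ ∘ V) (suc (proj₁ highest)) (λ i → s≤s (proj₂ highest i))
    (λ i → any? (λ j → adjacent? i j ×-dec (keyᴴ (V i) <? keyᴴ (V j))))
    (λ i → any? (λ j → adjacent? i j ×-dec (keyᴴ (V j) <? keyᴴ (V i))))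
    (λ a → kept-separates (keptᵛ a))
    (λ a a′ p q → V-injective (kept-unique up (keptᵛ a) (keptᵛ a′) p q))
    (λ a a′ p q → V-injective (kept-unique down (keptᵛ a) (keptᵛ a′) p q))
    where
    highest = maximum (keyᴴ ∘ V)
    adjacent? : ∀ i j → Dec (H′ ∋ i ~ j)
    adjacent? i j = T? _ ×-dec ¬? (T? _)

  -- Every deleted edge is charged to an exploded vertex.  The triangle of an
  -- unexploded redundant vertex is charged to the nonredundant vertex parallel
  -- to it: that one is exploded, but its link is not deleted.
  data Target : Set where
    linkᵉ     : Top → Top → Target
    pendantᵉ  : Bottom → Top → Target
    triangleᵉ : Bottom → Target

  ends : Target → Labelled I × Labelled I
  ends (linkᵉ t t′)   = (top , t) , (top , t′)
  ends (pendantᵉ b t) = (top , t) , (bot₀ , b)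
  ends (triangleᵉ b)  = (bot₀ , b) , (bot₁ , b)

  Owner : Target → Bottom → Set
  Owner (linkᵉ t t′) b   = toℕ t < toℕ t′ × Link b t t′ × ¬ Redundant b × (∀ c → Link c t t′ → c Subset.∈ S)
  Owner (pendantᵉ c t) b = b ≡ c × Pendant c t
  Owner (triangleᵉ c) b  = Forced c × (b ≡ c ⊎
    (c Subset.∉ S × ∃[ t ] ∃[ t′ ] (Link c t t′ × Link b t t′ × ¬ Redundant b)))

  same-pair : ∀ {b c t t′ u u′} → Link b t t′ → Link b u u′ → Link c t t′ → Link c u u′
  same-pair l l′ m = go (link-pair l l′) m
    where
    go : ∀ {c t t′ u u′} → (u ≡ t × u′ ≡ t′) ⊎ (u ≡ t′ × u′ ≡ t) → Link c t t′ → Link c u u′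
    go (inj₁ (refl , refl)) m = m
    go (inj₂ (refl , refl)) m = Link-sym m

  ordered-pair : ∀ {t t′ u u′} → toℕ t < toℕ t′ → toℕ u < toℕ u′ → (u ≡ t × u′ ≡ t′) ⊎ (u ≡ t′ × u′ ≡ t) →
                 linkᵉ t t′ ≡ linkᵉ u u′
  ordered-pair p q (inj₁ (refl , refl)) = refl
  ordered-pair p q (inj₂ (refl , refl)) = contradiction p (<-asym q)

  -- The delicate owner is the nonredundant vertex of a class: it may own the link edge or the
  -- triangle of a spared member. The former requires that no member is spared, and by
  -- `unexploded-unique` at most one is.
  owner-unique : ∀ e e′ {b} → Owner e b → Owner e′ b → e ≡ e′
  owner-unique (linkᵉ t t′) (linkᵉ u u′) (t<t′ , l , _) (u<u′ , l′ , _) = ordered-pair t<t′ u<u′ (link-pair l l′)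
  owner-unique (linkᵉ t t′) (pendantᵉ c u) (_ , l , _) (refl , p) = contradiction l (pendant-not-link p)
  owner-unique (pendantᵉ c u) (linkᵉ t t′) (refl , p) (_ , l , _) = contradiction l (pendant-not-link p)
  owner-unique (linkᵉ t t′) (triangleᵉ c) (_ , l , _ , all) (_ , inj₂ (c∉S , _ , _ , m , l′ , _)) =
    contradiction (all c (same-pair l′ l m)) c∉S
  owner-unique (linkᵉ t t′) (triangleᵉ c) (_ , (light , _) , nr , _) (inj₁ h , inj₁ refl) = contradiction h light
  owner-unique (linkᵉ t t′) (triangleᵉ c) (_ , _ , nr , _) (inj₂ r , inj₁ refl) = contradiction r nr
  owner-unique (triangleᵉ c) (linkᵉ t t′) (_ , inj₂ (c∉S , _ , _ , m , l′ , _)) (_ , l , _ , all) =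
    contradiction (all c (same-pair l′ l m)) c∉S
  owner-unique (triangleᵉ c) (linkᵉ t t′) (inj₁ h , inj₁ refl) (_ , (light , _) , nr , _) = contradiction h light
  owner-unique (triangleᵉ c) (linkᵉ t t′) (inj₂ r , inj₁ refl) (_ , _ , nr , _) = contradiction r nr
  owner-unique (pendantᵉ c t) (pendantᵉ d u) (refl , p) (refl , n , _) = cong (pendantᵉ c) (pendant-nbr p n)
  owner-unique (pendantᵉ c t) (triangleᵉ d) (refl , p) (f , inj₁ refl) = contradiction f (pendant-not-forced p)
  owner-unique (pendantᵉ c t) (triangleᵉ d) (refl , p) (_ , inj₂ (_ , _ , _ , _ , l , _)) = contradiction l (pendant-not-link p)
  owner-unique (triangleᵉ d) (pendantᵉ c t) (f , inj₁ refl) (refl , p) = contradiction f (pendant-not-forced p)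
  owner-unique (triangleᵉ d) (pendantᵉ c t) (_ , inj₂ (_ , _ , _ , _ , l , _)) (refl , p) = contradiction l (pendant-not-link p)
  owner-unique (triangleᵉ c) (triangleᵉ d) (_ , inj₁ refl) (_ , inj₁ refl) = refl
  owner-unique (triangleᵉ c) (triangleᵉ d) (inj₁ h , inj₁ refl) (_ , inj₂ (_ , _ , _ , _ , (light , _) , _)) = contradiction h light
  owner-unique (triangleᵉ c) (triangleᵉ d) (inj₂ r , inj₁ refl) (_ , inj₂ (_ , _ , _ , _ , _ , nr)) = contradiction r nr
  owner-unique (triangleᵉ c) (triangleᵉ d) (_ , inj₂ (_ , _ , _ , _ , (light , _) , _)) (inj₁ h , inj₁ refl) = contradiction h light
  owner-unique (triangleᵉ c) (triangleᵉ d) (_ , inj₂ (_ , _ , _ , _ , _ , nr)) (inj₂ r , inj₁ refl) = contradiction r nr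
  owner-unique (triangleᵉ c) (triangleᵉ d) (_ , inj₂ (c∉S , _ , _ , m , l , _)) (_ , inj₂ (d∉S , _ , _ , m′ , l′ , _)) =
    cong triangleᵉ (unexploded-unique c∉S d∉S (same-pair l l′ m) m′)

  Ends : Target → Labelled I → Labelled I → Set
  Ends e u v = ends e ≡ (u , v) ⊎ ends e ≡ (v , u)

  Charged : Labelled I → Labelled I → Bottom → Set
  Charged u v b = ∃[ e ] (Ends e u v × Owner e b)

  link-owner : ∀ {b t t′} → toℕ t < toℕ t′ → Link b t t′ → ¬ (∃[ b ] (Link b t t′ × b Subset.∉ S)) →
               ∃[ c ] (c Subset.∈ S × Owner (linkᵉ t t′) c)
  link-owner t<t′ l d = let c , l′ , nr = representative l in c , all c l′ , t<t′ , l′ , nr , all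
    where
    all : ∀ c → Link c _ _ → c Subset.∈ S
    all c m = decidable-stable (c ∈? S) (λ c∉S → d (c , m , c∉S))

  -- If a redundant `b` is spared, the representative of its class must be exploded: otherwise the
  -- two would coincide by `unexploded-unique`, yet only `b` is redundant.
  triangle-owner : ∀ {b} → Forced b → ∃[ c ] (c Subset.∈ S × Owner (triangleᵉ b) c)
  triangle-owner {b} f = go (b ∈? S) f
    where
    go : Dec (b Subset.∈ S) → Forced b → ∃[ c ] (c Subset.∈ S × Owner (triangleᵉ b) c)
    go (yes b∈S) f        = b , b∈S , f , inj₁ refl
    go (no b∉S)  (inj₁ h) = contradiction (heavy⇒exploded h) b∉S
    go (no b∉S)  (inj₂ r@(t , t′ , l , _)) =
      let c , l′ , nr = representative l in
      c , decidable-stable (c ∈? S) (λ c∉S → nr (subst Redundant (unexploded-unique b∉S c∉S l l′) r)) ,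
      inj₂ r , inj₂ (b∉S , t , t′ , l , l′ , nr)

  charge : ∀ u v → Adj u v → Deleted u v → ∃[ b ] (b Subset.∈ S × Charged u v b)
  charge (top  , t) (top  , t′) (b , l@(_ , inj₁ t<t′ , _)) d =
    let c , c∈S , o = link-owner t<t′ l d in c , c∈S , linkᵉ t t′ , inj₁ refl , o
  charge (top  , t) (top  , t′) (b , l@(_ , inj₂ t′<t , _)) d =
    let c , c∈S , o = link-owner t′<t (Link-sym l) (Deleted-sym (top , t) (top , t′) d) in c , c∈S , linkᵉ t′ t , inj₂ refl , o
  charge (top  , t) (bot₀ , b)  p d = b , d , pendantᵉ b t , inj₁ refl , refl , p
  charge (bot₀ , b) (top  , t)  p d = b , d , pendantᵉ b t , inj₂ refl , refl , p
  charge (bot₀ , b) (bot₁ , b′) (s , f , _) d = let c , c∈S , o = triangle-owner f in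
    c , c∈S , triangleᵉ b , inj₁ (cong (λ b′ → (bot₀ , b) , (bot₁ , b′)) (same⇒≡ {bottom} s)) , o
  charge (bot₁ , b) (bot₀ , b′) (s , f , _) d = let c , c∈S , o = triangle-owner f in
    c , c∈S , triangleᵉ b , inj₂ (cong (λ b′ → (bot₀ , b′) , (bot₁ , b)) (same⇒≡ {bottom} s)) , o

  Pair : Set
  Pair = Fin (order I kinds) × Fin (order I kinds)

  charged-unique : ∀ {i j i′ j′ b} → i Fin.< j → i′ Fin.< j′ →
                   Charged (V i) (V j) b → Charged (V i′) (V j′) b → (i , j) ≡ (i′ , j′)
  charged-unique {i} {j} {i′} {j′} i<j i′<j′ (e , s , o) (e′ , s′ , o′) =
    go s (subst (λ e → Ends e (V i′) (V j′)) (sym (owner-unique e e′ o o′)) s′)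
    where
    same-ends : ∀ {k l m n} → ends e ≡ (V k , V l) → ends e ≡ (V m , V n) → k ≡ m × l ≡ n
    same-ends p q = let r = trans (sym p) q in V-injective (cong proj₁ r) , V-injective (cong proj₂ r)
    flipped : (i , j) ≡ (j′ , i′) → (i , j) ≡ (i′ , j′)
    flipped refl = contradiction i<j (<-asym i′<j′)
    go : Ends e (V i) (V j) → Ends e (V i′) (V j′) → (i , j) ≡ (i′ , j′)
    go (inj₁ p) (inj₁ q) = let x , y = same-ends p q in cong₂ _,_ x y
    go (inj₂ p) (inj₂ q) = let x , y = same-ends p q in cong₂ _,_ y x
    go (inj₁ p) (inj₂ q) = let x , y = same-ends p q in flipped (cong₂ _,_ x y)
    go (inj₂ p) (inj₁ q) = let x , y = same-ends p q in flipped (cong₂ _,_ y x)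

  cost : ∣ deletions ∣ᴱ ≤ ∣ S ∣
  cost = subst (∣ deletions ∣ᴱ ≤_) (length-elements S)
    (pigeonhole (λ (i , j) b → Charged (V i) (V j) b) (elements S)
      (Unique.filter⁺ selected? (Unique.cartesianProduct⁺ (Unique.allFin⁺ _) (Unique.allFin⁺ _)))
      (λ {(i , j)} p → let _ , m = selected p ; a , d = toWitness m ; b , b∈S , c = charge (V i) (V j) a d in
        b , List.∈-filter⁺ (_∈? S) (List.∈-allFin b) b∈S , c)
      (λ p q → charged-unique (proj₁ (selected p)) (proj₁ (selected q))))
    where
    selected? : (p : Pair) → Dec (proj₁ p Fin.< proj₂ p × T (EdgeSet.mem deletions (proj₁ p) (proj₂ p)))
    selected? (i , j) = (i Fin.<? j) ×-dec T? (EdgeSet.mem deletions i j)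
    selected : ∀ {p} → p ∈ filter selected? (cartesianProduct (allFin _) (allFin _)) → _
    selected p = proj₂ (List.∈-filter⁻ selected? {xs = cartesianProduct (allFin _) (allFin _)} p)

-- From deletions to explosions

4*-≤ : ∀ {a b r s} → a * 4 + r ≤ b * 4 + s → s < 4 + r → a ≤ b
4*-≤ {a} {b} {r} {s} le s< = ≮⇒≥ λ b<a → <⇒≱ s< (+-cancelˡ-≤ (b * 4) (4 + r) s (begin
  b * 4 + (4 + r) ≡⟨ +-assoc (b * 4) 4 r ⟨
  b * 4 + 4 + r   ≡⟨ cong (_+ r) (+-comm (b * 4) 4) ⟩
  suc b * 4 + r   ≤⟨ +-monoˡ-≤ r (*-monoˡ-≤ 4 b<a) ⟩
  a * 4 + r       ≤⟨ le ⟩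
  b * 4 + s       ∎))
  where open ≤-Reasoning

4*-< : ∀ {a b r s} → a * 4 + r ≤ b * 4 + s → s < r → a < b
4*-< {a} {b} {r} {s} le s<r = ≰⇒> λ b≤a → <⇒≱ s<r (+-cancelˡ-≤ (b * 4) r s
  (≤-trans (+-monoˡ-≤ r (*-monoˡ-≤ 4 b≤a)) le))

-- Bags are indexed by pairs of a zone and an offset, in lexicographic order.
data Span : Set where
  range : ℕ → ℕ → Span
  point : ℕ → ℕ → Span

InSpan : Span → ℕ → ℕ → Set
InSpan (range lo hi) z i = lo ≤ z × z ≤ hi
InSpan (point z₀ i₀) z i = z ≡ z₀ × i ≡ i₀

inSpan? : ∀ s z i → Dec (InSpan s z i)
inSpan? (range lo hi) z i = (lo ≤? z) ×-dec (z ≤? hi)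
inSpan? (point z₀ i₀) z i = (z ℕ.≟ z₀) ×-dec (i ℕ.≟ i₀)

module Backward (I : Instance) (D : EdgeSet (Instances.target I)) (D⊆deletable : D ⊆ᴱ Instances.deletable I)
  (linear : LinearForest (deleteEdges (Instances.target I) D)) where
  open Instances I
  open Facts I

  H′ : Graph
  H′ = deleteEdges target D

  placement : Layout H′
  placement = LinearForestLayout.layout (Graph._~_ H′) (Graph.~-sym H′) (λ {v} → Graph.~-irr H′ {v}) linear

  Mem : Labelled I → Labelled I → Set
  Mem u v = T (EdgeSet.mem D (code u) (code v))

  abstract
    pos : Labelled I → ℕ
    pos u = Layout.position placement (code u)

    pos-injective : ∀ {u v} → pos u ≡ pos v → u ≡ v
    pos-injective {u} {v} e = trans (sym (V∘code u)) (trans (cong V (Layout.injective placement e)) (V∘code v))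

    pos-consecutive : ∀ {u v} → Adj u v → ¬ Mem u v → pos v ≡ suc (pos u) ⊎ pos u ≡ suc (pos v)
    pos-consecutive {u} {v} a ¬m = Layout.consecutive placement
      (matrix-complete adjᶠ (code u) (code v) (subst₂ Adj (sym (V∘code u)) (sym (V∘code v)) a) , ¬m)

    highest : ∃[ m ] ∀ u → pos u ≤ m
    highest = let m , p≤ = maximum (Layout.position placement) in m , p≤ ∘ code

    mem-allowed : ∀ {u v} → Mem u v → Allowed u v
    mem-allowed {u} {v} m = subst₂ Allowed (V∘code u) (V∘code v)
      (proj₂ (matrix-sound deletableᶠ (code u) (code v) (D⊆deletable _ _ m)))

  mem? : ∀ u v → Dec (Mem u v)
  mem? u v = T? _

  -- Three positions cannot be pairwise consecutive.
  triangle-deleted : ∀ {b} → Forced b →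
    Mem (bot₀ , b) (bot₁ , b) ⊎ Mem (bot₀ , b) (bot₂ , b) ⊎ Mem (bot₁ , b) (bot₂ , b)
  triangle-deleted {b} f = decidable-stable
    (mem? (bot₀ , b) (bot₁ , b) ⊎-dec (mem? (bot₀ , b) (bot₂ , b) ⊎-dec mem? (bot₁ , b) (bot₂ , b)))
    λ ¬m → impossible (pos-consecutive {bot₀ , b} {bot₁ , b} triangle (¬m ∘ inj₁))
                      (pos-consecutive {bot₀ , b} {bot₂ , b} triangle (¬m ∘ inj₂ ∘ inj₁))
                      (pos-consecutive {bot₁ , b} {bot₂ , b} triangle (¬m ∘ inj₂ ∘ inj₂))
    where
    triangle : ¬ Apart {bottom} b b × Forced b × Forced b
    triangle = Apart-irrefl {bottom} {b} , f , f
    impossible : ∀ {x y z} → y ≡ suc x ⊎ x ≡ suc y → z ≡ suc x ⊎ x ≡ suc z → z ≡ suc y ⊎ y ≡ suc z → ⊥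
    impossible (inj₁ refl) (inj₁ refl) (inj₁ ())
    impossible (inj₁ refl) (inj₁ refl) (inj₂ ())
    impossible (inj₁ refl) (inj₂ refl) (inj₁ ())
    impossible (inj₁ refl) (inj₂ refl) (inj₂ ())
    impossible (inj₂ refl) (inj₁ refl) (inj₁ ())
    impossible (inj₂ refl) (inj₁ refl) (inj₂ ())
    impossible (inj₂ refl) (inj₂ refl) (inj₁ ())
    impossible (inj₂ refl) (inj₂ refl) (inj₂ ())

  Exploded : Bottom → Set
  Exploded b = Forced b ⊎ (∃[ t ] (Pendant b t × Mem (top , t) (bot₀ , b))) ⊎
               (∃[ t ] ∃[ t′ ] (Link b t t′ × Mem (top , t) (top , t′)))

  abstract
    exploded? : ∀ b → Dec (Exploded b)
    exploded? b = forced? b ⊎-dec (any? (λ t → pendant? b t ×-dec mem? (top , t) (bot₀ , b)) ⊎-dec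
      any? (λ t → any? (λ t′ → link? b t t′ ×-dec mem? (top , t) (top , t′))))

    S : Subset (card I bottom)
    S = Vec.tabulate (λ b → ⌊ exploded? b ⌋)

    ∈S⇒exploded : ∀ {b} → b Subset.∈ S → Exploded b
    ∈S⇒exploded {b} b∈S = toWitness (Equivalence.from T-≡
      (trans (sym (lookup∘tabulate (λ b → ⌊ exploded? b ⌋) b)) ([]=⇒lookup b∈S)))

    exploded⇒∈S : ∀ {b} → Exploded b → b Subset.∈ S
    exploded⇒∈S {b} x = lookup⇒[]= b S
      (trans (lookup∘tabulate (λ b → ⌊ exploded? b ⌋) b) (Equivalence.to T-≡ (fromWitness x)))

  -- For a forced vertex this is read off the deleted edge of its triangle; a deletable link edge
  -- has all vertices behind it in `X`.
  exploded-in : ∀ {b} → Exploded b → In b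
  exploded-in {b} (inj₁ f) = go (triangle-deleted f)
    where
    go : Mem (bot₀ , b) (bot₁ , b) ⊎ Mem (bot₀ , b) (bot₂ , b) ⊎ Mem (bot₁ , b) (bot₂ , b) → In b
    go (inj₁ m)        = proj₁ (mem-allowed {bot₀ , b} {bot₁ , b} m)
    go (inj₂ (inj₁ m)) = proj₁ (mem-allowed {bot₀ , b} {bot₂ , b} m)
    go (inj₂ (inj₂ m)) = proj₁ (mem-allowed {bot₁ , b} {bot₂ , b} m)
  exploded-in {b} (inj₂ (inj₁ (t , _ , m)))      = proj₂ (mem-allowed {top , t} {bot₀ , b} m)
  exploded-in {b} (inj₂ (inj₂ (t , t′ , l , m))) = decidable-stable (in? b) λ b∉X →
    mem-allowed {top , t} {top , t′} m (b , l , b∉X)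

  S⊆X : S Subset.⊆ proj₂ I
  S⊆X b∈S = In⇒∈ I (exploded-in (∈S⇒exploded b∈S))

  -- Chooses b u v: the edge u v stands for exploding b.
  data Chooses (b : Bottom) : Labelled I → Labelled I → Set where
    linkᶜ    : ∀ {t t′} → Link b t t′ → ¬ Forced b → Chooses b (top , t) (top , t′)
    pendantᶜ : ∀ {t} → Pendant b t → Chooses b (top , t) (bot₀ , b)
    01ᶜ      : Forced b → Chooses b (bot₀ , b) (bot₁ , b)
    02ᶜ      : Forced b → Chooses b (bot₀ , b) (bot₂ , b)
    12ᶜ      : Forced b → Chooses b (bot₁ , b) (bot₂ , b)

  unforced-parallel : ∀ {b c t t′} → Link b t t′ → ¬ Forced b → Link c t t′ → ¬ Forced c → b ≡ c
  unforced-parallel {b} {c} l ¬f m ¬g = decidable-stable (b Fin.≟ c) λ b≢c →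
    [ ¬f ∘ inj₂ , ¬g ∘ inj₂ ]′ (parallel b≢c l m)

  chooses-unique : ∀ {b c u v} → Chooses b u v → Chooses c u v ⊎ Chooses c v u → b ≡ c
  chooses-unique (linkᶜ l ¬f) (inj₁ (linkᶜ m ¬g)) = unforced-parallel l ¬f m ¬g
  chooses-unique (linkᶜ l ¬f) (inj₂ (linkᶜ m ¬g)) = unforced-parallel l ¬f (Link-sym m) ¬g
  chooses-unique (pendantᶜ _) (inj₁ (pendantᶜ _)) = refl
  chooses-unique (01ᶜ _)      (inj₁ (01ᶜ _))      = refl
  chooses-unique (02ᶜ _)      (inj₁ (02ᶜ _))      = refl
  chooses-unique (12ᶜ _)      (inj₁ (12ᶜ _))      = refl

  -- Forcedness is tested first: a forced vertex pays with its triangle even if its link edge is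
  -- deleted, and leaves that edge to the unforced vertex of its class.
  choice : ∀ {b} → Exploded b → ∃[ u ] ∃[ v ] (Chooses b u v × Mem u v)
  choice {b} x = go (forced? b) x
    where
    go : Dec (Forced b) → Exploded b → ∃[ u ] ∃[ v ] (Chooses b u v × Mem u v)
    go (yes f) _ =
      [ (λ m → _ , _ , 01ᶜ f , m) , [ (λ m → _ , _ , 02ᶜ f , m) , (λ m → _ , _ , 12ᶜ f , m) ]′ ]′ (triangle-deleted f)
    go (no ¬f) (inj₁ f)                         = contradiction f ¬f
    go (no ¬f) (inj₂ (inj₁ (t , p , m)))        = _ , _ , pendantᶜ p , m
    go (no ¬f) (inj₂ (inj₂ (t , t′ , l , m)))   = _ , _ , linkᶜ l ¬f , m

  Represents : Bottom → Fin (order I kinds) × Fin (order I kinds) → Set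
  Represents b (i , j) = ∃[ u ] ∃[ v ] (Chooses b u v × ((i ≡ code u × j ≡ code v) ⊎ (i ≡ code v × j ≡ code u)))

  code-injective : ∀ {u v} → code u ≡ code v → u ≡ v
  code-injective {u} {v} e = trans (sym (V∘code u)) (trans (cong V e) (V∘code v))

  represents-unique : ∀ {b c e} → Represents b e → Represents c e → b ≡ c
  represents-unique {b} {c} (u , v , x , p) (u′ , v′ , y , q) = chooses-unique x (go p q)
    where
    same : ∀ {i w w′} → i ≡ code w → i ≡ code w′ → w′ ≡ w
    same e e′ = code-injective (trans (sym e′) e)
    go : _ → _ → Chooses c u v ⊎ Chooses c v u
    go (inj₁ (p , q)) (inj₁ (p′ , q′)) = inj₁ (subst₂ (Chooses c) (same p p′) (same q q′) y)
    go (inj₁ (p , q)) (inj₂ (p′ , q′)) = inj₂ (subst₂ (Chooses c) (same q q′) (same p p′) y)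
    go (inj₂ (p , q)) (inj₁ (p′ , q′)) = inj₂ (subst₂ (Chooses c) (same p p′) (same q q′) y)
    go (inj₂ (p , q)) (inj₂ (p′ , q′)) = inj₁ (subst₂ (Chooses c) (same q q′) (same p p′) y)

  cost : ∣ S ∣ ≤ ∣ D ∣ᴱ
  cost = subst (_≤ ∣ D ∣ᴱ) (length-elements S)
    (pigeonhole Represents (filter selected? (cartesianProduct (allFin _) (allFin _))) (elements-unique S)
      (λ p → represent (∈S⇒exploded (proj₂ (List.∈-filter⁻ (_∈? S) {xs = allFin _} p))))
      (λ _ _ → represents-unique))
    where
    selected? : (p : Fin (order I kinds) × Fin (order I kinds)) →
                Dec (proj₁ p Fin.< proj₂ p × T (EdgeSet.mem D (proj₁ p) (proj₂ p)))
    selected? (i , j) = (i Fin.<? j) ×-dec T? (EdgeSet.mem D i j)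
    select : ∀ {i j} → i Fin.< j → T (EdgeSet.mem D i j) → (i , j) ∈ filter selected? (cartesianProduct (allFin _) (allFin _))
    select lt m = List.∈-filter⁺ selected? (List.∈-cartesianProduct⁺ (List.∈-allFin _) (List.∈-allFin _)) (lt , m)
    represent : ∀ {b} → Exploded b → ∃[ e ] (e ∈ filter selected? (cartesianProduct (allFin _) (allFin _)) × Represents b e)
    represent x with choice x
    ... | u , v , c , m with Fin.<-cmp (code u) (code v)
    ...   | tri< lt _ _ = _ , select lt m , u , v , c , inj₁ (refl , refl)
    ...   | tri≈ _ eq _ = contradiction (subst (λ i → T (FinGraph.adj target (code u) i)) (sym eq) (EdgeSet.mem-adj D _ _ m))
                            (FinGraph.adj-irr target (code u))
    ...   | tri> _ _ gt = _ , select gt (EdgeSet.mem-sym D _ _ m) , u , v , c , inj₂ (refl , refl)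

  -- An unexploded vertex stands for a kept edge between positions `p` and `suc p`, or is a leaf at
  -- a core vertex, or is the centre of a star, all of whose neighbours are leaves.
  data Shape (b : Bottom) : Set where
    gap  : ∀ {u v} p → Chooses b u v → ¬ Forced b →
           (pos u ≡ p × pos v ≡ suc p) ⊎ (pos u ≡ suc p × pos v ≡ p) → Shape b
    leaf : ∀ t → CoreNbr b t → (∀ u → Edge u b → u ≡ t) → Shape b
    star : (∀ u → ¬ CoreNbr b u) → Shape b

  consecutive⇒gap : ∀ {b u v} → Chooses b u v → ¬ Forced b → pos v ≡ suc (pos u) ⊎ pos u ≡ suc (pos v) → Shape b
  consecutive⇒gap c ¬f (inj₁ e) = gap _ c ¬f (inj₁ (refl , e))
  consecutive⇒gap c ¬f (inj₂ e) = gap _ c ¬f (inj₂ (e , refl))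

  shape : ∀ {b} → ¬ Exploded b → Shape b
  shape {b} ¬x = go₁ (any? (coreNbr? b))
    where
    go₃ : ∀ t → CoreNbr b t → ¬ (∃[ u ] (t ≢ u × CoreNbr b u)) → Dec (∃[ u ] (t ≢ u × Edge u b)) → Shape b
    go₃ t n none (yes (u , t≢u , e)) = consecutive⇒gap (pendantᶜ p) (¬x ∘ inj₁)
      (pos-consecutive {top , t} {bot₀ , b} p (λ m → ¬x (inj₂ (inj₁ (t , p , m)))))
      where
      p : Pendant b t
      p = n , (λ (u , a , m) → none (u , apart⇒≢ {top} a , m)) , u , ≢⇒apart {top} t≢u , e
    go₃ t n none (no only) = leaf t n (λ u e → decidable-stable (u Fin.≟ t) (λ u≢t → only (u , u≢t ∘ sym , e)))
    go₂ : ∀ t → CoreNbr b t → Dec (∃[ u ] (t ≢ u × CoreNbr b u)) → Shape b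
    go₂ t n (yes (u , t≢u , m)) = consecutive⇒gap (linkᶜ l (¬x ∘ inj₁)) (¬x ∘ inj₁)
      (pos-consecutive {top , t} {top , u} (b , l) (λ m → ¬x (inj₂ (inj₂ (t , u , l , m)))))
      where
      l : Link b t u
      l = ¬x ∘ inj₁ ∘ inj₁ , ≢⇒apart {top} t≢u , n , m
    go₂ t n (no none) = go₃ t n none (any? (λ u → ¬? (t Fin.≟ u) ×-dec edge? u b))
    go₁ : Dec (∃[ t ] CoreNbr b t) → Shape b
    go₁ (yes (t , n)) = go₂ t n (any? (λ u → ¬? (t Fin.≟ u) ×-dec coreNbr? b u))
    go₁ (no none)     = star (λ u n → none (u , n))

  Fate : Bottom → Set
  Fate b = b Subset.∈ S ⊎ Shape b

  abstract
    fate : ∀ b → Fate b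
    fate b = go (exploded? b)
      where
      go : Dec (Exploded b) → Fate b
      go (yes x) = inj₁ (exploded⇒∈S x)
      go (no ¬x) = inj₂ (shape ¬x)

  -- Modulo 4, bridges meet a block in its zones 0 and 2; zone 1 is left for the leaves of its
  -- owner, and zone 3, which belongs to a bridge alone, for the leaves of the bridging vertex.
  -- Offsets separate leaves in the same zone. `point 0 0` is a default: nothing hangs from an
  -- exploded vertex or from a `leaf`, whose only neighbour is core.
  hang : ∀ {b} → Fate b → Top → Span
  hang     (inj₂ (gap p _ _ _)) t = point (p * 4 + 3) (toℕ t)
  hang {b} (inj₂ (star _))      t = point (pos (bot₀ , b) * 4 + 1) (toℕ t)
  hang     _                    t = point 0 0

  bottom-span : ∀ {b} → Fate b → Span
  bottom-span     (inj₂ (gap p _ _ _)) = range (p * 4 + 2) (suc p * 4 + 0)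
  bottom-span {b} (inj₂ (leaf t _ _))  = point (pos (top , t) * 4 + 1) (toℕ b)
  bottom-span {b} (inj₂ (star _))      = range (pos (bot₀ , b) * 4 + 0) (pos (bot₀ , b) * 4 + 2)
  bottom-span     (inj₁ _)             = range 0 0

  -- A noncore vertex has at most one neighbour. If that one is unexploded, the vertex is placed
  -- within its span; otherwise it gets a block of its own, with its copied neighbour, if any,
  -- inside.
  Attached : Top → Set
  Attached t = ∃[ b ] (b Subset.∉ S × Edge t b × ¬ Core t)

  abstract
    attached? : ∀ t → Dec (Attached t)
    attached? t = any? (λ b → ¬? (b ∈? S) ×-dec (edge? t b ×-dec ¬? (core? t)))

  top-span : ∀ t → Dec (Attached t) → Span
  top-span t (yes (b , _)) = hang (fate b) t
  top-span t (no _)        = range (pos (top , t) * 4 + 0) (pos (top , t) * 4 + 2)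

  -- A vertex of the target at position p owns the zones 4p, 4p + 1 and 4p + 2.
  -- These are given to the top vertices and to the bottom vertices without
  -- core neighbours.  An unexploded b whose edge in the target occupies the
  -- positions p and p + 1 bridges the zones from 4p + 2 to 4p + 4.  All other
  -- vertices of the exploded graph are leaves.
  span : Role (proj₁ I) S → Span
  span (tp t)   = top-span t (attached? t)
  span (bt b)   = bottom-span (fate b)
  span (cp b t) = point (pos (top , t) * 4 + 1) (toℕ b)

  is-top : Role (proj₁ I) S → Bool
  is-top (tp _) = true
  is-top _      = false

  data BottomView : Role (proj₁ I) S → Span → Set where
    copyᵛ  : ∀ {b t} → b Subset.∈ S → BottomView (cp b t) (point (pos (top , t) * 4 + 1) (toℕ b))
    shapeᵛ : ∀ {b} → b Subset.∉ S → (f : Shape b) → BottomView (bt b) (bottom-span (inj₂ f))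

  data TopView : Role (proj₁ I) S → Span → Set where
    freeᵛ : ∀ {t} → TopView (tp t) (range (pos (top , t) * 4 + 0) (pos (top , t) * 4 + 2))
    hangᵛ : ∀ {b t} → Edge t b → ¬ Core t → (f : Shape b) → TopView (tp t) (hang (inj₂ f) t)

  bottom-view : ∀ r → ValidRole (proj₁ I) S r → is-top r ≡ false → BottomView r (span r)
  bottom-view (bt b)   b∉S       _ = go (fate b)
    where
    go : (f : Fate b) → BottomView (bt b) (bottom-span f)
    go (inj₁ b∈S) = contradiction b∈S b∉S
    go (inj₂ f)   = shapeᵛ b∉S f
  bottom-view (cp b t) (b∈S , _) _ = copyᵛ b∈S

  top-view : ∀ r → is-top r ≡ true → TopView r (span r)
  top-view (tp t) _ = go (attached? t)
    where
    go₂ : ∀ {b} → b Subset.∉ S → Edge t b → ¬ Core t → (f : Fate b) → TopView (tp t) (hang f t)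
    go₂ b∉S e ¬c (inj₁ b∈S) = contradiction b∈S b∉S
    go₂ b∉S e ¬c (inj₂ f)   = hangᵛ e ¬c f
    go : (d : Dec (Attached t)) → TopView (tp t) (top-span t d)
    go (yes (b , b∉S , e , ¬c)) = go₂ b∉S e ¬c (fate b)
    go (no _)                   = freeᵛ

  same-point : ∀ p q {z} → z ≡ p * 4 + 1 → z ≡ q * 4 + 1 → p ≡ q
  same-point p q e e′ = *-cancelʳ-≡ p q 4 (+-cancelʳ-≡ 1 (p * 4) (q * 4) (trans (sym e) e′))

  block-unique : ∀ p q {z} → p * 4 + 0 ≤ z → z ≤ p * 4 + 2 → q * 4 + 0 ≤ z → z ≤ q * 4 + 2 → p ≡ q
  block-unique p q a b c d = ≤-antisym (4*-≤ {p} {q} (≤-trans a d) (s≤s (s≤s (s≤s z≤n)))) (4*-≤ {q} {p} (≤-trans c b) (s≤s (s≤s (s≤s z≤n))))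

  inside-block : ∀ p → p * 4 + 0 ≤ p * 4 + 1 × p * 4 + 1 ≤ p * 4 + 2
  inside-block p = +-monoʳ-≤ (p * 4) z≤n , +-monoʳ-≤ (p * 4) (s≤s z≤n)

  -- A bridge touches blocks only in its first and its last zone.
  block≢bridge : ∀ p q {z} → p * 4 + 0 ≤ z → z ≤ p * 4 + 2 → q * 4 + 2 ≤ z → z ≤ suc q * 4 + 0 → p ≡ q ⊎ p ≡ suc q
  block≢bridge p q a b c d =
    go (4*-≤ {p} {suc q} (≤-trans a d) (s≤s z≤n)) (4*-≤ {q} {p} (≤-trans c b) (s≤s (s≤s (s≤s z≤n))))
    where
    go : p ≤ suc q → q ≤ p → p ≡ q ⊎ p ≡ suc q
    go p≤ q≤ with m≤n⇒m<n∨m≡n p≤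
    ... | inj₁ p< = inj₁ (≤-antisym (s≤s⁻¹ p<) q≤)
    ... | inj₂ e  = inj₂ e

  off-bridge : ∀ p q {z} → z ≡ p * 4 + 1 → q * 4 + 2 ≤ z → z ≤ suc q * 4 + 0 → ⊥
  off-bridge p q refl c d = <⇒≱ (4*-< {q} {p} c (s≤s (s≤s z≤n))) (s≤s⁻¹ (4*-< {p} {suc q} d (s≤s z≤n)))

  off-block : ∀ p q {z} → z ≡ p * 4 + 3 → q * 4 + 0 ≤ z → z ≤ q * 4 + 2 → ⊥
  off-block p q refl c d = <⇒≱ (4*-< {p} {q} d (s≤s (s≤s (s≤s z≤n)))) (4*-≤ {q} {p} c (s≤s (s≤s (s≤s (s≤s z≤n)))))

  Places : ℕ → Labelled I → Labelled I → Set
  Places p u v = (pos u ≡ p × pos v ≡ suc p) ⊎ (pos u ≡ suc p × pos v ≡ p)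

  at-end : ∀ {p u v} w → Places p u v → pos w ≡ p ⊎ pos w ≡ suc p → w ≡ u ⊎ w ≡ v
  at-end w (inj₁ (e , e′)) (inj₁ x) = inj₁ (pos-injective (trans x (sym e)))
  at-end w (inj₁ (e , e′)) (inj₂ x) = inj₂ (pos-injective (trans x (sym e′)))
  at-end w (inj₂ (e , e′)) (inj₁ x) = inj₂ (pos-injective (trans x (sym e′)))
  at-end w (inj₂ (e , e′)) (inj₂ x) = inj₁ (pos-injective (trans x (sym e)))

  end-at : ∀ {p u v} w → Places p u v → w ≡ u ⊎ w ≡ v → pos w ≡ p ⊎ pos w ≡ suc p
  end-at w (inj₁ (e , e′)) (inj₁ refl) = inj₁ e
  end-at w (inj₁ (e , e′)) (inj₂ refl) = inj₂ e′
  end-at w (inj₂ (e , e′)) (inj₁ refl) = inj₂ e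
  end-at w (inj₂ (e , e′)) (inj₂ refl) = inj₁ e′

  bottom-end : ∀ {b c u v} → Chooses b u v → ¬ Forced b → (bot₀ , c) ≡ u ⊎ (bot₀ , c) ≡ v → ∃[ t ] Pendant c t
  bottom-end (pendantᶜ p) _  (inj₂ refl) = _ , p
  bottom-end (01ᶜ f)      ¬f _           = contradiction f ¬f
  bottom-end (02ᶜ f)      ¬f _           = contradiction f ¬f
  bottom-end (12ᶜ f)      ¬f _           = contradiction f ¬f
  bottom-end (linkᶜ _ _)  _  (inj₁ ())
  bottom-end (linkᶜ _ _)  _  (inj₂ ())

  core-end : ∀ {b t u v} → Chooses b u v → ¬ Forced b → CoreNbr b t → (top , t) ≡ u ⊎ (top , t) ≡ v
  core-end (linkᶜ l _)  _  n = [ inj₁ ∘ cong (top ,_) , inj₂ ∘ cong (top ,_) ]′ (link-ends l n)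
  core-end (pendantᶜ p) _  n = inj₁ (cong (top ,_) (sym (pendant-nbr p n)))
  core-end (01ᶜ f)      ¬f _ = contradiction f ¬f
  core-end (02ᶜ f)      ¬f _ = contradiction f ¬f
  core-end (12ᶜ f)      ¬f _ = contradiction f ¬f

  -- The position of a `bot₀` bounds a gap only if its vertex is pendant and thus has a core
  -- neighbour.
  star-off-gap : ∀ {b c p u v} → Chooses b u v → ¬ Forced b → Places p u v → (∀ t → ¬ CoreNbr c t) →
                 pos (bot₀ , c) ≡ p ⊎ pos (bot₀ , c) ≡ suc p → ⊥
  star-off-gap {c = c} ch ¬f pl none e =
    let t , n , _ = bottom-end ch ¬f (at-end (bot₀ , c) pl e) in none t n

  gap-unique : ∀ {b c p u v u′ v′} → Chooses b u v → Places p u v → Chooses c u′ v′ → Places p u′ v′ → b ≡ c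
  gap-unique {c = c} ch pl ch′ pl′ = chooses-unique ch (go pl pl′)
    where
    same : ∀ {u u′ p} → pos u ≡ p → pos u′ ≡ p → u′ ≡ u
    same e e′ = pos-injective (trans e′ (sym e))
    go : _ → _ → Chooses c _ _ ⊎ Chooses c _ _
    go (inj₁ (p , q)) (inj₁ (p′ , q′)) = inj₁ (subst₂ (Chooses c) (same p p′) (same q q′) ch′)
    go (inj₁ (p , q)) (inj₂ (p′ , q′)) = inj₂ (subst₂ (Chooses c) (same q p′) (same p q′) ch′)
    go (inj₂ (p , q)) (inj₁ (p′ , q′)) = inj₂ (subst₂ (Chooses c) (same q p′) (same p q′) ch′)
    go (inj₂ (p , q)) (inj₂ (p′ , q′)) = inj₁ (subst₂ (Chooses c) (same p p′) (same q q′) ch′)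

  same-top : ∀ t u {z} → z ≡ pos (top , t) * 4 + 1 → z ≡ pos (top , u) * 4 + 1 → t ≡ u
  same-top t u e e′ with refl ← pos-injective {top , t} {top , u} (same-point (pos (top , t)) (pos (top , u)) e e′) = refl

  top-off-star : ∀ t c {z} → z ≡ pos (top , t) * 4 + 1 → pos (bot₀ , c) * 4 + 0 ≤ z → z ≤ pos (bot₀ , c) * 4 + 2 → ⊥
  top-off-star t c {z} refl a b
    with () ← pos-injective {top , t} {bot₀ , c} (let i , j = inside-block (pos (top , t)) in
                block-unique (pos (top , t)) (pos (bot₀ , c)) {z} i j a b)

  star-off-top : ∀ t c {z} → z ≡ pos (bot₀ , c) * 4 + 1 → pos (top , t) * 4 + 0 ≤ z → z ≤ pos (top , t) * 4 + 2 → ⊥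
  star-off-top t c {z} refl a b
    with () ← pos-injective {top , t} {bot₀ , c} (let i , j = inside-block (pos (bot₀ , c)) in
                block-unique (pos (top , t)) (pos (bot₀ , c)) {z} a b i j)

  -- Copies and leaves are points in the middle zone of a top block, out of reach of bridges and of
  -- star blocks; there the offset names the bottom vertex, and a copy and a leaf differ in being
  -- exploded. Bridges with different starts are disjoint.
  bottom-unique : ∀ {r r′ s s′ z i} → BottomView r s → BottomView r′ s′ → InSpan s z i → InSpan s′ z i → r ≡ r′
  bottom-unique (copyᵛ {b} {t} _) (copyᵛ {c} {u} _) (e , f) (e′ , f′) =
    cong₂ cp (toℕ-injective (trans (sym f) f′)) (same-top t u e e′)
  bottom-unique (copyᵛ {b} b∈S) (shapeᵛ {c} c∉S (leaf t _ _)) (_ , f) (_ , f′) =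
    contradiction (subst (Subset._∈ S) (toℕ-injective (trans (sym f) f′)) b∈S) c∉S
  bottom-unique (shapeᵛ {c} c∉S (leaf t _ _)) (copyᵛ {b} b∈S) (_ , f) (_ , f′) =
    contradiction (subst (Subset._∈ S) (toℕ-injective (trans (sym f′) f)) b∈S) c∉S
  bottom-unique (copyᵛ {b} {t} _) (shapeᵛ _ (gap p _ _ _)) (e , _) (c , d) = ⊥-elim (off-bridge (pos (top , t)) p e c d)
  bottom-unique (shapeᵛ _ (gap p _ _ _)) (copyᵛ {b} {t} _) (c , d) (e , _) = ⊥-elim (off-bridge (pos (top , t)) p e c d)
  bottom-unique (copyᵛ {b} {t} _) (shapeᵛ {c} _ (star _)) (e , _) (x , y) = ⊥-elim (top-off-star t c e x y)
  bottom-unique (shapeᵛ {c} _ (star _)) (copyᵛ {b} {t} _) (x , y) (e , _) = ⊥-elim (top-off-star t c e x y)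
  bottom-unique (shapeᵛ _ (leaf _ _ _)) (shapeᵛ _ (leaf _ _ _)) (_ , f) (_ , f′) = cong bt (toℕ-injective (trans (sym f) f′))
  bottom-unique (shapeᵛ _ (leaf t _ _)) (shapeᵛ _ (gap p _ _ _)) (e , _) (c , d) = ⊥-elim (off-bridge (pos (top , t)) p e c d)
  bottom-unique (shapeᵛ _ (gap p _ _ _)) (shapeᵛ _ (leaf t _ _)) (c , d) (e , _) = ⊥-elim (off-bridge (pos (top , t)) p e c d)
  bottom-unique (shapeᵛ _ (leaf t _ _)) (shapeᵛ {c} _ (star _)) (e , _) (x , y) = ⊥-elim (top-off-star t c e x y)
  bottom-unique (shapeᵛ {c} _ (star _)) (shapeᵛ _ (leaf t _ _)) (x , y) (e , _) = ⊥-elim (top-off-star t c e x y)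
  bottom-unique (shapeᵛ {b} _ (gap p ch _ pl)) (shapeᵛ {c} _ (gap q ch′ _ pl′)) (x , y) (x′ , y′) =
    cong bt (gap-unique ch pl ch′ (subst (λ n → Places n _ _) (sym p≡q) pl′))
    where
    p≡q : p ≡ q
    p≡q = ≤-antisym (s≤s⁻¹ (4*-< {p} {suc q} (≤-trans x y′) (s≤s z≤n))) (s≤s⁻¹ (4*-< {q} {suc p} (≤-trans x′ y) (s≤s z≤n)))
  bottom-unique (shapeᵛ _ (gap p ch ¬f pl)) (shapeᵛ {c} _ (star none)) (x , y) (x′ , y′) =
    ⊥-elim (star-off-gap ch ¬f pl none (block≢bridge (pos (bot₀ , c)) p x′ y′ x y))
  bottom-unique (shapeᵛ {c} _ (star none)) (shapeᵛ _ (gap p ch ¬f pl)) (x′ , y′) (x , y) =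
    ⊥-elim (star-off-gap ch ¬f pl none (block≢bridge (pos (bot₀ , c)) p x′ y′ x y))
  bottom-unique (shapeᵛ {b} _ (star _)) (shapeᵛ {c} _ (star _)) (x , y) (x′ , y′)
    with refl ← pos-injective {bot₀ , b} {bot₀ , c} (block-unique (pos (bot₀ , b)) (pos (bot₀ , c)) x y x′ y′) = refl

  -- Hanging vertices avoid the blocks of top vertices, and among themselves the offset alone tells
  -- them apart.
  top-unique : ∀ {r r′ s s′ z i} → TopView r s → TopView r′ s′ → InSpan s z i → InSpan s′ z i → r ≡ r′
  top-unique (freeᵛ {t}) (freeᵛ {u}) (x , y) (x′ , y′)
    with refl ← pos-injective {top , t} {top , u} (block-unique (pos (top , t)) (pos (top , u)) x y x′ y′) = refl
  top-unique (freeᵛ {t}) (hangᵛ _ _ (gap p _ _ _)) (x , y) (e , _) = ⊥-elim (off-block p (pos (top , t)) e x y)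
  top-unique (hangᵛ _ _ (gap p _ _ _)) (freeᵛ {t}) (e , _) (x , y) = ⊥-elim (off-block p (pos (top , t)) e x y)
  top-unique (freeᵛ {t}) (hangᵛ {b} _ _ (star _)) (x , y) (e , _) = ⊥-elim (star-off-top t b e x y)
  top-unique (hangᵛ {b} _ _ (star _)) (freeᵛ {t}) (e , _) (x , y) = ⊥-elim (star-off-top t b e x y)
  top-unique freeᵛ (hangᵛ ed ¬c (leaf t (_ , c) only)) _ _ = contradiction (subst Core (sym (only _ ed)) c) ¬c
  top-unique (hangᵛ ed ¬c (leaf t (_ , c) only)) _ _ _ = contradiction (subst Core (sym (only _ ed)) c) ¬c
  top-unique (hangᵛ _ _ (gap _ _ _ _)) (hangᵛ ed ¬c (leaf t (_ , c) only)) _ _ = contradiction (subst Core (sym (only _ ed)) c) ¬c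
  top-unique (hangᵛ _ _ (star _)) (hangᵛ ed ¬c (leaf t (_ , c) only)) _ _ = contradiction (subst Core (sym (only _ ed)) c) ¬c
  top-unique (hangᵛ _ _ (gap _ _ _ _)) (hangᵛ _ _ (gap _ _ _ _)) (_ , f) (_ , f′) = cong tp (toℕ-injective (trans (sym f) f′))
  top-unique (hangᵛ _ _ (gap _ _ _ _)) (hangᵛ _ _ (star _))      (_ , f) (_ , f′) = cong tp (toℕ-injective (trans (sym f) f′))
  top-unique (hangᵛ _ _ (star _))      (hangᵛ _ _ (gap _ _ _ _)) (_ , f) (_ , f′) = cong tp (toℕ-injective (trans (sym f) f′))
  top-unique (hangᵛ _ _ (star _))      (hangᵛ _ _ (star _))      (_ , f) (_ , f′) = cong tp (toℕ-injective (trans (sym f) f′))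

  offsets : ℕ
  offsets = suc (card I top + card I bottom)

  top<offsets : ∀ (t : Top) → toℕ t < offsets
  top<offsets t = <-trans (toℕ<n t) (s≤s (m≤m+n _ _))

  bottom<offsets : ∀ (b : Bottom) → toℕ b < offsets
  bottom<offsets b = <-trans (toℕ<n b) (s≤s (m≤n+m _ _))

  Inhabited : Span → Set
  Inhabited s = ∃[ z ] ∃[ i ] (i < offsets × InSpan s z i)

  range-inhabited : ∀ {lo hi} → lo ≤ hi → Inhabited (range lo hi)
  range-inhabited {lo} le = lo , 0 , s≤s z≤n , ≤-refl , le

  bridge-range : ∀ p → p * 4 + 2 ≤ suc p * 4 + 0
  bridge-range p = ≤-trans (≤-reflexive (+-comm (p * 4) 2)) (≤-trans (+-monoˡ-≤ (p * 4) {2} {4} (s≤s (s≤s z≤n))) (m≤m+n _ 0))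

  block-range : ∀ p → p * 4 + 0 ≤ p * 4 + 2
  block-range p = +-monoʳ-≤ (p * 4) z≤n

  bottom-inhabited : ∀ {r s} → BottomView r s → Inhabited s
  bottom-inhabited (copyᵛ {b} _)                  = _ , _ , bottom<offsets b , refl , refl
  bottom-inhabited (shapeᵛ _ (gap p _ _ _))       = range-inhabited (bridge-range p)
  bottom-inhabited (shapeᵛ {b} _ (leaf _ _ _))    = _ , _ , bottom<offsets b , refl , refl
  bottom-inhabited (shapeᵛ {b} _ (star _))        = range-inhabited (block-range (pos (bot₀ , b)))

  top-inhabited : ∀ {r s} → TopView r s → Inhabited s
  top-inhabited (freeᵛ {t})                       = range-inhabited (block-range (pos (top , t)))
  top-inhabited (hangᵛ {t = t} _ _ (gap _ _ _ _)) = _ , _ , top<offsets t , refl , refl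
  top-inhabited (hangᵛ {t = t} _ _ (star _))      = _ , _ , top<offsets t , refl , refl
  top-inhabited (hangᵛ _ _ (leaf _ _ _))          = 0 , 0 , s≤s z≤n , refl , refl

  zones : ℕ
  zones = suc (proj₁ highest) * 4 + 3

  zone≤ : ∀ {p r} → p ≤ suc (proj₁ highest) → r ≤ 3 → p * 4 + r ≤ zones
  zone≤ p≤ r≤ = +-mono-≤ (*-monoˡ-≤ 4 p≤) r≤

  pos≤ : ∀ u → pos u ≤ suc (proj₁ highest)
  pos≤ u = m≤n⇒m≤1+n (proj₂ highest u)

  gap≤ : ∀ {p u v} → Places p u v → suc p ≤ suc (proj₁ highest)
  gap≤ {u = u} (inj₁ (e , _)) = s≤s (≤-trans (≤-reflexive (sym e)) (proj₂ highest u))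
  gap≤ {v = v} (inj₂ (_ , e)) = s≤s (≤-trans (≤-reflexive (sym e)) (proj₂ highest v))

  Bounded : Span → Set
  Bounded s = ∀ {z i} → InSpan s z i → z ≤ zones

  bottom-bounded : ∀ {b} (f : Fate b) → Bounded (bottom-span f)
  bottom-bounded (inj₁ _) (_ , y)                   = ≤-trans y z≤n
  bottom-bounded (inj₂ (gap p _ _ pl)) (_ , y)      = ≤-trans y (zone≤ (gap≤ pl) z≤n)
  bottom-bounded (inj₂ (leaf t _ _)) (refl , _)     = zone≤ (pos≤ (top , t)) (s≤s z≤n)
  bottom-bounded {b} (inj₂ (star _)) (_ , y)        = ≤-trans y (zone≤ (pos≤ (bot₀ , b)) (s≤s (s≤s z≤n)))

  hang-bounded : ∀ {b} (f : Fate b) t → Bounded (hang f t)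
  hang-bounded (inj₁ _)              t (refl , _) = z≤n
  hang-bounded (inj₂ (gap p _ _ pl)) t (refl , _) = zone≤ (≤-trans (n≤1+n p) (gap≤ pl)) ≤-refl
  hang-bounded (inj₂ (leaf _ _ _))   t (refl , _) = z≤n
  hang-bounded {b} (inj₂ (star _))   t (refl , _) = zone≤ (pos≤ (bot₀ , b)) (s≤s z≤n)

  span-bounded : ∀ r → Bounded (span r)
  span-bounded (tp t) = go (attached? t)
    where
    go : (d : Dec (Attached t)) → Bounded (top-span t d)
    go (yes (b , _)) = hang-bounded (fate b) t
    go (no _) (_ , y) = ≤-trans y (zone≤ (pos≤ (top , t)) (s≤s (s≤s z≤n)))
  span-bounded (bt b)   = bottom-bounded (fate b)
  span-bounded (cp b t) (refl , _) = zone≤ (pos≤ (top , t)) (s≤s z≤n)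

  Meet : Span → Span → Set
  Meet s s′ = ∃[ z ] ∃[ i ] (i < offsets × InSpan s z i × InSpan s′ z i)

  attached-only : ∀ {t b c} → ¬ Core t → Edge t b → Edge t c → b ≡ c
  attached-only {t} {b} {c} ¬c e e′ = decidable-stable (b Fin.≟ c) (λ b≢c → ¬c (core b≢c e e′))

  free-block : Top → Span
  free-block t = range (pos (top , t) * 4 + 0) (pos (top , t) * 4 + 2)

  meet-point : ∀ (b : Bottom) t → Meet (free-block t) (point (pos (top , t) * 4 + 1) (toℕ b))
  meet-point b t = _ , _ , bottom<offsets b , inside-block (pos (top , t)) , refl , refl

  meet-gap : ∀ {p} t → pos (top , t) ≡ p ⊎ pos (top , t) ≡ suc p →
             Meet (free-block t) (range (p * 4 + 2) (suc p * 4 + 0))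
  meet-gap {p} t (inj₁ e) = p * 4 + 2 , 0 , s≤s z≤n ,
    subst (λ q → q * 4 + 0 ≤ p * 4 + 2 × p * 4 + 2 ≤ q * 4 + 2) (sym e) (block-range p , ≤-refl) , ≤-refl , bridge-range p
  meet-gap {p} t (inj₂ e) = suc p * 4 + 0 , 0 , s≤s z≤n ,
    subst (λ q → q * 4 + 0 ≤ suc p * 4 + 0 × suc p * 4 + 0 ≤ q * 4 + 2) (sym e) (≤-refl , block-range (suc p)) ,
    bridge-range p , ≤-refl

  meet-bottom : ∀ {t b} → b Subset.∉ S → Edge t b → Meet (span (tp t)) (span (bt b))
  meet-bottom {t} {b} b∉S e = go (attached? t)
    where
    hanging : ¬ Core t → (f : Fate b) → Meet (hang f t) (bottom-span f)
    hanging ¬c (inj₁ b∈S)              = contradiction b∈S b∉S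
    hanging ¬c (inj₂ (gap p _ _ _))    = p * 4 + 3 , toℕ t , top<offsets t , (refl , refl) ,
      +-monoʳ-≤ (p * 4) (s≤s (s≤s z≤n)) ,
      ≤-trans (≤-reflexive (+-comm (p * 4) 3)) (≤-trans (n≤1+n _) (m≤m+n _ 0))
    hanging ¬c (inj₂ (leaf u (_ , c) only)) = contradiction (subst Core (sym (only t e)) c) ¬c
    hanging ¬c (inj₂ (star _))         = _ , _ , top<offsets t , (refl , refl) , inside-block (pos (bot₀ , b))
    free : Core t → (f : Fate b) → Meet (free-block t) (bottom-span f)
    free c (inj₁ b∈S)              = contradiction b∈S b∉S
    free c (inj₂ (gap p ch ¬f pl)) = meet-gap t (end-at (top , t) pl (core-end ch ¬f (e , c)))
    free c (inj₂ (leaf u _ only))  = subst (λ u → Meet (free-block t) (point (pos (top , u) * 4 + 1) (toℕ b))) (only t e) (meet-point b t)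
    free c (inj₂ (star none))      = contradiction (e , c) (none t)
    go : (d : Dec (Attached t)) → Meet (top-span t d) (bottom-span (fate b))
    -- `attached?` may have found any neighbour, but a noncore `t` has only one.
    go (yes (c , _ , e′ , ¬c)) =
      subst (λ c → Meet (hang (fate c) t) (bottom-span (fate b))) (attached-only ¬c e e′) (hanging ¬c (fate b))
    go (no ¬a) = free (decidable-stable (core? t) (λ ¬c → ¬a (b , b∉S , e , ¬c))) (fate b)

  meet-copy : ∀ {t b} → b Subset.∈ S → Edge t b → Meet (span (tp t)) (span (cp b t))
  meet-copy {t} {b} b∈S e = go (attached? t)
    where
    go : (d : Dec (Attached t)) → Meet (top-span t d) (span (cp b t))
    go (yes (c , c∉S , e′ , ¬c)) = contradiction (subst (Subset._∈ S) (attached-only ¬c e e′) b∈S) c∉S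
    go (no _)                    = meet-point b t

  Meet-sym : ∀ {s s′} → Meet s s′ → Meet s′ s
  Meet-sym (z , i , i< , p , q) = z , i , i< , q , p

  meet : ∀ r r′ → ValidRole (proj₁ I) S r → ValidRole (proj₁ I) S r′ → RoleAdj (proj₁ I) S r r′ → Meet (span r) (span r′)
  meet (tp t)   (bt b)    _ b∉S e             = meet-bottom b∉S e
  meet (tp t)   (cp b .t) _ (b∈S , e) refl    = meet-copy b∈S e
  meet (bt b)   (tp t)    b∉S _ e             = Meet-sym {span (tp t)} {span (bt b)} (meet-bottom b∉S e)
  meet (cp b t) (tp .t)   (b∈S , e) _ refl    = Meet-sym {span (tp t)} {span (cp b t)} (meet-copy b∈S e)

  open Roles (roles (proj₁ I) S)

  K : Graph
  K = explodeBottom (proj₁ I) S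

  Covers : ℕ → Graph.Vertex K → Set
  Covers x v = InSpan (span (role v)) (x / offsets) (x % offsets)

  div-mod : ∀ x → x / offsets * offsets + x % offsets ≡ x
  div-mod x = trans (+-comm _ (x % offsets)) (sym (m≡m%n+[m/n]*n x offsets))

  locate : ∀ z {i} → i < offsets → (z * offsets + i) / offsets ≡ z × (z * offsets + i) % offsets ≡ i
  locate z {i} i< = quotient-unique offsets ((z * offsets + i) / offsets) z (div-mod (z * offsets + i)) (m%n<n (z * offsets + i) offsets) i<

  relocate : ∀ s {z i} → i < offsets → InSpan s z i → InSpan s ((z * offsets + i) / offsets) ((z * offsets + i) % offsets)
  relocate s {z} i< p = let e , e′ = locate z i< in subst₂ (InSpan s) (sym e) (sym e′) p

  -- A `range` ignores offsets, and division is monotone; a `point` corresponds to a single number.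
  convex : ∀ s {x y w} → x ≤ y → y ≤ w → InSpan s (x / offsets) (x % offsets) → InSpan s (w / offsets) (w % offsets) →
           InSpan s (y / offsets) (y % offsets)
  convex (range lo hi) x≤y y≤w (p , _) (_ , q) = ≤-trans p (/-monoˡ-≤ offsets x≤y) , ≤-trans (/-monoˡ-≤ offsets y≤w) q
  convex (point z i) {x} {y} {w} x≤y y≤w (p , p′) (q , q′) =
    subst (λ n → n / offsets ≡ z × n % offsets ≡ i) (≤-antisym x≤y (≤-trans y≤w (≤-reflexive w≡x))) (p , p′)
    where
    w≡x : w ≡ x
    w≡x = trans (sym (div-mod w)) (trans (cong₂ (λ u v → u * offsets + v) (trans q (sym p)) (trans q′ (sym p′))) (div-mod x))

  -- The vertices of `K` are searched through their roles, which range over finite types.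
  role-any? : {P : Role (proj₁ I) S → Set} → (∀ r → Dec (P r)) → Dec (∃[ v ] P (role v))
  role-any? {P} P? = map′ to from
    (any? (λ t → P? (tp t)) ⊎-dec
     (any? (λ b → ¬? (b ∈? S) ×-dec P? (bt b)) ⊎-dec
      any? (λ b → any? (λ t → (b ∈? S ×-dec edge? t b) ×-dec P? (cp b t)))))
    where
    find : ∀ r → ValidRole (proj₁ I) S r → P r → ∃[ v ] P (role v)
    find r ok p = let v , e = role-surjective r ok in v , subst P (sym e) p
    to : _ → ∃[ v ] P (role v)
    to (inj₁ (t , p))                        = find (tp t) tt p
    to (inj₂ (inj₁ (b , b∉S , p)))           = find (bt b) b∉S p
    to (inj₂ (inj₂ (b , t , (b∈S , e) , p))) = find (cp b t) (b∈S , e) p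
    classify : ∀ r → ValidRole (proj₁ I) S r → P r → _
    classify (tp t)   _         p = inj₁ (t , p)
    classify (bt b)   b∉S       p = inj₂ (inj₁ (b , b∉S , p))
    classify (cp b t) (b∈S , e) p = inj₂ (inj₂ (b , t , (b∈S , e) , p))
    from : ∃[ v ] P (role v) → _
    from (v , p) = classify (role v) (role-valid v) p

  view-inhabited : ∀ r → ValidRole (proj₁ I) S r → Inhabited (span r)
  view-inhabited r ok = go (is-top r) refl
    where
    go : ∀ b → is-top r ≡ b → Inhabited (span r)
    go true  e = top-inhabited (top-view r e)
    go false e = bottom-inhabited (bottom-view r ok e)

  view-unique : ∀ r r′ → ValidRole (proj₁ I) S r → ValidRole (proj₁ I) S r′ → is-top r ≡ is-top r′ →
                ∀ {z i} → InSpan (span r) z i → InSpan (span r′) z i → r ≡ r′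
  view-unique r r′ ok ok′ same = go (is-top r) refl
    where
    go : ∀ b → is-top r ≡ b → ∀ {z i} → InSpan (span r) z i → InSpan (span r′) z i → r ≡ r′
    go true  e = top-unique (top-view r e) (top-view r′ (trans (sym same) e))
    go false e = bottom-unique (bottom-view r ok e) (bottom-view r′ ok′ (trans (sym same) e))

  pathwidth : PathwidthAtMost 1 K
  pathwidth = Covering.covering⇒pathwidth K Covers (is-top ∘ role) (suc zones * offsets)
    (λ s x → role-any? {λ r → is-top r ≡ s × InSpan (span r) (x / offsets) (x % offsets)}
               (λ r → (is-top r Bool.≟ s) ×-dec inSpan? (span r) _ _))
    (λ {x} {u} {v} e c c′ → role-injective (view-unique (role u) (role v) (role-valid u) (role-valid v) e c c′))
    (λ {x} {v} c → subst (_< suc zones * offsets) (div-mod x)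
      (<-≤-trans (+-monoʳ-< (x / offsets * offsets) (m%n<n x offsets))
        (≤-trans (≤-reflexive (+-comm _ offsets)) (*-monoˡ-≤ offsets (s≤s (span-bounded (role v) c))))))
    (λ v → let z , i , i< , p = view-inhabited (role v) (role-valid v) in
      z * offsets + i , relocate (span (role v)) i< p)
    (λ {u} {v} a → let z , i , i< , p , q = meet (role u) (role v) (role-valid u) (role-valid v) (Equivalence.to (role-adjacent u v) a) in
      z * offsets + i , relocate (span (role u)) i< p , relocate (span (role v)) i< q)
    (λ {x} {y} {z} {v} x≤y y≤z → convex (span (role v)) x≤y y≤z)

-- The two reductions

restricted : ParameterPreservingReduction RestrictedBOVE RestrictedCPS
restricted = record
  { reduce    = λ (I , k) → (Instances.target I , Instances.deletable I) , k
  ; poly-time = restricted-poly-time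
  ; parameter = λ I k → ≤-refl
  ; correct   = λ I k → mk⇔
      (λ (S , S⊆X , S≤k , narrow) → let open Forward I S S⊆X narrow in
        deletions , deletions⊆deletable , ≤-trans cost S≤k , linear)
      (λ (D , D⊆X , D≤k , linear) → let open Backward I D D⊆X linear in
        S , S⊆X , ≤-trans cost D≤k , pathwidth)
  }

module _ (G : BipartiteGraph) where
  open Instances (full G)

  full-in : ∀ b → In b
  full-in b = ∈⇒In (full G) ∈⊤

  full-allowed : ∀ u v → Adj u v → Allowed u v
  full-allowed (top  , t) (top  , t′) _ (b , _ , b∉X) = b∉X (full-in b)
  full-allowed (top  , t) (bot₀ , b)  _ = tt , full-in b
  full-allowed (bot₀ , b) (top  , t)  _ = full-in b , tt
  full-allowed (bot₀ , b) (bot₁ , b′) _ = full-in b , full-in b′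
  full-allowed (bot₀ , b) (bot₂ , b′) _ = full-in b , full-in b′
  full-allowed (bot₁ , b) (bot₀ , b′) _ = full-in b , full-in b′
  full-allowed (bot₁ , b) (bot₂ , b′) _ = full-in b , full-in b′
  full-allowed (bot₂ , b) (bot₀ , b′) _ = full-in b , full-in b′
  full-allowed (bot₂ , b) (bot₁ , b′) _ = full-in b , full-in b′

  -- With `X` full every edge of the target may be deleted, so `Forward` and `Backward` also serve
  -- the unrestricted problems.
  full-deletable : (D : EdgeSet (Instances.target (full G))) → D ⊆ᴱ Instances.deletable (full G)
  full-deletable D i j m = let a = matrix-sound adjᶠ i j (EdgeSet.mem-adj D i j m) in
    matrix-complete deletableᶠ i j (a , full-allowed (V i) (V j) a)

unrestricted : ParameterPreservingReduction BOVE CPS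
unrestricted = record
  { reduce    = λ (G , k) → Instances.target (full G) , k
  ; poly-time = unrestricted-poly-time
  ; parameter = λ G k → ≤-refl
  ; correct   = λ G k → mk⇔
      (λ (S , S≤k , narrow) → let open Forward (full G) S (λ _ → ∈⊤) narrow in
        deletions , ≤-trans cost S≤k , linear)
      (λ (D , D≤k , linear) → let open Backward (full G) D (full-deletable G D) linear in
        S , ≤-trans cost D≤k , pathwidth)
  }

lemma2 : ParameterPreservingReduction BOVE CPS × ParameterPreservingReduction RestrictedBOVE RestrictedCPS
lemma2 = unrestricted , restricted
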